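{- Let $F$ be a nonarchimedean local field with residue field $\mathbb{F}_q$, $B$ the quaternion division $F$-algebra with maximal order $O_B$ and uniformizer $\Pi$ chosen as in the context. Taking the right truncation $L/L\Pi$ of an $(O_B,O_B)$-bilattice $L$ induces a one-to-one correspondence between the set of isomorphism classes of $(O_B,O_B)$-bilattices and the set of isomorphism classes of finitely generated $(\mathbb{F}_{q^2}[\varepsilon],\mathbb{F}_{q^2})$-bimodules. By symmetry, the same holds true if the right truncation $L/L\Pi$ and the $(\mathbb{F}_{q^2}[\varepsilon],\mathbb{F}_{q^2})$-bimodules are replaced respectively by the left truncation $L/\Pi L$ and the $(\mathbb{F}_{q^2},\mathbb{F}_{q^2}[\varepsilon])$-bimodules.
   Context: An $(O_B,O_B)$-bilattice is a finitely generated $O_F$-torsion-free $(O_B,O_B)$-bimodule with agreeing left and right $O_F$-actions. Let $K$ be the unramified quadratic extension of $F$, with nontrivial automorphism $\sigma$, embedded in $B$; $\pi$ is a uniformizer of $F$ and $\Pi\in O_B$ satisfies $O_B=O_K\oplus O_K\Pi$, $\Pi^2=\pi$, $\Pi a=a^\sigma\Pi$ for $a\in O_K$. Then $O_B/\Pi O_B=\mathbb{F}_{q^2}$ and $O_B/\pi O_B=\mathbb{F}_{q^2}[\varepsilon]=\mathbb{F}_{q^2}\oplus\mathbb{F}_{q^2}\varepsilon$, where $\varepsilon$ is the image of $\Pi$, with $\varepsilon^2=0$ and $\varepsilon a=a^q\varepsilon$ for $a\in\mathbb{F}_{q^2}$. The quotient $L/L\Pi$ is an $(O_B/\pi O_B,O_B/\Pi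 O_B)=(\mathbb{F}_{q^2}[\varepsilon],\mathbb{F}_{q^2})$-bimodule, and $L/\Pi L$ is an $(\mathbb{F}_{q^2},\mathbb{F}_{q^2}[\varepsilon])$-bimodule. All bimodules over these $\mathbb{F}_q$-algebras have agreeing left and right $\mathbb{F}_q$-actions. -}

module Defs where

open import Algebra.Bundles using (AbelianGroup; Ring; CommutativeRing)
open import Algebra.Module.Bundles using (Bimodule)
open import Algebra.Module.Morphism.Structures using (module BimoduleMorphisms)
open import Algebra.Morphism.Structures using (module RingMorphisms)
import Algebra.Properties.AbelianGroup as AbelianGroupProperties
import Algebra.Properties.CommutativeMonoid.Sum as Sum
import Algebra.Properties.CommutativeSemigroup as CommutativeSemigroupProperties
import Algebra.Properties.Ring as RingProperties
open import Data.Empty using (⊥-elim)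
open import Data.Fin.Base using (Fin)
open import Data.Integer.Base as ℤ using (ℤ; +_; -[1+_]; 0ℤ; 1ℤ)
import Data.Integer.Properties as ℤ
open import Data.Nat.Base as ℕ using (ℕ; z≤n; s≤s)
open import Data.Product.Base using (Σ; ∃; ∃-syntax; _×_; _,_; proj₁; proj₂)
open import Function.Bundles using (Bijection)
open import Level using (Level; _⊔_; suc; 0ℓ)
open import Relation.Binary.Construct.Add.Supremum.NonStrict ℤ._≤_
  using (_≤⁺_; [_]; _≤⊤⁺)
open import Relation.Binary.PropositionalEquality.Core as ≡ using (_≡_)
import Relation.Binary.PropositionalEquality.Properties as ≡
import Relation.Binary.Reasoning.Setoid as SetoidReasoning
open import Relation.Nullary.Construct.Add.Supremum using (_⁺; ⊤⁺; [_])
open import Relation.Nullary.Negation.Core using (¬_)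
open import Relation.Unary using (Pred; _∈_; _⊆_)

private
  variable
    c ℓ ℓ′ p : Level

-- Quotients are setoid quotients: same carrier, with equality coarsened to
-- "the difference lies in the given subobject".

record IsSubgroup (A : AbelianGroup c ℓ) (H : Pred (AbelianGroup.Carrier A) p)
                  : Set (c ⊔ ℓ ⊔ p) where
  open AbelianGroup A
  field
    resp : ∀ {x y} → x ≈ y → H x → H y
    ε∈   : H ε
    ∙∈   : ∀ {x y} → H x → H y → H (x ∙ y)
    ⁻¹∈  : ∀ {x} → H x → H (x ⁻¹)

module AbelianQuotient (A : AbelianGroup c ℓ)
                       {H : Pred (AbelianGroup.Carrier A) p}
                       (isSubgroup : IsSubgroup A H) where
  open AbelianGroup A
  open IsSubgroup isSubgroup
  open AbelianGroupProperties A
  open CommutativeSemigroupProperties commutativeSemigroup using (interchange)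
  open SetoidReasoning setoid

  infix 4 _≋_
  _≋_ : Carrier → Carrier → Set p
  x ≋ y = H (x ∙ y ⁻¹)

  ≈⇒≋ : ∀ {x y} → x ≈ y → x ≋ y
  ≈⇒≋ {x} {y} x≈y = resp (sym (trans (∙-congʳ x≈y) (inverseʳ y))) ε∈

  ≋-sym : ∀ {x y} → x ≋ y → y ≋ x
  ≋-sym {x} {y} h = resp (⁻¹-anti-homo‿- x y) (⁻¹∈ h)

  ≋-trans : ∀ {x y z} → x ≋ y → y ≋ z → x ≋ z
  ≋-trans {x} {y} {z} h k = resp eq (∙∈ h k)
    where
    eq : (x ∙ y ⁻¹) ∙ (y ∙ z ⁻¹) ≈ x ∙ z ⁻¹
    eq = begin
      (x ∙ y ⁻¹) ∙ (y ∙ z ⁻¹)  ≈⟨ assoc x (y ⁻¹) (y ∙ z ⁻¹) ⟩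
      x ∙ (y ⁻¹ ∙ (y ∙ z ⁻¹))  ≈⟨ ∙-congˡ (sym (assoc (y ⁻¹) y (z ⁻¹))) ⟩
      x ∙ ((y ⁻¹ ∙ y) ∙ z ⁻¹)  ≈⟨ ∙-congˡ (∙-congʳ (inverseˡ y)) ⟩
      x ∙ (ε ∙ z ⁻¹)           ≈⟨ ∙-congˡ (identityˡ (z ⁻¹)) ⟩
      x ∙ z ⁻¹                 ∎

  ≋-∙-cong : ∀ {x y u v} → x ≋ y → u ≋ v → (x ∙ u) ≋ (y ∙ v)
  ≋-∙-cong {x} {y} {u} {v} h k = resp eq (∙∈ h k)
    where
    eq : (x ∙ y ⁻¹) ∙ (u ∙ v ⁻¹) ≈ (x ∙ u) ∙ (y ∙ v) ⁻¹
    eq = begin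
      (x ∙ y ⁻¹) ∙ (u ∙ v ⁻¹)  ≈⟨ interchange x (y ⁻¹) u (v ⁻¹) ⟩
      (x ∙ u) ∙ (y ⁻¹ ∙ v ⁻¹)  ≈⟨ ∙-congˡ (⁻¹-∙-comm y v) ⟩
      (x ∙ u) ∙ (y ∙ v) ⁻¹     ∎

  ≋-⁻¹-cong : ∀ {x y} → x ≋ y → (x ⁻¹) ≋ (y ⁻¹)
  ≋-⁻¹-cong {x} {y} h = resp (sym (⁻¹-∙-comm x (y ⁻¹))) (⁻¹∈ h)

  quotient : AbelianGroup c p
  quotient = record
    { Carrier = Carrier ; _≈_ = _≋_ ; _∙_ = _∙_ ; ε = ε ; _⁻¹ = _⁻¹
    ; isAbelianGroup = record
      { isGroup = record
        { isMonoid = record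
          { isSemigroup = record
            { isMagma = record
              { isEquivalence = record
                { refl  = λ {x} → ≈⇒≋ {x} refl
                ; sym   = λ {x} {y} → ≋-sym {x} {y}
                ; trans = λ {x} {y} {z} → ≋-trans {x} {y} {z}
                }
              ; ∙-cong = λ {x} {y} {u} {v} → ≋-∙-cong {x} {y} {u} {v}
              }
            ; assoc = λ x y z → ≈⇒≋ (assoc x y z)
            }
          ; identity = (λ x → ≈⇒≋ (identityˡ x)) , (λ x → ≈⇒≋ (identityʳ x))
          }
        ; inverse = (λ x → ≈⇒≋ (inverseˡ x)) , (λ x → ≈⇒≋ (inverseʳ x))
        ; ⁻¹-cong = λ {x} {y} → ≋-⁻¹-cong {x} {y}
        }
      ; comm = λ x y → ≈⇒≋ (comm x y)
      }
    }

record IsSubring (R : Ring c ℓ) (S : Pred (Ring.Carrier R) p)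
                 : Set (c ⊔ ℓ ⊔ p) where
  open Ring R
  field
    resp : ∀ {x y} → x ≈ y → S x → S y
    0∈   : S 0#
    1∈   : S 1#
    +∈   : ∀ {x y} → S x → S y → S (x + y)
    *∈   : ∀ {x y} → S x → S y → S (x * y)
    -∈   : ∀ {x} → S x → S (- x)

subring : (R : Ring c ℓ) {S : Pred (Ring.Carrier R) p} →
          IsSubring R S → Ring (c ⊔ p) ℓ
subring R {S} isSubring = record
  { Carrier = Σ Carrier S
  ; _≈_ = λ x y → proj₁ x ≈ proj₁ y
  ; _+_ = λ (x , s) (y , t) → x + y , +∈ s t
  ; _*_ = λ (x , s) (y , t) → x * y , *∈ s t
  ; -_  = λ (x , s) → - x , -∈ s
  ; 0#  = 0# , 0∈
  ; 1#  = 1# , 1∈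
  ; isRing = record
    { +-isAbelianGroup = record
      { isGroup = record
        { isMonoid = record
          { isSemigroup = record
            { isMagma = record
              { isEquivalence = record { refl = refl ; sym = sym ; trans = trans }
              ; ∙-cong = +-cong
              }
            ; assoc = λ (x , _) (y , _) (z , _) → +-assoc x y z
            }
          ; identity = (λ (x , _) → +-identityˡ x) , (λ (x , _) → +-identityʳ x)
          }
        ; inverse = (λ (x , _) → -‿inverseˡ x) , (λ (x , _) → -‿inverseʳ x)
        ; ⁻¹-cong = -‿cong
        }
      ; comm = λ (x , _) (y , _) → +-comm x y
      }
    ; *-cong = *-cong
    ; *-assoc = λ (x , _) (y , _) (z , _) → *-assoc x y z
    ; *-identity = (λ (x , _) → *-identityˡ x) , (λ (x , _) → *-identityʳ x)
    ; distrib = (λ (x , _) (y , _) (z , _) → distribˡ x y z)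
              , (λ (x , _) (y , _) (z , _) → distribʳ x y z)
    }
  }
  where
  open Ring R
  open IsSubring isSubring

record IsIdeal (R : Ring c ℓ) (I : Pred (Ring.Carrier R) p)
               : Set (c ⊔ ℓ ⊔ p) where
  open Ring R
  field
    isSubgroup : IsSubgroup +-abelianGroup I
    *∈ˡ        : ∀ r {x} → I x → I (r * x)
    *∈ʳ        : ∀ r {x} → I x → I (x * r)

quotientRing : (R : Ring c ℓ) {I : Pred (Ring.Carrier R) p} →
               IsIdeal R I → Ring c p
quotientRing R {I} isIdeal = record
  { Carrier = Carrier ; _≈_ = _≋_ ; _+_ = _+_ ; _*_ = _*_ ; -_ = -_
  ; 0# = 0# ; 1# = 1#
  ; isRing = record
    { +-isAbelianGroup = AbelianGroup.isAbelianGroup quotient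
    ; *-cong = λ {x} {y} {u} {v} → mul-cong {x} {y} {u} {v}
    ; *-assoc = λ x y z → ≈⇒≋ (*-assoc x y z)
    ; *-identity = (λ x → ≈⇒≋ (*-identityˡ x)) , (λ x → ≈⇒≋ (*-identityʳ x))
    ; distrib = (λ x y z → ≈⇒≋ (distribˡ x y z))
              , (λ x y z → ≈⇒≋ (distribʳ x y z))
    }
  }
  where
  open Ring R
  open IsIdeal isIdeal
  open IsSubgroup isSubgroup using (resp)
  open AbelianQuotient +-abelianGroup isSubgroup
  open RingProperties R using (x[y-z]≈xy-xz; [y-z]x≈yx-zx)

  mul-cong : ∀ {x y u v} → x ≋ y → u ≋ v → (x * u) ≋ (y * v)
  mul-cong {x} {y} {u} {v} h k =
    ≋-trans {x * u} {y * u} {y * v}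
      (resp ([y-z]x≈yx-zx u x y) (*∈ʳ u h))
      (resp (x[y-z]≈xy-xz y u v) (*∈ˡ y k))

module _ {r s : Level} {R : Ring r ℓ} {S : Ring s ℓ′} where
  private
    module R = Ring R
    module S = Ring S

  infix 4 _≅_
  _≅_ : ∀ {m n ℓm ℓn} → Bimodule R S m ℓm → Bimodule R S n ℓn →
        Set (r ⊔ s ⊔ m ⊔ n ⊔ ℓm ⊔ ℓn)
  M ≅ N = ∃ IsBimoduleIsomorphism
    where open BimoduleMorphisms (Bimodule.rawBimodule M) (Bimodule.rawBimodule N)

  module _ {m ℓm : Level} (M : Bimodule R S m ℓm) where
    open Bimodule M

    data Span {n : ℕ} (g : Fin n → Carrierᴹ) : Pred Carrierᴹ (r ⊔ s ⊔ m ⊔ ℓm) where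
      gen  : ∀ i → Span g (g i)
      zero : Span g 0ᴹ
      add  : ∀ {x y} → Span g x → Span g y → Span g (x +ᴹ y)
      actₗ : ∀ a {x} → Span g x → Span g (a *ₗ x)
      actᵣ : ∀ b {x} → Span g x → Span g (x *ᵣ b)
      resp : ∀ {x y} → x ≈ᴹ y → Span g x → Span g y

    FinitelyGenerated : Set (r ⊔ s ⊔ m ⊔ ℓm)
    FinitelyGenerated = ∃[ n ] ∃ λ (g : Fin n → Carrierᴹ) → ∀ x → x ∈ Span g

    -- The left and right actions of Z, given through maps to R and S, agree.
    ActionsAgree : ∀ {z} {Z : Set z} → (Z → R.Carrier) → (Z → S.Carrier) →
                   Set (z ⊔ m ⊔ ℓm)
    ActionsAgree f g = ∀ z x → f z *ₗ x ≈ᴹ x *ᵣ g z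

    record IsSubBimodule (N : Pred Carrierᴹ p) : Set (r ⊔ s ⊔ m ⊔ ℓm ⊔ p) where
      field
        isSubgroup : IsSubgroup +ᴹ-abelianGroup N
        *ₗ∈        : ∀ a {x} → N x → N (a *ₗ x)
        *ᵣ∈        : ∀ b {x} → N x → N (x *ᵣ b)

module _ {r s : Level} {R : Ring r ℓ} {S : Ring s ℓ′} where
  private
    module R = Ring R
    module S = Ring S

  -- M/N as an (R/I, S/J)-bimodule, when IM ⊆ N and MJ ⊆ N.
  quotientBimodule :
    ∀ {m ℓm i j} (M : Bimodule R S m ℓm)
    {N : Pred (Bimodule.Carrierᴹ M) p} → IsSubBimodule M N →
    {I : Pred R.Carrier i} (isIdealI : IsIdeal R I) →
    {J : Pred S.Carrier j} (isIdealJ : IsIdeal S J) →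
    (∀ {a} x → I a → N (Bimodule._*ₗ_ M a x)) →
    (∀ {b} x → J b → N (Bimodule._*ᵣ_ M x b)) →
    Bimodule (quotientRing R isIdealI) (quotientRing S isIdealJ) m p
  quotientBimodule M {N} isSub {I} _ {J} _ IM⊆N MJ⊆N = record
    { Carrierᴹ = Carrierᴹ ; _≈ᴹ_ = _≋_ ; _+ᴹ_ = _+ᴹ_ ; _*ₗ_ = _*ₗ_ ; _*ᵣ_ = _*ᵣ_
    ; 0ᴹ = 0ᴹ ; -ᴹ_ = -ᴹ_
    ; isBimodule = record
      { isBisemimodule = record
        { +ᴹ-isCommutativeMonoid = AbelianGroup.isCommutativeMonoid quotient
        ; isPreleftSemimodule = record
          { *ₗ-cong = λ {a} {b} {x} {y} → left-cong {a} {b} {x} {y}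
          ; *ₗ-zeroˡ = λ x → ≈⇒≋ (*ₗ-zeroˡ x)
          ; *ₗ-distribʳ = λ x a b → ≈⇒≋ (*ₗ-distribʳ x a b)
          ; *ₗ-identityˡ = λ x → ≈⇒≋ (*ₗ-identityˡ x)
          ; *ₗ-assoc = λ a b x → ≈⇒≋ (*ₗ-assoc a b x)
          ; *ₗ-zeroʳ = λ a → ≈⇒≋ (*ₗ-zeroʳ a)
          ; *ₗ-distribˡ = λ a x y → ≈⇒≋ (*ₗ-distribˡ a x y)
          }
        ; isPrerightSemimodule = record
          { *ᵣ-cong = λ {x} {y} {a} {b} → right-cong {x} {y} {a} {b}
          ; *ᵣ-zeroʳ = λ x → ≈⇒≋ (*ᵣ-zeroʳ x)
          ; *ᵣ-distribˡ = λ x a b → ≈⇒≋ (*ᵣ-distribˡ x a b)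
          ; *ᵣ-identityʳ = λ x → ≈⇒≋ (*ᵣ-identityʳ x)
          ; *ᵣ-assoc = λ x a b → ≈⇒≋ (*ᵣ-assoc x a b)
          ; *ᵣ-zeroˡ = λ a → ≈⇒≋ (*ᵣ-zeroˡ a)
          ; *ᵣ-distribʳ = λ a x y → ≈⇒≋ (*ᵣ-distribʳ a x y)
          }
        ; *ₗ-*ᵣ-assoc = λ a x b → ≈⇒≋ (*ₗ-*ᵣ-assoc a x b)
        }
      ; -ᴹ‿cong = λ {x} {y} → ≋-⁻¹-cong {x} {y}
      ; -ᴹ‿inverse = (λ x → ≈⇒≋ (-ᴹ‿inverseˡ x)) , (λ x → ≈⇒≋ (-ᴹ‿inverseʳ x))
      }
    }
    where
    open Bimodule M
    open IsSubBimodule isSub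
    open IsSubgroup isSubgroup using () renaming (resp to N-resp)
    open AbelianQuotient +ᴹ-abelianGroup isSubgroup
    open AbelianGroupProperties +ᴹ-abelianGroup using (inverseʳ-unique)

    *ₗ-neg : ∀ a x → a *ₗ (-ᴹ x) ≈ᴹ -ᴹ (a *ₗ x)
    *ₗ-neg a x = inverseʳ-unique _ _
      (≈ᴹ-trans (≈ᴹ-sym (*ₗ-distribˡ a x (-ᴹ x)))
      (≈ᴹ-trans (*ₗ-cong R.refl (-ᴹ‿inverseʳ x)) (*ₗ-zeroʳ a)))

    neg-*ₗ : ∀ a x → (R.- a) *ₗ x ≈ᴹ -ᴹ (a *ₗ x)
    neg-*ₗ a x = inverseʳ-unique _ _
      (≈ᴹ-trans (≈ᴹ-sym (*ₗ-distribʳ x a (R.- a)))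
      (≈ᴹ-trans (*ₗ-cong (R.-‿inverseʳ a) ≈ᴹ-refl)
                 (*ₗ-zeroˡ x)))

    *ᵣ-neg : ∀ x b → x *ᵣ (S.- b) ≈ᴹ -ᴹ (x *ᵣ b)
    *ᵣ-neg x b = inverseʳ-unique _ _
      (≈ᴹ-trans (≈ᴹ-sym (*ᵣ-distribˡ x b (S.- b)))
      (≈ᴹ-trans (*ᵣ-cong ≈ᴹ-refl (S.-‿inverseʳ b))
                 (*ᵣ-zeroʳ x)))

    neg-*ᵣ : ∀ x b → (-ᴹ x) *ᵣ b ≈ᴹ -ᴹ (x *ᵣ b)
    neg-*ᵣ x b = inverseʳ-unique _ _
      (≈ᴹ-trans (≈ᴹ-sym (*ᵣ-distribʳ b x (-ᴹ x)))
      (≈ᴹ-trans (*ᵣ-cong (-ᴹ‿inverseʳ x) S.refl) (*ᵣ-zeroˡ b)))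

    left-cong : ∀ {a b x y} → I (a R.- b) → x ≋ y → (a *ₗ x) ≋ (b *ₗ y)
    left-cong {a} {b} {x} {y} h k =
      ≋-trans {a *ₗ x} {b *ₗ x} {b *ₗ y}
        (N-resp (≈ᴹ-trans (*ₗ-distribʳ x a (R.- b)) (+ᴹ-congˡ (neg-*ₗ b x)))
                (IM⊆N x h))
        (N-resp (≈ᴹ-trans (*ₗ-distribˡ b x (-ᴹ y)) (+ᴹ-congˡ (*ₗ-neg b y)))
                (*ₗ∈ b k))

    right-cong : ∀ {x y a b} → x ≋ y → J (a S.- b) → (x *ᵣ a) ≋ (y *ᵣ b)
    right-cong {x} {y} {a} {b} k h =
      ≋-trans {x *ᵣ a} {y *ᵣ a} {y *ᵣ b}
        (N-resp (≈ᴹ-trans (*ᵣ-distribʳ a x (-ᴹ y)) (+ᴹ-congˡ (neg-*ᵣ y a)))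
                (*ᵣ∈ a k))
        (N-resp (≈ᴹ-trans (*ᵣ-distribˡ y a (S.- b)) (+ᴹ-congˡ (*ᵣ-neg y b)))
                (MJ⊆N y h))

module _ {r s : Level} {R : Ring r ℓ} {S : Ring s ℓ′} where
  private
    module R = Ring R
    module S = Ring S

  quotient-fg :
    ∀ {m ℓm i j} (M : Bimodule R S m ℓm)
    {N : Pred (Bimodule.Carrierᴹ M) p} (isSub : IsSubBimodule M N) →
    {I : Pred R.Carrier i} (isIdealI : IsIdeal R I) →
    {J : Pred S.Carrier j} (isIdealJ : IsIdeal S J) →
    (IM⊆N : ∀ {a} x → I a → N (Bimodule._*ₗ_ M a x))
    (MJ⊆N : ∀ {b} x → J b → N (Bimodule._*ᵣ_ M x b)) →
    FinitelyGenerated M →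
    FinitelyGenerated (quotientBimodule M isSub isIdealI isIdealJ IM⊆N MJ⊆N)
  quotient-fg M isSub isIdealI isIdealJ IM⊆N MJ⊆N (n , g , span) =
    n , g , λ x → image (span x)
    where
    open Bimodule M
    open AbelianQuotient +ᴹ-abelianGroup (IsSubBimodule.isSubgroup isSub)

    image : Span M g ⊆ Span (quotientBimodule M isSub isIdealI isIdealJ IM⊆N MJ⊆N) g
    image (gen i)    = gen i
    image zero       = zero
    image (add s t)  = add (image s) (image t)
    image (actₗ a s) = actₗ a (image s)
    image (actᵣ b s) = actᵣ b (image s)
    image (resp e s) = resp (≈⇒≋ e) (image s)

record IsDivisionRing (R : Ring c ℓ) : Set (c ⊔ ℓ) where
  open Ring R
  field
    1≉0     : ¬ 1# ≈ 0#
    inverse : ∀ x → ¬ x ≈ 0# → ∃[ y ] (x * y ≈ 1# × y * x ≈ 1#)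

IsRingHom : ∀ {c ℓ c′ ℓ′} (R : Ring c ℓ) (S : Ring c′ ℓ′) →
            (Ring.Carrier R → Ring.Carrier S) → Set (c ⊔ ℓ ⊔ ℓ′)
IsRingHom R S = RingMorphisms.IsRingHomomorphism (Ring.rawRing R) (Ring.rawRing S)

IsRingAut : (R : Ring c ℓ) → (Ring.Carrier R → Ring.Carrier R) → Set (c ⊔ ℓ)
IsRingAut R = RingMorphisms.IsRingIsomorphism (Ring.rawRing R) (Ring.rawRing R)

module _ {c′ : Level} (R : Ring c ℓ) (A : Ring c′ ℓ′)
         (ι : Ring.Carrier R → Ring.Carrier A) where
  private
    module R = Ring R
    module A = Ring A

  linearCombination : ∀ {n} → (Fin n → R.Carrier) → (Fin n → A.Carrier) → A.Carrier
  linearCombination a e = Sum.sum A.+-commutativeMonoid (λ i → ι (a i) A.* e i)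

  IsBasis : ∀ {n} → (Fin n → A.Carrier) → Set (c ⊔ ℓ ⊔ c′ ⊔ ℓ′)
  IsBasis e =
    (∀ x → ∃[ a ] x A.≈ linearCombination a e) ×
    (∀ a → linearCombination a e A.≈ A.0# → ∀ i → a i R.≈ R.0#)

  HasDegree : ℕ → Set (c ⊔ ℓ ⊔ c′ ⊔ ℓ′)
  HasDegree n = ∃ λ (e : Fin n → A.Carrier) → IsBasis e

infixl 6 _+⁺_
_+⁺_ : ℤ ⁺ → ℤ ⁺ → ℤ ⁺
[ m ] +⁺ [ n ] = [ m ℤ.+ n ]
[ _ ] +⁺ ⊤⁺    = ⊤⁺
⊤⁺    +⁺ _     = ⊤⁺

private
  +⁺-mono : ∀ {m n u w} → [ m ] ≤⁺ u → [ n ] ≤⁺ w → [ m ℤ.+ n ] ≤⁺ u +⁺ w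
  +⁺-mono [ p ]     [ q ]     = [ ℤ.+-mono-≤ p q ]
  +⁺-mono [ p ]     (_ ≤⊤⁺)   = _ ≤⊤⁺
  +⁺-mono (_ ≤⊤⁺)   _         = _ ≤⊤⁺

  ≤⁺-trans : ∀ {m n w} → m ℤ.≤ n → [ n ] ≤⁺ w → [ m ] ≤⁺ w
  ≤⁺-trans p [ q ]   = [ ℤ.≤-trans p q ]
  ≤⁺-trans p (_ ≤⊤⁺) = _ ≤⊤⁺

  doubled-nonneg : ∀ m → 0ℤ ℤ.≤ m ℤ.+ m → 0ℤ ℤ.≤ m
  doubled-nonneg (+ n)    _ = ℤ.+≤+ z≤n
  doubled-nonneg -[1+ n ] ()

record DiscretelyValuedField (ℓ : Level) : Set (suc ℓ) where
  field
    commutativeRing : CommutativeRing ℓ ℓ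
  open CommutativeRing commutativeRing public
  field
    isDivisionRing : IsDivisionRing ring
    v       : Carrier → ℤ ⁺
    v-cong  : ∀ {x y} → x ≈ y → v x ≡ v y
    v-0#    : v 0# ≡ ⊤⁺
    v-⊤⁺    : ∀ {x} → v x ≡ ⊤⁺ → x ≈ 0#
    v-*     : ∀ x y → v (x * y) ≡ v x +⁺ v y
    -- v (x + y) ≥ min (v x) (v y), with the minimum spelled out.
    v-+     : ∀ {x y k} → k ≤⁺ v x → k ≤⁺ v y → k ≤⁺ v (x + y)
    v-onto  : ∃[ x ] v x ≡ [ 1ℤ ]

  open IsDivisionRing isDivisionRing public

  𝒪 : Pred Carrier 0ℓ
  𝒪 x = [ 0ℤ ] ≤⁺ v x

  Uniformizer : Pred Carrier 0ℓ
  Uniformizer x = v x ≡ [ 1ℤ ]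

  private
    0≤v-* : ∀ {x y} → [ 0ℤ ] ≤⁺ v x → [ 0ℤ ] ≤⁺ v y → [ 0ℤ ] ≤⁺ v (x * y)
    0≤v-* {x} {y} h k = ≡.subst ([ 0ℤ ] ≤⁺_) (≡.sym (v-* x y)) (+⁺-mono h k)

    0≤v-square : ∀ x → [ 0ℤ ] ≤⁺ v (x * x) → [ 0ℤ ] ≤⁺ v x
    0≤v-square x h = go (v x) (≡.subst ([ 0ℤ ] ≤⁺_) (v-* x x) h)
      where
      go : ∀ w → [ 0ℤ ] ≤⁺ w +⁺ w → [ 0ℤ ] ≤⁺ w
      go ⊤⁺    _     = _ ≤⊤⁺
      go [ m ] [ p ] = [ doubled-nonneg m p ]

    v-1# : v 1# ≡ [ 0ℤ ]
    v-1# = go (v 1#) ≡.refl (≡.trans (≡.sym (v-* 1# 1#)) (v-cong (*-identityˡ 1#)))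
      where
      []-inj : ∀ {m n : ℤ} → _≡_ {A = ℤ ⁺} [ m ] [ n ] → m ≡ n
      []-inj ≡.refl = ≡.refl

      go : ∀ w → v 1# ≡ w → w +⁺ w ≡ w → w ≡ [ 0ℤ ]
      go ⊤⁺    e _ = ⊥-elim (1≉0 (v-⊤⁺ e))
      go [ m ] _ e = ≡.cong [_] (RingProperties.x+x≈x⇒x≈0 ℤ.+-*-ring m ([]-inj e))

    1∈𝒪 : 𝒪 1#
    1∈𝒪 = ≡.subst ([ 0ℤ ] ≤⁺_) (≡.sym v-1#) [ ℤ.≤-refl ]

    open RingProperties ring using (-1*x≈-x; -‿involutive)

    -1∈𝒪 : 𝒪 (- 1#)
    -1∈𝒪 = 0≤v-square (- 1#) (≡.subst ([ 0ℤ ] ≤⁺_)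
      (v-cong (sym (trans (-1*x≈-x (- 1#)) (-‿involutive 1#)))) 1∈𝒪)

    0∈ : ∀ {k} → k ≤⁺ v 0#
    0∈ = ≡.subst (_ ≤⁺_) (≡.sym v-0#) (_ ≤⊤⁺)

    v-neg : ∀ {m x} → [ m ] ≤⁺ v x → [ m ] ≤⁺ v (- x)
    v-neg {m} {x} h = ≡.subst₂ (λ n w → [ n ] ≤⁺ w) (ℤ.+-identityˡ m)
      (≡.trans (≡.sym (v-* (- 1#) x)) (v-cong (-1*x≈-x x)))
      (+⁺-mono -1∈𝒪 h)

  𝒪-isSubring : IsSubring ring 𝒪
  𝒪-isSubring = record
    { resp = λ e → ≡.subst ([ 0ℤ ] ≤⁺_) (v-cong e)
    ; 0∈ = 0∈ ; 1∈ = 1∈𝒪 ; +∈ = v-+ ; *∈ = 0≤v-* ; -∈ = v-neg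
    }

  𝒪-ring : Ring ℓ ℓ
  𝒪-ring = subring ring 𝒪-isSubring

  Uniformizer⊆𝒪 : Uniformizer ⊆ 𝒪
  Uniformizer⊆𝒪 e = ≡.subst ([ 0ℤ ] ≤⁺_) (≡.sym e) [ ℤ.+≤+ z≤n ]

  𝔪 : Pred (Ring.Carrier 𝒪-ring) 0ℓ
  𝔪 (x , _) = [ 1ℤ ] ≤⁺ v x

  𝔪-isIdeal : IsIdeal 𝒪-ring 𝔪
  𝔪-isIdeal = record
    { isSubgroup = record
      { resp = λ e → ≡.subst ([ 1ℤ ] ≤⁺_) (v-cong e)
      ; ε∈ = 0∈ ; ∙∈ = v-+ ; ⁻¹∈ = v-neg
      }
    ; *∈ˡ = λ (r , r∈𝒪) {(x , _)} h →
        ≡.subst ([ 1ℤ ] ≤⁺_) (≡.sym (v-* r x)) (+⁺-mono r∈𝒪 h)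
    ; *∈ʳ = λ (r , r∈𝒪) {(x , _)} h →
        ≡.subst ([ 1ℤ ] ≤⁺_) (≡.sym (v-* x r)) (+⁺-mono h r∈𝒪)
    }

  residueField : Ring ℓ 0ℓ
  residueField = quotientRing 𝒪-ring 𝔪-isIdeal

  Cauchy : Pred (ℕ → Carrier) 0ℓ
  Cauchy s = ∀ (k : ℤ) → ∃[ N ] ∀ m n → N ℕ.≤ m → N ℕ.≤ n → [ k ] ≤⁺ v (s m - s n)

  _⟶_ : (ℕ → Carrier) → Carrier → Set
  s ⟶ x = ∀ (k : ℤ) → ∃[ N ] ∀ n → N ℕ.≤ n → [ k ] ≤⁺ v (s n - x)

record NonarchimedeanLocalField (ℓ : Level) : Set (suc ℓ) where
  field
    discretelyValuedField : DiscretelyValuedField ℓ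
  open DiscretelyValuedField discretelyValuedField public
  field
    complete     : ∀ s → Cauchy s → ∃[ x ] s ⟶ x
    q            : ℕ
    residueField-card : Bijection (Ring.setoid residueField) (≡.setoid (Fin q))

record UnramifiedQuadraticExtension {ℓ} (F : DiscretelyValuedField ℓ) : Set (suc ℓ) where
  private module F = DiscretelyValuedField F
  field
    extension : DiscretelyValuedField ℓ
  open DiscretelyValuedField extension public
  field
    ι       : F.Carrier → Carrier
    ι-isHom : IsRingHom F.ring ring ι
    degree  : HasDegree F.ring ring ι 2
    -- Both valuations are normalized, so this says that the ramification
    -- index is 1.
    v-ι     : ∀ x → v (ι x) ≡ F.v x

  residueι : Ring.Carrier F.residueField → Ring.Carrier residueField
  residueι (x , x∈𝒪) = ι x , ≡.subst ([ 0ℤ ] ≤⁺_) (≡.sym (v-ι x)) x∈𝒪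

  field
    residueDegree : HasDegree F.residueField residueField residueι 2

    σ            : Carrier → Carrier
    σ-isAut      : IsRingAut ring σ
    σ-ι          : ∀ x → σ (ι x) ≈ ι x
    σ-nontrivial : ∃[ x ] ¬ σ x ≈ x

record QuaternionDivisionAlgebra {ℓ} (F : DiscretelyValuedField ℓ) : Set (suc ℓ) where
  private module F = DiscretelyValuedField F
  field
    ring : Ring ℓ ℓ
  open Ring ring public
  field
    isDivisionRing : IsDivisionRing ring
    ι         : F.Carrier → Carrier
    ι-isHom   : IsRingHom F.ring ring ι
    ι-central : ∀ a x → ι a * x ≈ x * ι a
    centre    : ∀ z → (∀ x → z * x ≈ x * z) → ∃[ a ] z ≈ ι a
    degree    : HasDegree F.ring ring ι 4

  open IsDivisionRing isDivisionRing public

  record IsOrder (O : Pred Carrier ℓ) : Set ℓ where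
    field
      isSubring : IsSubring ring O
      ι∈        : ∀ {a} → F.𝒪 a → O (ι a)
      finite    : ∃[ n ] ∃ λ (e : Fin n → Carrier) → (∀ i → O (e i)) ×
                  (∀ {x} → O x → ∃[ a ] (∀ i → F.𝒪 (a i)) ×
                                 x ≈ linearCombination F.ring ring ι a e)
      spans     : ∀ x → ∃[ n ] ∃ λ (e : Fin n → Carrier) → (∀ i → O (e i)) ×
                  ∃[ a ] x ≈ linearCombination F.ring ring ι a e

  record IsMaximalOrder (O : Pred Carrier ℓ) : Set (suc ℓ) where
    field
      isOrder : IsOrder O
      maximal : ∀ {O′ : Pred Carrier ℓ} → IsOrder O′ → O ⊆ O′ → O′ ⊆ O
    open IsOrder isOrder public

record QuaternionDatum {ℓ} (F : NonarchimedeanLocalField ℓ) : Set (suc ℓ) where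
  private module F = NonarchimedeanLocalField F
  field
    unramified : UnramifiedQuadraticExtension F.discretelyValuedField
    quaternion : QuaternionDivisionAlgebra F.discretelyValuedField

  module K = UnramifiedQuadraticExtension unramified
  module B = QuaternionDivisionAlgebra quaternion
  open B using (_≈_; _+_; _*_; 0#)

  field
    κ       : K.Carrier → B.Carrier
    κ-isHom : IsRingHom K.ring B.ring κ
    κ-ι     : ∀ a → κ (K.ι a) ≈ B.ι a

    O                : Pred B.Carrier ℓ
    O-isMaximalOrder : B.IsMaximalOrder O

    π             : F.Carrier
    π-uniformizer : F.Uniformizer π

    Π    : B.Carrier
    Π∈O  : O Π
    Π²≈π : Π * Π ≈ B.ι π
    Π-σ  : ∀ {a} → K.𝒪 a → Π * κ a ≈ κ (K.σ a) * Π

    -- O_B = O_K ⊕ O_K Π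
    O-gen    : ∀ {a b} → K.𝒪 a → K.𝒪 b → O (κ a + κ b * Π)
    O-decomp : ∀ {x} → O x →
               ∃[ a ] ∃[ b ] K.𝒪 a × K.𝒪 b × x ≈ κ a + κ b * Π
    O-direct : ∀ {a b} → K.𝒪 a → K.𝒪 b → κ a + κ b * Π ≈ 0# →
               a K.≈ K.0# × b K.≈ K.0#

  open B.IsMaximalOrder O-isMaximalOrder public using () renaming (isSubring to O-isSubring; ι∈ to ι∈O)

  O-ring : Ring ℓ ℓ
  O-ring = subring B.ring O-isSubring
  module O = Ring O-ring

  ιO : Ring.Carrier F.𝒪-ring → O.Carrier
  ιO (a , a∈𝒪) = B.ι a , ι∈O a∈𝒪

  πO ΠO : O.Carrier
  πO = ιO (π , F.Uniformizer⊆𝒪 π-uniformizer)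
  ΠO = Π , Π∈O

  πO-central : ∀ x → πO O.* x O.≈ x O.* πO
  πO-central (x , _) = B.ι-central π x

  private
    module KP = RingProperties K.ring
    module κ = RingMorphisms.IsRingHomomorphism κ-isHom
    module SB = IsSubring O-isSubring
    module SK = IsSubring K.𝒪-isSubring
    module ιB = RingMorphisms.IsRingHomomorphism B.ι-isHom
    open SetoidReasoning B.setoid

    κ∈O : ∀ {a} → K.𝒪 a → O (κ a)
    κ∈O {a} a∈ = SB.resp eq (O-gen a∈ SK.0∈)
      where
      eq : κ a + κ K.0# * Π ≈ κ a
      eq = begin
        κ a + κ K.0# * Π  ≈⟨ B.+-congˡ (B.*-congʳ κ.0#-homo) ⟩
        κ a + 0# * Π      ≈⟨ B.+-congˡ (B.zeroˡ Π) ⟩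
        κ a + 0#          ≈⟨ B.+-identityʳ (κ a) ⟩
        κ a               ∎

    -- If z ∉ O_K then z⁻¹ ∈ O_K, and Π ≈ κ (z⁻¹ c) contradicts directness.
    integral : ∀ {z c} → K.𝒪 c → κ z * Π ≈ κ c → K.𝒪 z
    integral {z} {c} c∈ e = go (K.v z) ≡.refl
      where
      go : ∀ w → K.v z ≡ w → K.𝒪 z
      go ⊤⁺         eq = ≡.subst ([ 0ℤ ] ≤⁺_) (≡.sym eq) (_ ≤⊤⁺)
      go [ + n ]    eq = ≡.subst ([ 0ℤ ] ≤⁺_) (≡.sym eq) [ ℤ.+≤+ z≤n ]
      go [ -[1+ n ] ] eq = ⊥-elim (K.1≉0 (K.trans (K.sym (KP.-‿involutive K.1#))
                             (K.trans (K.-‿cong (proj₂ direct)) KP.-0#≈0#)))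
        where
        z≉0 : ¬ z K.≈ K.0#
        z≉0 z≈0 with () ← ≡.trans (≡.sym eq) (≡.trans (K.v-cong z≈0) K.v-0#)

        z⁻¹ : K.Carrier
        z⁻¹ = proj₁ (K.inverse z z≉0)

        z⁻¹z≈1 : z⁻¹ K.* z K.≈ K.1#
        z⁻¹z≈1 = proj₂ (proj₂ (K.inverse z z≉0))

        nonneg : ∀ u → [ 0ℤ ] ≤⁺ u +⁺ [ -[1+ n ] ] → [ 0ℤ ] ≤⁺ u
        nonneg ⊤⁺           _     = _ ≤⊤⁺
        nonneg [ + m ]      _     = [ ℤ.+≤+ z≤n ]
        nonneg [ -[1+ m ] ] [ () ]

        z⁻¹∈ : K.𝒪 z⁻¹
        z⁻¹∈ = nonneg (K.v z⁻¹) (≡.subst ([ 0ℤ ] ≤⁺_)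
          (≡.trans (≡.sym (K.v-cong z⁻¹z≈1))
          (≡.trans (K.v-* z⁻¹ z) (≡.cong (K.v z⁻¹ +⁺_) eq))) SK.1∈)

        Π≈ : κ (z⁻¹ K.* c) ≈ Π
        Π≈ = begin
          κ (z⁻¹ K.* c)          ≈⟨ κ.*-homo z⁻¹ c ⟩
          κ z⁻¹ * κ c            ≈⟨ B.*-congˡ (B.sym e) ⟩
          κ z⁻¹ * (κ z * Π)      ≈⟨ B.sym (B.*-assoc (κ z⁻¹) (κ z) Π) ⟩
          (κ z⁻¹ * κ z) * Π      ≈⟨ B.*-congʳ (B.sym (κ.*-homo z⁻¹ z)) ⟩
          κ (z⁻¹ K.* z) * Π      ≈⟨ B.*-congʳ (κ.⟦⟧-cong z⁻¹z≈1) ⟩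
          κ K.1# * Π             ≈⟨ B.*-congʳ κ.1#-homo ⟩
          B.1# * Π               ≈⟨ B.*-identityˡ Π ⟩
          Π                      ∎

        vanish : κ (z⁻¹ K.* c) + κ (K.- K.1#) * Π ≈ 0#
        vanish = begin
          κ (z⁻¹ K.* c) + κ (K.- K.1#) * Π  ≈⟨ B.+-cong Π≈ (B.*-congʳ (κ.-‿homo K.1#)) ⟩
          Π + (B.- κ K.1#) * Π              ≈⟨ B.+-congˡ (B.*-congʳ (B.-‿cong κ.1#-homo)) ⟩
          Π + (B.- B.1#) * Π                ≈⟨ B.+-congˡ (RingProperties.-1*x≈-x B.ring Π) ⟩
          Π + B.- Π                         ≈⟨ B.-‿inverseʳ Π ⟩
          0#                                ∎

        direct = O-direct (SK.*∈ z⁻¹∈ c∈) (SK.-∈ SK.1∈) vanish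

  σ-𝒪 : ∀ {a} → K.𝒪 a → K.𝒪 (K.σ a)
  σ-𝒪 {a} a∈ with O-decomp (SB.*∈ Π∈O (κ∈O a∈))
  ... | c , d , c∈ , d∈ , e =
    SK.resp (K.trans (K.+-assoc _ _ _)
              (K.trans (K.+-congˡ (K.-‿inverseˡ d)) (K.+-identityʳ _)))
            (SK.+∈ (integral c∈ eq) d∈)
    where
    eq : κ (K.σ a K.- d) * Π ≈ κ c
    eq = begin
      κ (K.σ a K.+ K.- d) * Π             ≈⟨ B.*-congʳ (κ.+-homo _ _) ⟩
      (κ (K.σ a) + κ (K.- d)) * Π         ≈⟨ B.*-congʳ (B.+-congˡ (κ.-‿homo d)) ⟩
      (κ (K.σ a) + B.- κ d) * Π           ≈⟨ RingProperties.[y-z]x≈yx-zx B.ring Π _ _ ⟩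
      κ (K.σ a) * Π + B.- (κ d * Π)       ≈⟨ B.+-congʳ (B.sym (Π-σ a∈)) ⟩
      Π * κ a + B.- (κ d * Π)             ≈⟨ B.+-congʳ e ⟩
      (κ c + κ d * Π) + B.- (κ d * Π)     ≈⟨ B.+-assoc _ _ _ ⟩
      κ c + (κ d * Π + B.- (κ d * Π))     ≈⟨ B.+-congˡ (B.-‿inverseʳ _) ⟩
      κ c + 0#                            ≈⟨ B.+-identityʳ _ ⟩
      κ c                                 ∎

  -- Conjugation by Π stabilizes O_B, hence Π O_B = O_B Π.
  O-twist : ∀ x → ∃[ y ] (ΠO O.* x O.≈ y O.* ΠO) × (x O.* ΠO O.≈ ΠO O.* y)
  O-twist (x , x∈) with O-decomp x∈
  ... | a , b , a∈ , b∈ , e =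
    (y , O-gen (σ-𝒪 a∈) (σ-𝒪 b∈)) , move , back
    where
    y : B.Carrier
    y = κ (K.σ a) + κ (K.σ b) * Π

    move : Π * x ≈ y * Π
    move = begin
      Π * x                                      ≈⟨ B.*-congˡ e ⟩
      Π * (κ a + κ b * Π)                        ≈⟨ B.distribˡ _ _ _ ⟩
      Π * κ a + Π * (κ b * Π)                    ≈⟨ B.+-congˡ (B.sym (B.*-assoc _ _ _)) ⟩
      Π * κ a + (Π * κ b) * Π                    ≈⟨ B.+-cong (Π-σ a∈) (B.*-congʳ (Π-σ b∈)) ⟩
      κ (K.σ a) * Π + (κ (K.σ b) * Π) * Π        ≈⟨ B.sym (B.distribʳ _ _ _) ⟩
      y * Π                                      ∎

    ιπ≉0 : ¬ B.ι π ≈ 0#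
    ιπ≉0 ιπ≈0 = B.1≉0 (begin
      B.1#                    ≈⟨ B.sym ιB.1#-homo ⟩
      B.ι F.1#                ≈⟨ ιB.⟦⟧-cong (F.sym (proj₁ (proj₂ inv))) ⟩
      B.ι (π F.* proj₁ inv)   ≈⟨ ιB.*-homo _ _ ⟩
      B.ι π * B.ι (proj₁ inv) ≈⟨ B.*-congʳ ιπ≈0 ⟩
      0# * B.ι (proj₁ inv)    ≈⟨ B.zeroˡ _ ⟩
      0#                      ∎)
      where
      π≉0 : ¬ π F.≈ F.0#
      π≉0 π≈0 with () ← ≡.trans (≡.sym π-uniformizer) (≡.trans (F.v-cong π≈0) F.v-0#)
      inv = F.inverse π π≉0

    Π≉0 : ¬ Π ≈ 0#
    Π≉0 Π≈0 = ιπ≉0 (B.trans (B.sym Π²≈π) (B.trans (B.*-congʳ Π≈0) (B.zeroˡ Π)))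

    Π⁻¹ : B.Carrier
    Π⁻¹ = proj₁ (B.inverse Π Π≉0)

    ΠΠ⁻¹≈1 : Π * Π⁻¹ ≈ B.1#
    ΠΠ⁻¹≈1 = proj₁ (proj₂ (B.inverse Π Π≉0))

    cancel : ∀ u → (u * Π) * Π⁻¹ ≈ u
    cancel u = B.trans (B.*-assoc u Π Π⁻¹)
      (B.trans (B.*-congˡ ΠΠ⁻¹≈1) (B.*-identityʳ u))

    back : x * Π ≈ Π * y
    back = begin
      x * Π                  ≈⟨ B.sym (cancel (x * Π)) ⟩
      ((x * Π) * Π) * Π⁻¹    ≈⟨ B.*-congʳ (B.*-assoc x Π Π) ⟩
      (x * (Π * Π)) * Π⁻¹    ≈⟨ B.*-congʳ (B.*-congˡ Π²≈π) ⟩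
      (x * B.ι π) * Π⁻¹      ≈⟨ B.*-congʳ (B.sym (B.ι-central π x)) ⟩
      (B.ι π * x) * Π⁻¹      ≈⟨ B.*-congʳ (B.*-congʳ (B.sym Π²≈π)) ⟩
      ((Π * Π) * x) * Π⁻¹    ≈⟨ B.*-congʳ (B.*-assoc Π Π x) ⟩
      (Π * (Π * x)) * Π⁻¹    ≈⟨ B.*-congʳ (B.*-congˡ move) ⟩
      (Π * (y * Π)) * Π⁻¹    ≈⟨ B.*-congʳ (B.sym (B.*-assoc Π y Π)) ⟩
      ((Π * y) * Π) * Π⁻¹    ≈⟨ cancel (Π * y) ⟩
      Π * y                  ∎

  rightMultiples : O.Carrier → Pred O.Carrier ℓ
  rightMultiples a x = ∃[ c ] x O.≈ a O.* c

  private
    multiples-isIdeal : ∀ a → (∀ r → ∃[ r′ ] r O.* a O.≈ a O.* r′) →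
                        IsIdeal O-ring (rightMultiples a)
    multiples-isIdeal a swap = record
      { isSubgroup = record
        { resp = λ e (c , f) → c , B.trans (B.sym e) f
        ; ε∈   = O.0# , B.sym (O.zeroʳ a)
        ; ∙∈   = λ (c , e) (d , f) →
                   c O.+ d , B.trans (B.+-cong e f) (B.sym (O.distribˡ a c d))
        ; ⁻¹∈  = λ (c , e) → O.- c ,
                   B.trans (B.-‿cong e) (RingProperties.-‿distribʳ-* O-ring a c)
        }
      ; *∈ˡ = λ r (c , e) → let r′ , f = swap r in
          r′ O.* c , B.trans (B.*-congˡ e) (B.trans (B.sym (O.*-assoc r a c))
                     (B.trans (B.*-congʳ f) (O.*-assoc a r′ c)))
      ; *∈ʳ = λ r (c , e) →
          c O.* r , B.trans (B.*-congʳ e) (O.*-assoc a c r)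
      }

  πO-isIdeal : IsIdeal O-ring (rightMultiples πO)
  πO-isIdeal = multiples-isIdeal πO (λ r → r , B.sym (πO-central r))

  ΠO-isIdeal : IsIdeal O-ring (rightMultiples ΠO)
  ΠO-isIdeal = multiples-isIdeal ΠO (λ r → let y , _ , back = O-twist r in y , back)

  -- 𝔽_{q²} = O_B/ΠO_B and 𝔽_{q²}[ε] = O_B/πO_B, with ε the class of Π.
  𝔽q² 𝔽q²[ε] : Ring ℓ ℓ
  𝔽q²    = quotientRing O-ring ΠO-isIdeal
  𝔽q²[ε] = quotientRing O-ring πO-isIdeal

  -- The algebra maps from 𝔽_q; the carriers are those of O_F and O_B.
  𝔽q→𝔽q² : Ring.Carrier F.residueField → Ring.Carrier 𝔽q²
  𝔽q→𝔽q² = ιO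

  𝔽q→𝔽q²[ε] : Ring.Carrier F.residueField → Ring.Carrier 𝔽q²[ε]
  𝔽q→𝔽q²[ε] = ιO

  record Bilattice : Set (suc ℓ) where
    field
      bimodule : Bimodule O-ring O-ring ℓ ℓ
    open Bimodule bimodule public
    field
      finitelyGenerated : FinitelyGenerated bimodule
      actionsAgree      : ActionsAgree bimodule ιO ιO
      torsionFree       : ∀ a x → ¬ proj₁ a F.≈ F.0# → ιO a *ₗ x ≈ᴹ 0ᴹ → x ≈ᴹ 0ᴹ

  record 𝔽q²[ε]-𝔽q²-Bimodule : Set (suc ℓ) where
    field
      bimodule          : Bimodule 𝔽q²[ε] 𝔽q² ℓ ℓ
      finitelyGenerated : FinitelyGenerated bimodule
      actionsAgree      : ActionsAgree bimodule 𝔽q→𝔽q²[ε] 𝔽q→𝔽q²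

  record 𝔽q²-𝔽q²[ε]-Bimodule : Set (suc ℓ) where
    field
      bimodule          : Bimodule 𝔽q² 𝔽q²[ε] ℓ ℓ
      finitelyGenerated : FinitelyGenerated bimodule
      actionsAgree      : ActionsAgree bimodule 𝔽q→𝔽q² 𝔽q→𝔽q²[ε]

  _≅ᴸ_ : Bilattice → Bilattice → Set ℓ
  L ≅ᴸ L′ = Bilattice.bimodule L ≅ Bilattice.bimodule L′

  _≅ʳ_ : 𝔽q²[ε]-𝔽q²-Bimodule → 𝔽q²[ε]-𝔽q²-Bimodule → Set ℓ
  M ≅ʳ M′ = 𝔽q²[ε]-𝔽q²-Bimodule.bimodule M ≅ 𝔽q²[ε]-𝔽q²-Bimodule.bimodule M′

  _≅ˡ_ : 𝔽q²-𝔽q²[ε]-Bimodule → 𝔽q²-𝔽q²[ε]-Bimodule → Set ℓ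
  M ≅ˡ M′ = 𝔽q²-𝔽q²[ε]-Bimodule.bimodule M ≅ 𝔽q²-𝔽q²[ε]-Bimodule.bimodule M′

  module _ (L : Bilattice) where
    open Bilattice L

    LΠ ΠL : Pred Carrierᴹ ℓ
    LΠ x = ∃[ y ] x ≈ᴹ y *ᵣ ΠO
    ΠL x = ∃[ y ] x ≈ᴹ ΠO *ₗ y

    private
      open AbelianGroupProperties +ᴹ-abelianGroup using (inverseʳ-unique)

      -ᴹ-*ᵣ : ∀ x b → -ᴹ (x *ᵣ b) ≈ᴹ (-ᴹ x) *ᵣ b
      -ᴹ-*ᵣ x b = ≈ᴹ-sym (inverseʳ-unique _ _
        (≈ᴹ-trans (≈ᴹ-sym (*ᵣ-distribʳ b x (-ᴹ x)))
        (≈ᴹ-trans (*ᵣ-cong (-ᴹ‿inverseʳ x) B.refl) (*ᵣ-zeroˡ b))))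

      -ᴹ-*ₗ : ∀ a x → -ᴹ (a *ₗ x) ≈ᴹ a *ₗ (-ᴹ x)
      -ᴹ-*ₗ a x = ≈ᴹ-sym (inverseʳ-unique _ _
        (≈ᴹ-trans (≈ᴹ-sym (*ₗ-distribˡ a x (-ᴹ x)))
        (≈ᴹ-trans (*ₗ-cong B.refl (-ᴹ‿inverseʳ x)) (*ₗ-zeroʳ a))))

      πO≈ΠO² : πO O.≈ ΠO O.* ΠO
      πO≈ΠO² = B.sym Π²≈π

    LΠ-isSubBimodule : IsSubBimodule bimodule LΠ
    LΠ-isSubBimodule = record
      { isSubgroup = record
        { resp = λ e (y , f) → y , ≈ᴹ-trans (≈ᴹ-sym e) f
        ; ε∈   = 0ᴹ , ≈ᴹ-sym (*ᵣ-zeroˡ ΠO)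
        ; ∙∈   = λ (y , e) (z , f) →
                   y +ᴹ z , ≈ᴹ-trans (+ᴹ-cong e f) (≈ᴹ-sym (*ᵣ-distribʳ ΠO y z))
        ; ⁻¹∈  = λ (y , e) → -ᴹ y , ≈ᴹ-trans (-ᴹ‿cong e) (-ᴹ-*ᵣ y ΠO)
        }
      ; *ₗ∈ = λ a (y , e) →
          a *ₗ y , ≈ᴹ-trans (*ₗ-cong B.refl e) (≈ᴹ-sym (*ₗ-*ᵣ-assoc a y ΠO))
      ; *ᵣ∈ = λ b (y , e) → let b′ , move , _ = O-twist b in
          y *ᵣ b′ , ≈ᴹ-trans (*ᵣ-cong e B.refl) (≈ᴹ-trans (*ᵣ-assoc y ΠO b)
                    (≈ᴹ-trans (*ᵣ-cong ≈ᴹ-refl move) (≈ᴹ-sym (*ᵣ-assoc y b′ ΠO))))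
      }

    ΠL-isSubBimodule : IsSubBimodule bimodule ΠL
    ΠL-isSubBimodule = record
      { isSubgroup = record
        { resp = λ e (y , f) → y , ≈ᴹ-trans (≈ᴹ-sym e) f
        ; ε∈   = 0ᴹ , ≈ᴹ-sym (*ₗ-zeroʳ ΠO)
        ; ∙∈   = λ (y , e) (z , f) →
                   y +ᴹ z , ≈ᴹ-trans (+ᴹ-cong e f) (≈ᴹ-sym (*ₗ-distribˡ ΠO y z))
        ; ⁻¹∈  = λ (y , e) → -ᴹ y , ≈ᴹ-trans (-ᴹ‿cong e) (-ᴹ-*ₗ ΠO y)
        }
      ; *ₗ∈ = λ a (y , e) → let a′ , _ , back = O-twist a in
          a′ *ₗ y , ≈ᴹ-trans (*ₗ-cong B.refl e) (≈ᴹ-trans (≈ᴹ-sym (*ₗ-assoc a ΠO y))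
                    (≈ᴹ-trans (*ₗ-cong back ≈ᴹ-refl) (*ₗ-assoc ΠO a′ y)))
      ; *ᵣ∈ = λ b (y , e) →
          y *ᵣ b , ≈ᴹ-trans (*ᵣ-cong e B.refl) (*ₗ-*ᵣ-assoc ΠO y b)
      }

    private
      π-agree : ∀ x → πO *ₗ x ≈ᴹ x *ᵣ πO
      π-agree = actionsAgree _

      πL⊆LΠ : ∀ {a} x → rightMultiples πO a → LΠ (a *ₗ x)
      πL⊆LΠ x (c , e) = (c *ₗ x) *ᵣ ΠO ,
        ≈ᴹ-trans (*ₗ-cong e ≈ᴹ-refl) (≈ᴹ-trans (*ₗ-assoc πO c x)
        (≈ᴹ-trans (π-agree (c *ₗ x)) (≈ᴹ-trans (*ᵣ-cong ≈ᴹ-refl πO≈ΠO²)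
        (≈ᴹ-sym (*ᵣ-assoc (c *ₗ x) ΠO ΠO)))))

      LΠO⊆LΠ : ∀ {b} x → rightMultiples ΠO b → LΠ (x *ᵣ b)
      LΠO⊆LΠ x (c , e) = let c′ , move , _ = O-twist c in
        x *ᵣ c′ , ≈ᴹ-trans (*ᵣ-cong ≈ᴹ-refl (B.trans e move)) (≈ᴹ-sym (*ᵣ-assoc x c′ ΠO))

      ΠOL⊆ΠL : ∀ {a} x → rightMultiples ΠO a → ΠL (a *ₗ x)
      ΠOL⊆ΠL x (c , e) = c *ₗ x , ≈ᴹ-trans (*ₗ-cong e ≈ᴹ-refl) (*ₗ-assoc ΠO c x)

      Lπ⊆ΠL : ∀ {b} x → rightMultiples πO b → ΠL (x *ᵣ b)
      Lπ⊆ΠL x (c , e) = ΠO *ₗ (x *ᵣ c) ,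
        ≈ᴹ-trans (*ᵣ-cong ≈ᴹ-refl (B.trans e (πO-central c)))
        (≈ᴹ-trans (≈ᴹ-sym (*ᵣ-assoc x c πO)) (≈ᴹ-trans (≈ᴹ-sym (π-agree (x *ᵣ c)))
        (≈ᴹ-trans (*ₗ-cong πO≈ΠO² ≈ᴹ-refl) (*ₗ-assoc ΠO ΠO (x *ᵣ c)))))

    rightTruncation : 𝔽q²[ε]-𝔽q²-Bimodule
    rightTruncation = record
      { bimodule = quotientBimodule bimodule LΠ-isSubBimodule
                     πO-isIdeal ΠO-isIdeal πL⊆LΠ LΠO⊆LΠ
      ; finitelyGenerated = quotient-fg bimodule LΠ-isSubBimodule
                     πO-isIdeal ΠO-isIdeal πL⊆LΠ LΠO⊆LΠ finitelyGenerated
      ; actionsAgree = λ a x → AbelianQuotient.≈⇒≋ +ᴹ-abelianGroup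
                     (IsSubBimodule.isSubgroup LΠ-isSubBimodule) (actionsAgree a x)
      }

    leftTruncation : 𝔽q²-𝔽q²[ε]-Bimodule
    leftTruncation = record
      { bimodule = quotientBimodule bimodule ΠL-isSubBimodule
                     ΠO-isIdeal πO-isIdeal ΠOL⊆ΠL Lπ⊆ΠL
      ; finitelyGenerated = quotient-fg bimodule ΠL-isSubBimodule
                     ΠO-isIdeal πO-isIdeal ΠOL⊆ΠL Lπ⊆ΠL finitelyGenerated
      ; actionsAgree = λ a x → AbelianQuotient.≈⇒≋ +ᴹ-abelianGroup
                     (IsSubBimodule.isSubgroup ΠL-isSubBimodule) (actionsAgree a x)
      }

{-# OPTIONS --safe #-}

-- Write O_K ⊗ O_K = O_K × O_K, using some ζ ∈ O_K such that σζ - ζ is a unit. It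
-- grades a bimodule L by Z/2 (xa = ax in degree 0, xa = (σa)x in degree 1), and
-- left and right multiplication by Π become commuting operators Πₗ, Πᵣ of degree 1
-- that are σ-semilinear, respectively linear, over O_K, with Πₗ² = Πᵣ² = π. On the
-- truncation M = L/LΠ only the differential Πₗ survives, so M is classified by the
-- ranks of Πₗ and the dimensions of its homology in the two degrees: it has a basis
-- e, Πe, f with Πf = 0.
--
-- Some such basis lifts to L so that Πf = fΠ. Indeed Πₗ Πᵣ⁻¹ is a σ-semilinear
-- involution of {x ∈ L : Πx ∈ LΠ}, which is therefore spanned over O_K by its fixed
-- points. By Nakayama's lemma and descent along powers of π, the e, Πe, f then form a
-- basis of L as a right O_B-module, so L is determined by the same four numbers as
-- M, and all of them occur. The left truncation is the same statement with Πₗ and Πᵣ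
-- exchanged.
module Submission where

open import Defs
open import Algebra.Bundles using (AbelianGroup; CommutativeMonoid; CommutativeRing; Ring)
open import Algebra.Module.Bundles using (Bimodule; LeftModule)
open import Algebra.Module.Morphism.Structures using (module BimoduleMorphisms)
import Algebra.Module.Properties.LeftModule as LeftModuleProperties
open import Algebra.Morphism.Structures using (module RingMorphisms)
import Algebra.Properties.AbelianGroup as AbelianGroupProperties
import Algebra.Properties.CommutativeMonoid.Sum as Sum
import Algebra.Properties.CommutativeSemigroup as CommutativeSemigroupProperties
import Algebra.Properties.Ring as RingProperties
import Algebra.Properties.Semiring.Exp as Exp
import Algebra.Solver.Ring.NaturalCoefficients.Default as SemiringSolver
open import Axiom.ExcludedMiddle using (ExcludedMiddle)
open import Data.Bool.Base using (Bool; true; false; not)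
import Data.Bool.Properties as Bool
open import Data.Empty using (⊥; ⊥-elim)
open import Data.Fin.Base using (Fin; zero; suc; _↑ˡ_; _↑ʳ_; punchIn; punchOut; splitAt)
import Data.Fin.Properties as Fin
open import Data.Integer.Base as ℤ using (ℤ; +_; -[1+_]; 0ℤ; 1ℤ)
import Data.Integer.Properties as ℤ
open import Data.List.Base as List using (List)
open import Data.List.Membership.Propositional using (_∈_)
import Data.List.Membership.Propositional.Properties as ∈
open import Data.List.Relation.Unary.Any as Any using (here; there)
import Data.List.Relation.Unary.Any.Properties as Any using (lookup-index)
open import Data.Nat.Base as ℕ using (ℕ; zero; suc; z≤n; s≤s)
import Data.Nat.Properties as ℕ
open import Data.Product.Base using (∃; ∃-syntax; _×_; _,_; proj₁; proj₂)
open import Data.Sum.Base using (_⊎_; inj₁; inj₂)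
open import Data.Vec.Functional using (Vector; _∷_; _++_; insertAt; removeAt; tail)
open import Data.Vec.Functional.Properties
  using (insertAt-lookup; insertAt-punchIn; lookup-++ˡ; lookup-++ʳ)
open import Function.Base using (_∘_; id)
open import Function.Bundles using (Bijection)
open import Function.Structures using (IsBijection)
open import Level using (Level)
open import Relation.Binary.Construct.Add.Supremum.NonStrict ℤ._≤_
  using (_≤⁺_; [_]; _≤⊤⁺)
import Relation.Binary.Construct.On as On
open import Relation.Binary.Definitions using (DecidableEquality)
open import Relation.Binary.PropositionalEquality.Core as ≡ using (_≡_)
import Relation.Binary.Reasoning.Setoid as SetoidReasoning
open import Relation.Binary.Structures using (IsEquivalence)
open import Relation.Nullary.Construct.Add.Supremum using (_⁺; ⊤⁺; [_])
open import Relation.Nullary.Decidable.Core using (yes; no; map′; _×-dec_)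
open import Relation.Nullary.Negation.Core using (¬_; contradiction)
open import Relation.Unary using (Pred; _⊆_)

-- Linear algebra over a local ring

-- The relation Πf = fΠ is the crux. Lying in the kernel of the differential only says that Πf = f′Π
-- for some f′, possibly different from f, and a basis over O_B on the right does not by itself
-- determine how Π acts on the left. The relation is therefore demanded exactly, not modulo LΠ, of
-- every adapted basis. On a truncation it reads Πf = 0, so one notion of basis serves bilattices
-- and truncations alike, and a basis of L maps to one of L/LΠ with the same four sizes. These sizes
-- are dimensions over the residue field, but no quotient space is formed: every condition is stated
-- in the module itself, modulo a submodule containing all multiples of π.
--
-- The element ζ is not given. Residue degree 2 has to be converted into a nontrivial action of σ on
-- residues: if σ acted trivially, the trace (when 2 is a unit) or the norm (when 2 is in the
-- maximal ideal, where square roots exist in the finite residue field) would place every residue in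
-- that of F.
--
-- Excluded middle enters in two places, the selection of bases among generators and the existence
-- of ζ.

module _ {c ℓ} (A : AbelianGroup c ℓ) where
  open AbelianGroup A

  x∙[y-x]≈y : ∀ x y → x ∙ (y ∙ x ⁻¹) ≈ y
  x∙[y-x]≈y x y = trans (sym (assoc x y (x ⁻¹))) (AbelianGroupProperties.xyx⁻¹≈y A x y)

module _ {ℓ} (R : CommutativeRing ℓ ℓ) where
  open CommutativeRing R

  Unit : Pred Carrier ℓ
  Unit a = ∃[ b ] b * a ≈ 1#

  Multiple : Carrier → Pred Carrier ℓ
  Multiple π a = ∃[ b ] a ≈ π * b

-- The two hypotheses make the ring local with maximal ideal generated by π. The dichotomy is data,
-- so that a unit among finitely many coefficients is found by search.
module LocalLinearAlgebra
  {ℓ} (R : CommutativeRing ℓ ℓ) (π : CommutativeRing.Carrier R)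
  (unit-or-𝔪 : ∀ a → Unit R a ⊎ Multiple R π a)
  (1∉𝔪 : ¬ Multiple R π (CommutativeRing.1# R)) where
  open CommutativeRing R hiding (zero)

  𝔪 : Pred Carrier ℓ
  𝔪 = Multiple R π

  module LinearAlgebra (M : LeftModule ring ℓ ℓ) where
    open LeftModule M
    open LeftModuleProperties M using (inverseʳ-uniqueᴹ)
    open AbelianGroupProperties +ᴹ-abelianGroup using (xyx⁻¹≈y)
    open CommutativeSemigroupProperties
      (CommutativeMonoid.commutativeSemigroup +ᴹ-commutativeMonoid) using (interchange)
    open Sum +ᴹ-commutativeMonoid using (sum; sum-remove)
    open SetoidReasoning ≈ᴹ-setoid

    -‿*ₗ : ∀ a x → (- a) *ₗ x ≈ᴹ -ᴹ (a *ₗ x)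
    -‿*ₗ a x = inverseʳ-uniqueᴹ _ _ (begin
      a *ₗ x +ᴹ (- a) *ₗ x  ≈⟨ *ₗ-distribʳ x a (- a) ⟨
      (a + - a) *ₗ x        ≈⟨ *ₗ-cong (-‿inverseʳ a) ≈ᴹ-refl ⟩
      0# *ₗ x               ≈⟨ *ₗ-zeroˡ x ⟩
      0ᴹ                    ∎)

    -1*ₗ : ∀ x → (- 1#) *ₗ x ≈ᴹ -ᴹ x
    -1*ₗ x = ≈ᴹ-trans (-‿*ₗ 1# x) (-ᴹ‿cong (*ₗ-identityˡ x))

    comb : ∀ {n} → Vector Carrier n → Vector Carrierᴹ n → Carrierᴹ
    comb {zero}  a x = 0ᴹ
    comb {suc n} a x = a zero *ₗ x zero +ᴹ comb (tail a) (tail x)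

    comb≈sum : ∀ {n} (a : Vector Carrier n) x → comb a x ≈ᴹ sum (λ i → a i *ₗ x i)
    comb≈sum {zero}  a x = ≈ᴹ-refl
    comb≈sum {suc n} a x = +ᴹ-congˡ (comb≈sum (tail a) (tail x))

    comb-cong : ∀ {n} {a b : Vector Carrier n} {x y : Vector Carrierᴹ n} →
                (∀ i → a i ≈ b i) → (∀ i → x i ≈ᴹ y i) → comb a x ≈ᴹ comb b y
    comb-cong {zero}  p q = ≈ᴹ-refl
    comb-cong {suc n} p q = +ᴹ-cong (*ₗ-cong (p zero) (q zero)) (comb-cong (p ∘ suc) (q ∘ suc))

    comb-+ : ∀ {n} (a b : Vector Carrier n) x →
             comb (λ i → a i + b i) x ≈ᴹ comb a x +ᴹ comb b x
    comb-+ {zero}  a b x = ≈ᴹ-sym (+ᴹ-identityˡ 0ᴹ)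
    comb-+ {suc n} a b x = ≈ᴹ-trans
      (+ᴹ-cong (*ₗ-distribʳ _ _ _) (comb-+ (tail a) (tail b) (tail x)))
      (interchange _ _ _ _)

    comb-* : ∀ {n} c (a : Vector Carrier n) x →
             comb (λ i → c * a i) x ≈ᴹ c *ₗ comb a x
    comb-* {zero}  c a x = ≈ᴹ-sym (*ₗ-zeroʳ c)
    comb-* {suc n} c a x = ≈ᴹ-trans
      (+ᴹ-cong (*ₗ-assoc c _ _) (comb-* c (tail a) (tail x)))
      (≈ᴹ-sym (*ₗ-distribˡ c _ _))

    comb-+ᴹ : ∀ {n} (a : Vector Carrier n) x y →
              comb a (λ i → x i +ᴹ y i) ≈ᴹ comb a x +ᴹ comb a y
    comb-+ᴹ {zero}  a x y = ≈ᴹ-sym (+ᴹ-identityˡ 0ᴹ)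
    comb-+ᴹ {suc n} a x y = ≈ᴹ-trans
      (+ᴹ-cong (*ₗ-distribˡ _ _ _) (comb-+ᴹ (tail a) (tail x) (tail y)))
      (interchange _ _ _ _)

    comb-0 : ∀ {n} (x : Vector Carrierᴹ n) → comb (λ _ → 0#) x ≈ᴹ 0ᴹ
    comb-0 {zero}  x = ≈ᴹ-refl
    comb-0 {suc n} x = ≈ᴹ-trans (+ᴹ-cong (*ₗ-zeroˡ _) (comb-0 (tail x))) (+ᴹ-identityˡ 0ᴹ)

    comb-remove : ∀ {n} i (a : Vector Carrier (suc n)) x →
                  comb a x ≈ᴹ a i *ₗ x i +ᴹ comb (removeAt a i) (removeAt x i)
    comb-remove i a x = ≈ᴹ-trans (comb≈sum a x)
      (≈ᴹ-trans (sum-remove {i = i} (λ j → a j *ₗ x j))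
        (+ᴹ-congˡ (≈ᴹ-sym (comb≈sum (removeAt a i) (removeAt x i)))))

    record IsSubmodule (W : Pred Carrierᴹ ℓ) : Set ℓ where
      field
        ≈-resp : ∀ {x y} → x ≈ᴹ y → W x → W y
        0∈   : W 0ᴹ
        +∈   : ∀ {x y} → W x → W y → W (x +ᴹ y)
        *∈   : ∀ a {x} → W x → W (a *ₗ x)

      -∈ : ∀ {x} → W x → W (-ᴹ x)
      -∈ p = ≈-resp (-1*ₗ _) (*∈ (- 1#) p)

      +-cancel∈ : ∀ {x y} → W x → W (x +ᴹ y) → W y
      +-cancel∈ p q = ≈-resp (xyx⁻¹≈y _ _) (+∈ q (-∈ p))

      comb∈ : ∀ {n} (a : Vector Carrier n) {x : Vector Carrierᴹ n} →
              (∀ i → W (x i)) → W (comb a x)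
      comb∈ {zero}  a p = 0∈
      comb∈ {suc n} a p = +∈ (*∈ (a zero) (p zero)) (comb∈ (tail a) (p ∘ suc))

    Adjoin : ∀ {n} → Vector Carrierᴹ n → Pred Carrierᴹ ℓ → Pred Carrierᴹ ℓ
    Adjoin x W z = ∃[ a ] ∃[ t ] W t × z ≈ᴹ comb a x +ᴹ t

    -- When `W` contains all multiples of π, the quotient by `W` is a vector space over the residue
    -- field, and this is linear independence there: a coefficient is zero as soon as it lies in
    -- `𝔪`.
    Independent : ∀ {n} → Vector Carrierᴹ n → Pred Carrierᴹ ℓ → Set ℓ
    Independent x W = ∀ a → W (comb a x) → ∀ i → 𝔪 (a i)

    module _ {W : Pred Carrierᴹ ℓ} (isSub : IsSubmodule W) where
      open IsSubmodule isSub

      Adjoin-isSubmodule : ∀ {n} (x : Vector Carrierᴹ n) → IsSubmodule (Adjoin x W)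
      Adjoin-isSubmodule x = record
        { ≈-resp = λ e (a , t , p , f) → a , t , p , ≈ᴹ-trans (≈ᴹ-sym e) f
        ; 0∈ = (λ _ → 0#) , 0ᴹ , 0∈ ,
               ≈ᴹ-sym (≈ᴹ-trans (+ᴹ-identityʳ _) (comb-0 x))
        ; +∈ = λ (a , t , p , e) (b , s , q , f) →
            (λ i → a i + b i) , t +ᴹ s , +∈ p q ,
            ≈ᴹ-trans (+ᴹ-cong e f) (≈ᴹ-trans (interchange _ _ _ _)
              (+ᴹ-congʳ (≈ᴹ-sym (comb-+ a b x))))
        ; *∈ = λ c (a , t , p , e) →
            (λ i → c * a i) , c *ₗ t , *∈ c p ,
            ≈ᴹ-trans (*ₗ-cong refl e) (≈ᴹ-trans (*ₗ-distribˡ c _ _)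
              (+ᴹ-congʳ (≈ᴹ-sym (comb-* c a x))))
        }

      base⊆Adjoin : ∀ {n} (x : Vector Carrierᴹ n) → W ⊆ Adjoin x W
      base⊆Adjoin x {z} p = (λ _ → 0#) , z , p ,
        ≈ᴹ-sym (≈ᴹ-trans (+ᴹ-congʳ (comb-0 x)) (+ᴹ-identityˡ z))

      Adjoin-tail : ∀ {n} (x : Vector Carrierᴹ (suc n)) → Adjoin (tail x) W ⊆ Adjoin x W
      Adjoin-tail x (a , t , p , e) = (0# ∷ a) , t , p ,
        ≈ᴹ-trans e (+ᴹ-congʳ (≈ᴹ-sym (≈ᴹ-trans (+ᴹ-congʳ (*ₗ-zeroˡ _)) (+ᴹ-identityˡ _))))

      ∈Adjoin : ∀ {n} (x : Vector Carrierᴹ n) i → Adjoin x W (x i)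
      ∈Adjoin x zero = (1# ∷ λ _ → 0#) , 0ᴹ , 0∈ , ≈ᴹ-sym (begin
        (1# *ₗ x zero +ᴹ comb (λ _ → 0#) (tail x)) +ᴹ 0ᴹ  ≈⟨ +ᴹ-identityʳ _ ⟩
        1# *ₗ x zero +ᴹ comb (λ _ → 0#) (tail x)          ≈⟨ +ᴹ-cong (*ₗ-identityˡ _) (comb-0 (tail x)) ⟩
        x zero +ᴹ 0ᴹ                                      ≈⟨ +ᴹ-identityʳ _ ⟩
        x zero                                            ∎)
      ∈Adjoin x (suc i) = Adjoin-tail x (∈Adjoin (tail x) i)

      Adjoin-uncons : ∀ {n} (x : Vector Carrierᴹ (suc n)) {z} → Adjoin x W z →
                      ∃[ c ] ∃[ s ] Adjoin (tail x) W s × z ≈ᴹ c *ₗ x zero +ᴹ s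
      Adjoin-uncons x (a , t , p , e) = a zero , comb (tail a) (tail x) +ᴹ t ,
        (tail a , t , p , ≈ᴹ-refl) , ≈ᴹ-trans e (+ᴹ-assoc _ _ _)

      Adjoin-least : ∀ {n} {x : Vector Carrierᴹ n} {S} → IsSubmodule S → W ⊆ S →
                     (∀ i → S (x i)) → Adjoin x W ⊆ S
      Adjoin-least S-isSub W⊆S p (a , t , q , e) =
        S.≈-resp (≈ᴹ-sym e) (S.+∈ (S.comb∈ a p) (W⊆S q))
        where module S = IsSubmodule S-isSub

    module _ {W : Pred Carrierᴹ ℓ} (isSub : IsSubmodule W) (π∈ : ∀ x → W (π *ₗ x)) where
      open IsSubmodule isSub

      𝔪∈ : ∀ {a} → 𝔪 a → ∀ x → W (a *ₗ x)
      𝔪∈ (b , e) x = ≈-resp (≈ᴹ-sym (≈ᴹ-trans (*ₗ-cong e ≈ᴹ-refl) (*ₗ-assoc π b x))) (π∈ _)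

      comb-𝔪∈ : ∀ {n} {a : Vector Carrier n} → (∀ i → 𝔪 (a i)) → ∀ x → W (comb a x)
      comb-𝔪∈ {zero}  p x = 0∈
      comb-𝔪∈ {suc n} p x = +∈ (𝔪∈ (p zero) (x zero)) (comb-𝔪∈ (p ∘ suc) (tail x))

      -- If the coefficient of `y` in a relation were a unit, one could solve for `y` and place it
      -- in the span. Otherwise its term lies in `W`, and what is left is a relation among the `x`.
      independent-∷ : ∀ {n} {x : Vector Carrierᴹ n} {y} → Independent x W →
                      ¬ Adjoin x W y → Independent (y ∷ x) W
      independent-∷ {x = x} {y} ind y∉ a p with unit-or-𝔪 (a zero)
      ... | inj₁ (b , ba≈1) = ⊥-elim (y∉ (X.≈-resp by≈y (X.*∈ b (X.+-cancel∈ rest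
              (X.≈-resp (+ᴹ-comm _ _) (base⊆Adjoin isSub x p))))))
        where
        module X = IsSubmodule (Adjoin-isSubmodule isSub x)
        rest : Adjoin x W (comb (tail a) x)
        rest = tail a , 0ᴹ , 0∈ , ≈ᴹ-sym (+ᴹ-identityʳ _)
        by≈y : b *ₗ a zero *ₗ y ≈ᴹ y
        by≈y = ≈ᴹ-trans (≈ᴹ-sym (*ₗ-assoc b _ y))
                 (≈ᴹ-trans (*ₗ-cong ba≈1 ≈ᴹ-refl) (*ₗ-identityˡ y))
      ... | inj₂ a₀∈𝔪 = λ where
              zero    → a₀∈𝔪
              (suc i) → ind (tail a) (+-cancel∈ (𝔪∈ a₀∈𝔪 y) p) i

      -- The basis is selected from the given vectors, so that `basis⊆` hands down their properties;
      -- below these are being homogeneous and being balanced.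
      record Extraction {n} (x : Vector Carrierᴹ n) : Set ℓ where
        field
          size        : ℕ
          basis       : Vector Carrierᴹ size
          basis⊆      : ∀ k → ∃[ i ] basis k ≡ x i
          independent : Independent basis W
          spans       : ∀ i → Adjoin basis W (x i)

      -- Greedy selection: excluded middle decides whether the next vector is already in the span of
      -- those kept.
      extract : ExcludedMiddle ℓ → ∀ {n} (x : Vector Carrierᴹ n) → Extraction x
      extract em {zero} x = record
        { size = 0 ; basis = λ () ; basis⊆ = λ () ; independent = λ _ _ () ; spans = λ () }
      extract em {suc n} x with extract em (tail x)
      ... | E with em {Adjoin (Extraction.basis E) W (x zero)}
      ... | yes x₀∈ = record
              { size = size ; basis = basis
              ; basis⊆ = λ k → suc (proj₁ (basis⊆ k)) , proj₂ (basis⊆ k)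
              ; independent = independent
              ; spans = λ { zero → x₀∈ ; (suc i) → spans i } }
        where open Extraction E
      ... | no x₀∉ = record
              { size = suc size ; basis = x zero ∷ basis
              ; basis⊆ = λ where
                  zero    → zero , ≡.refl
                  (suc k) → suc (proj₁ (basis⊆ k)) , proj₂ (basis⊆ k)
              ; independent = independent-∷ independent x₀∉
              ; spans = λ where
                  zero    → ∈Adjoin isSub (x zero ∷ basis) zero
                  (suc i) → Adjoin-tail isSub (x zero ∷ basis) (spans i) }
        where open Extraction E

    private
      pivot : ∀ {n} (a : Vector Carrier n) →
              (∃[ i ] ∃[ b ] b * a i ≈ 1#) ⊎ (∀ i → 𝔪 (a i))
      pivot {zero}  a = inj₂ λ ()
      pivot {suc n} a with unit-or-𝔪 (a zero) | pivot (tail a)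
      ... | inj₁ u | _            = inj₁ (zero , u)
      ... | inj₂ _ | inj₁ (i , u) = inj₁ (suc i , u)
      ... | inj₂ p | inj₂ q       = inj₂ λ { zero → p ; (suc i) → q i }

    -- Steinitz exchange: a unit coefficient at y₀ is used to eliminate y₀,
    -- at the cost of one of the x's.
    independent≤spanning :
      ∀ {W} → IsSubmodule W → (∀ x → W (π *ₗ x)) →
      ∀ {m n} (x : Vector Carrierᴹ m) (y : Vector Carrierᴹ n) →
      Independent x W → (∀ i → Adjoin y W (x i)) → m ℕ.≤ n
    independent≤spanning isSub π∈ {zero} x y ind span = z≤n
    independent≤spanning {W} isSub π∈ {suc m} {zero} x y ind span =
      ⊥-elim (1∉𝔪 (ind (λ _ → 1#) (comb∈ (λ _ → 1#) x∈) zero))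
      where
      open IsSubmodule isSub
      x∈ : ∀ i → W (x i)
      x∈ i = Adjoin-least isSub {x = y} isSub (λ p → p) (λ ()) (span i)
    independent≤spanning {W} isSub π∈ {suc m} {suc n} x y ind span
      with pivot (λ i → proj₁ (Adjoin-uncons isSub y (span i)))
    ... | inj₂ small = ℕ.m≤n⇒m≤1+n (independent≤spanning isSub π∈ x (tail y) ind span′)
      where
      open IsSubmodule (Adjoin-isSubmodule isSub (tail y))
      span′ : ∀ i → Adjoin (tail y) W (x i)
      span′ i = let c , s , p , e = Adjoin-uncons isSub y (span i) in
        ≈-resp (≈ᴹ-sym e) (+∈ (base⊆Adjoin isSub (tail y) (𝔪∈ isSub π∈ (small i) _)) p)
    ... | inj₁ (i , b , bc≈1) =
      s≤s (independent≤spanning isSub π∈ x′ (tail y) ind′ span′)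
      where
      module W = IsSubmodule isSub
      open IsSubmodule (Adjoin-isSubmodule isSub (tail y))
      c : Vector Carrier (suc m)
      c j = proj₁ (Adjoin-uncons isSub y (span j))
      d : Vector Carrier m
      d j = - (c (punchIn i j) * b)
      x′ : Vector Carrierᴹ m
      x′ j = x (punchIn i j) +ᴹ d j *ₗ x i
      span′ : ∀ j → Adjoin (tail y) W (x′ j)
      span′ j =
        let s , p , e = proj₂ (Adjoin-uncons isSub y (span (punchIn i j)))
            t , q , f = proj₂ (Adjoin-uncons isSub y (span i))
            cⱼ = c (punchIn i j)
            cancel : cⱼ + d j * c i ≈ 0#
            cancel = trans (+-congˡ (trans (sym (-‿distribˡ-* _ _))
              (-‿cong (trans (*-assoc _ _ _) (trans (*-congˡ bc≈1) (*-identityʳ _))))))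
              (-‿inverseʳ _)
        in ≈-resp (≈ᴹ-sym (begin
          x (punchIn i j) +ᴹ d j *ₗ x i
            ≈⟨ +ᴹ-cong e (≈ᴹ-trans (*ₗ-cong refl f) (*ₗ-distribˡ _ _ _)) ⟩
          (cⱼ *ₗ y zero +ᴹ s) +ᴹ (d j *ₗ c i *ₗ y zero +ᴹ d j *ₗ t)
            ≈⟨ interchange _ _ _ _ ⟩
          (cⱼ *ₗ y zero +ᴹ d j *ₗ c i *ₗ y zero) +ᴹ (s +ᴹ d j *ₗ t)
            ≈⟨ +ᴹ-congʳ (+ᴹ-congˡ (*ₗ-assoc _ _ _)) ⟨
          (cⱼ *ₗ y zero +ᴹ (d j * c i) *ₗ y zero) +ᴹ (s +ᴹ d j *ₗ t)
            ≈⟨ +ᴹ-congʳ (*ₗ-distribʳ _ _ _) ⟨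
          (cⱼ + d j * c i) *ₗ y zero +ᴹ (s +ᴹ d j *ₗ t)
            ≈⟨ +ᴹ-congʳ (≈ᴹ-trans (*ₗ-cong cancel ≈ᴹ-refl) (*ₗ-zeroˡ _)) ⟩
          0ᴹ +ᴹ (s +ᴹ d j *ₗ t)
            ≈⟨ +ᴹ-identityˡ _ ⟩
          s +ᴹ d j *ₗ t ∎))
          (+∈ p (*∈ (d j) q))
        where open RingProperties ring using (-‿distribˡ-*)
      comb-const : ∀ {k} (a e : Vector Carrier k) z →
                   ∃[ r ] comb a (λ j → e j *ₗ z) ≈ᴹ r *ₗ z
      comb-const {zero}  a e z = 0# , ≈ᴹ-sym (*ₗ-zeroˡ z)
      comb-const {suc k} a e z = let r , f = comb-const (tail a) (tail e) z in
        a zero * e zero + r ,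
        ≈ᴹ-trans (+ᴹ-cong (≈ᴹ-sym (*ₗ-assoc _ _ _)) f) (≈ᴹ-sym (*ₗ-distribʳ _ _ _))
      -- All multiples of `x i` that occur in a relation among the `x′` are collected in one
      -- coefficient `r`. Inserting it at position `i` gives a relation among the `x` that keeps the
      -- other coefficients.
      ind′ : Independent x′ W
      ind′ a p j = ≡.subst 𝔪 (insertAt-punchIn a i r j) (ind a⁺ (W.≈-resp eq p) (punchIn i j))
        where
        r = proj₁ (comb-const a d (x i))
        a⁺ = insertAt a i r
        eq : comb a x′ ≈ᴹ comb a⁺ x
        eq = begin
          comb a x′
            ≈⟨ comb-+ᴹ a (removeAt x i) (λ j → d j *ₗ x i) ⟩
          comb a (removeAt x i) +ᴹ comb a (λ j → d j *ₗ x i)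
            ≈⟨ +ᴹ-congˡ (proj₂ (comb-const a d (x i))) ⟩
          comb a (removeAt x i) +ᴹ r *ₗ x i
            ≈⟨ +ᴹ-comm _ _ ⟩
          r *ₗ x i +ᴹ comb a (removeAt x i)
            ≈⟨ +ᴹ-cong (*ₗ-cong (reflexive (insertAt-lookup a i r)) ≈ᴹ-refl)
                 (comb-cong (λ j → reflexive (insertAt-punchIn a i r j)) (λ _ → ≈ᴹ-refl)) ⟨
          a⁺ i *ₗ x i +ᴹ comb (removeAt a⁺ i) (removeAt x i)
            ≈⟨ comb-remove i a⁺ x ⟨
          comb a⁺ x ∎

    private
      1-𝔪-unit : ∀ a → ∃[ b ] b * (1# + - (π * a)) ≈ 1#
      1-𝔪-unit a with unit-or-𝔪 (1# + - (π * a))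
      ... | inj₁ u       = u
      ... | inj₂ (b , e) = ⊥-elim (1∉𝔪 (b + a ,
        trans (sym (trans (+-assoc _ _ _) (trans (+-congˡ (-‿inverseˡ _)) (+-identityʳ _))))
          (trans (+-congʳ e) (sym (distribˡ π b a)))))

    nakayama : ∀ {S} → IsSubmodule S → ∀ {n} (x : Vector Carrierᴹ n) →
               (∀ z → Adjoin x S z) →
               (∀ z → ∃[ y ] ∃[ s ] S s × z ≈ᴹ π *ₗ y +ᴹ s) → ∀ z → S z
    nakayama isSub {zero} x generates step z = Adjoin-least isSub {x = x} isSub (λ p → p) (λ ()) (generates z)
    nakayama {S} isSub {suc n} x generates step =
      nakayama isSub (tail x)
        (λ z → Adjoin-least isSub X-isSub (λ p → base⊆Adjoin isSub (tail x) p) x∈ (generates z)) step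
      where
      X-isSub = Adjoin-isSubmodule isSub (tail x)
      open IsSubmodule X-isSub
      x₀∈ : Adjoin (tail x) S (x zero)
      x₀∈ =
        let y , s , p , e = step (x zero)
            a , t , q , f = Adjoin-uncons isSub x (generates y)
            b , g         = 1-𝔪-unit a
            x₀ = x zero
            rhs = π *ₗ t +ᴹ s
            eq : (1# + - (π * a)) *ₗ x₀ ≈ᴹ rhs
            eq = begin
              (1# + - (π * a)) *ₗ x₀           ≈⟨ *ₗ-distribʳ _ _ _ ⟩
              1# *ₗ x₀ +ᴹ (- (π * a)) *ₗ x₀    ≈⟨ +ᴹ-cong (≈ᴹ-trans (*ₗ-identityˡ _)
                                                   (≈ᴹ-trans e (+ᴹ-congʳ (≈ᴹ-trans (*ₗ-cong refl f)
                                                     (≈ᴹ-trans (*ₗ-distribˡ _ _ _) (+ᴹ-congʳ (≈ᴹ-sym (*ₗ-assoc _ _ _))))))))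
                                                   (-‿*ₗ _ _) ⟩
              (((π * a) *ₗ x₀ +ᴹ π *ₗ t) +ᴹ s) +ᴹ -ᴹ ((π * a) *ₗ x₀)
                                                ≈⟨ +ᴹ-congʳ (+ᴹ-assoc _ _ _) ⟩
              ((π * a) *ₗ x₀ +ᴹ rhs) +ᴹ -ᴹ ((π * a) *ₗ x₀)
                                                ≈⟨ xyx⁻¹≈y _ _ ⟩
              rhs ∎
        in ≈-resp (≈ᴹ-trans (*ₗ-cong refl (≈ᴹ-sym eq))
                  (≈ᴹ-trans (≈ᴹ-sym (*ₗ-assoc _ _ _))
                    (≈ᴹ-trans (*ₗ-cong g ≈ᴹ-refl) (*ₗ-identityˡ _))))
             (*∈ b (+∈ (*∈ π q) (base⊆Adjoin isSub (tail x) p)))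
      x∈ : ∀ i → Adjoin (tail x) S (x i)
      x∈ zero    = x₀∈
      x∈ (suc i) = ∈Adjoin isSub (tail x) i

-- Graded bimodules with two square roots of π

-- The properties of O_K with its Galois involution that the classification
-- uses; δ⁻¹ witnesses that K/F is unramified.
record UnramifiedInvolution (ℓ : Level) : Set (Level.suc ℓ) where
  field
    commutativeRing : CommutativeRing ℓ ℓ
  open CommutativeRing commutativeRing public hiding (zero)
  field
    σ       : Carrier → Carrier
    σ-isHom : IsRingHom ring ring σ
    σ-σ     : ∀ a → σ (σ a) ≈ a
    π       : Carrier
    σπ≈π    : σ π ≈ π
    unit-or-𝔪 : ∀ a → (∃[ b ] b * a ≈ 1#) ⊎ (∃[ b ] a ≈ π * b)
    1∉𝔪       : ¬ (∃[ b ] 1# ≈ π * b)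
  open Exp semiring public using (_^_)
  field
    separated : ∀ {a} → (∀ n → ∃[ b ] a ≈ (π ^ n) * b) → a ≈ 0#
    ζ δ⁻¹   : Carrier
    δ⁻¹δ≈1  : δ⁻¹ * (σ ζ + - ζ) ≈ 1#

  open RingMorphisms.IsRingHomomorphism σ-isHom public using ()
    renaming (⟦⟧-cong to σ-cong; +-homo to σ-+; *-homo to σ-*; 1#-homo to σ-1; 0#-homo to σ-0; -‿homo to σ-neg)
  open LocalLinearAlgebra commutativeRing π unit-or-𝔪 1∉𝔪 public

  δ : Carrier
  δ = σ ζ + - ζ

  open RingProperties ring
    using (-‿distribˡ-*; -‿distribʳ-*; -‿involutive; ⁻¹-anti-homo‿-; x[y-z]≈xy-xz)
  open SetoidReasoning setoid

  x+[y-x]≈y : ∀ x y → x + (y + - x) ≈ y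
  x+[y-x]≈y = x∙[y-x]≈y +-abelianGroup

  σ[σx-x]≈-[σx-x] : ∀ x → σ (σ x + - x) ≈ - (σ x + - x)
  σ[σx-x]≈-[σx-x] x = begin
    σ (σ x + - x)      ≈⟨ σ-+ _ _ ⟩
    σ (σ x) + σ (- x)  ≈⟨ +-cong (σ-σ x) (σ-neg x) ⟩
    x + - σ x          ≈⟨ ⁻¹-anti-homo‿- (σ x) x ⟨
    - (σ x + - x)      ∎

  σδ⁻¹≈-δ⁻¹ : σ δ⁻¹ ≈ - δ⁻¹
  σδ⁻¹≈-δ⁻¹ = begin
    σ δ⁻¹                    ≈⟨ *-identityʳ _ ⟨
    σ δ⁻¹ * 1#               ≈⟨ *-congˡ (trans (*-comm _ _) δ⁻¹δ≈1) ⟨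
    σ δ⁻¹ * (δ * δ⁻¹)        ≈⟨ *-assoc _ _ _ ⟨
    (σ δ⁻¹ * δ) * δ⁻¹        ≈⟨ *-congʳ eq ⟩
    - 1# * δ⁻¹               ≈⟨ RingProperties.-1*x≈-x ring δ⁻¹ ⟩
    - δ⁻¹                    ∎
    where
    eq : σ δ⁻¹ * δ ≈ - 1#
    eq = begin
      σ δ⁻¹ * δ          ≈⟨ *-congˡ (trans (-‿cong (σ[σx-x]≈-[σx-x] ζ)) (-‿involutive δ)) ⟨
      σ δ⁻¹ * - σ δ      ≈⟨ -‿distribʳ-* _ _ ⟨
      - (σ δ⁻¹ * σ δ)    ≈⟨ -‿cong (trans (sym (σ-* _ _)) (trans (σ-cong δ⁻¹δ≈1) σ-1)) ⟩
      - 1#               ∎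

  Fixed : Pred Carrier ℓ
  Fixed a = σ a ≈ a

  -- This is O_K = O_F ⊕ O_F ζ. Both σa - a and δ change sign under σ, so their quotient t is fixed;
  -- and a - tζ is fixed because σa - a = tδ.
  fixed-coordinates : ∀ a → ∃[ s ] ∃[ t ] Fixed s × Fixed t × a ≈ s + t * ζ
  fixed-coordinates a = a + - (t * ζ) , t , σs≈s , σt≈t ,
    sym (trans (+-comm _ _) (x+[y-x]≈y _ _))
    where
    t = δ⁻¹ * (σ a + - a)
    σt≈t : σ t ≈ t
    σt≈t = begin
      σ t                          ≈⟨ σ-* _ _ ⟩
      σ δ⁻¹ * σ (σ a + - a)        ≈⟨ *-cong σδ⁻¹≈-δ⁻¹ (σ[σx-x]≈-[σx-x] a) ⟩
      - δ⁻¹ * - (σ a + - a)        ≈⟨ -‿distribˡ-* _ _ ⟨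
      - (δ⁻¹ * - (σ a + - a))      ≈⟨ -‿cong (-‿distribʳ-* _ _) ⟨
      - - t                        ≈⟨ -‿involutive t ⟩
      t                            ∎
    tδ : t * δ ≈ σ a + - a
    tδ = begin
      (δ⁻¹ * (σ a + - a)) * δ      ≈⟨ *-congʳ (*-comm _ _) ⟩
      ((σ a + - a) * δ⁻¹) * δ      ≈⟨ *-assoc _ _ _ ⟩
      (σ a + - a) * (δ⁻¹ * δ)      ≈⟨ *-congˡ δ⁻¹δ≈1 ⟩
      (σ a + - a) * 1#             ≈⟨ *-identityʳ _ ⟩
      σ a + - a                    ∎
    σa≈ : σ a ≈ (a + - (t * ζ)) + t * σ ζ
    σa≈ = begin
      σ a                                 ≈⟨ x+[y-x]≈y a (σ a) ⟨
      a + (σ a + - a)                     ≈⟨ +-congˡ tδ ⟨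
      a + t * (σ ζ + - ζ)                 ≈⟨ +-congˡ (trans (x[y-z]≈xy-xz t _ _) (+-comm _ _)) ⟩
      a + (- (t * ζ) + t * σ ζ)           ≈⟨ +-assoc _ _ _ ⟨
      (a + - (t * ζ)) + t * σ ζ           ∎
    σs≈s : σ (a + - (t * ζ)) ≈ a + - (t * ζ)
    σs≈s = begin
      σ (a + - (t * ζ))                          ≈⟨ σ-+ _ _ ⟩
      σ a + σ (- (t * ζ))                        ≈⟨ +-cong σa≈ (trans (σ-neg _) (-‿cong (trans (σ-* _ _) (*-congʳ σt≈t)))) ⟩
      ((a + - (t * ζ)) + t * σ ζ) + - (t * σ ζ)  ≈⟨ +-assoc _ _ _ ⟩
      (a + - (t * ζ)) + (t * σ ζ + - (t * σ ζ))  ≈⟨ +-congˡ (-‿inverseʳ _) ⟩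
      (a + - (t * ζ)) + 0#                       ≈⟨ +-identityʳ _ ⟩
      a + - (t * ζ)                              ∎

  twist : Bool → Carrier → Carrier
  twist false a = a
  twist true  a = σ a

  twist-cong : ∀ s {a b} → a ≈ b → twist s a ≈ twist s b
  twist-cong false e = e
  twist-cong true  e = σ-cong e

  twist-+ : ∀ s a b → twist s (a + b) ≈ twist s a + twist s b
  twist-+ false a b = refl
  twist-+ true  a b = σ-+ a b

  twist-* : ∀ s a b → twist s (a * b) ≈ twist s a * twist s b
  twist-* false a b = refl
  twist-* true  a b = σ-* a b

  twist-1 : ∀ s → twist s 1# ≈ 1#
  twist-1 false = refl
  twist-1 true  = σ-1

  twist-0 : ∀ s → twist s 0# ≈ 0#
  twist-0 false = refl
  twist-0 true  = σ-0

  twist-fixed : ∀ s {a} → Fixed a → twist s a ≈ a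
  twist-fixed false e = refl
  twist-fixed true  e = e

  twist-not : ∀ s a → twist (not s) a ≈ twist s (σ a)
  twist-not false a = refl
  twist-not true  a = sym (σ-σ a)

  σ-twist : ∀ s a → σ (twist s a) ≈ twist s (σ a)
  σ-twist false a = refl
  σ-twist true  a = refl

module _ {ℓ} (𝒦 : UnramifiedInvolution ℓ) where
  private module 𝒦 = UnramifiedInvolution 𝒦
  open 𝒦

  -- An (O_B, O_B)-bimodule, seen through O_B = O_K ⊕ O_K Π on both sides:
  -- Πₗ and Πᵣ are the left and the right multiplication by Π.
  record Π-Bimodule : Set (Level.suc ℓ) where
    field
      bimodule : Bimodule ring ring ℓ ℓ
    open Bimodule bimodule public
    field
      Πₗ Πᵣ   : Carrierᴹ → Carrierᴹ
      Πₗ-cong : ∀ {x y} → x ≈ᴹ y → Πₗ x ≈ᴹ Πₗ y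
      Πᵣ-cong : ∀ {x y} → x ≈ᴹ y → Πᵣ x ≈ᴹ Πᵣ y
      Πₗ-+    : ∀ x y → Πₗ (x +ᴹ y) ≈ᴹ Πₗ x +ᴹ Πₗ y
      Πᵣ-+    : ∀ x y → Πᵣ (x +ᴹ y) ≈ᴹ Πᵣ x +ᴹ Πᵣ y
      Πₗ-*ₗ   : ∀ a x → Πₗ (a *ₗ x) ≈ᴹ σ a *ₗ Πₗ x
      Πᵣ-*ₗ   : ∀ a x → Πᵣ (a *ₗ x) ≈ᴹ a *ₗ Πᵣ x
      Πₗ-*ᵣ   : ∀ x a → Πₗ (x *ᵣ a) ≈ᴹ Πₗ x *ᵣ a
      Πᵣ-*ᵣ   : ∀ x a → Πᵣ (x *ᵣ a) ≈ᴹ Πᵣ x *ᵣ σ a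
      Πₗ-Πᵣ   : ∀ x → Πₗ (Πᵣ x) ≈ᴹ Πᵣ (Πₗ x)
      Πₗ²     : ∀ x → Πₗ (Πₗ x) ≈ᴹ π *ₗ x
      Πᵣ²     : ∀ x → Πᵣ (Πᵣ x) ≈ᴹ x *ᵣ π
      fixed-central : ∀ {a} → Fixed a → ∀ x → a *ₗ x ≈ᴹ x *ᵣ a

    Πᵣ²ₗ : ∀ x → Πᵣ (Πᵣ x) ≈ᴹ π *ₗ x
    Πᵣ²ₗ x = ≈ᴹ-trans (Πᵣ² x) (≈ᴹ-sym (fixed-central σπ≈π x))

  record Π-Hom (A B : Π-Bimodule) : Set ℓ where
    private
      module A = Π-Bimodule A
      module B = Π-Bimodule B
    field
      fun     : A.Carrierᴹ → B.Carrierᴹ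
      cong    : ∀ {x y} → x A.≈ᴹ y → fun x B.≈ᴹ fun y
      +-homo  : ∀ x y → fun (x A.+ᴹ y) B.≈ᴹ fun x B.+ᴹ fun y
      *ₗ-homo : ∀ a x → fun (a A.*ₗ x) B.≈ᴹ a B.*ₗ fun x
      *ᵣ-homo : ∀ x a → fun (x A.*ᵣ a) B.≈ᴹ fun x B.*ᵣ a
      Πₗ-homo : ∀ x → fun (A.Πₗ x) B.≈ᴹ B.Πₗ (fun x)
      Πᵣ-homo : ∀ x → fun (A.Πᵣ x) B.≈ᴹ B.Πᵣ (fun x)

    0-homo : fun A.0ᴹ B.≈ᴹ B.0ᴹ
    0-homo = B.≈ᴹ-trans (cong (A.≈ᴹ-sym (A.*ₗ-zeroˡ A.0ᴹ)))
               (B.≈ᴹ-trans (*ₗ-homo _ _) (B.*ₗ-zeroˡ _))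

  module Grading (A : Π-Bimodule) where
    open Π-Bimodule A
    open LinearAlgebra leftModule
    open SetoidReasoning ≈ᴹ-setoid

    -- The eigenspace of O_K ⊗ O_K ≅ O_K × O_K on which x a = σ^s(a) x.
    Homogeneous : Bool → Pred Carrierᴹ ℓ
    Homogeneous s x = ∀ a → x *ᵣ a ≈ᴹ twist s a *ₗ x

    homogeneous-isSubmodule : ∀ s → IsSubmodule (Homogeneous s)
    homogeneous-isSubmodule s = record
      { ≈-resp = λ e h a → ≈ᴹ-trans (*ᵣ-cong (≈ᴹ-sym e) refl) (≈ᴹ-trans (h a) (*ₗ-cong refl e))
      ; 0∈ = λ a → ≈ᴹ-trans (*ᵣ-zeroˡ a) (≈ᴹ-sym (*ₗ-zeroʳ _))
      ; +∈ = λ h k a → ≈ᴹ-trans (*ᵣ-distribʳ a _ _)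
               (≈ᴹ-trans (+ᴹ-cong (h a) (k a)) (≈ᴹ-sym (*ₗ-distribˡ _ _ _)))
      ; *∈ = λ b {x} h a → begin
          (b *ₗ x) *ᵣ a           ≈⟨ *ₗ-*ᵣ-assoc b x a ⟩
          b *ₗ (x *ᵣ a)           ≈⟨ *ₗ-cong refl (h a) ⟩
          b *ₗ twist s a *ₗ x     ≈⟨ *ₗ-assoc _ _ _ ⟨
          (b * twist s a) *ₗ x    ≈⟨ *ₗ-cong (*-comm _ _) ≈ᴹ-refl ⟩
          (twist s a * b) *ₗ x    ≈⟨ *ₗ-assoc _ _ _ ⟩
          twist s a *ₗ b *ₗ x     ∎
      }

    Πₗ-homogeneous : ∀ {s x} → Homogeneous s x → Homogeneous (not s) (Πₗ x)
    Πₗ-homogeneous {s} {x} h a = begin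
      Πₗ x *ᵣ a               ≈⟨ Πₗ-*ᵣ x a ⟨
      Πₗ (x *ᵣ a)             ≈⟨ Πₗ-cong (h a) ⟩
      Πₗ (twist s a *ₗ x)     ≈⟨ Πₗ-*ₗ _ _ ⟩
      σ (twist s a) *ₗ Πₗ x   ≈⟨ *ₗ-cong (trans (σ-twist s a) (sym (twist-not s a))) ≈ᴹ-refl ⟩
      twist (not s) a *ₗ Πₗ x ∎

    Πᵣ-homogeneous : ∀ {s x} → Homogeneous s x → Homogeneous (not s) (Πᵣ x)
    Πᵣ-homogeneous {s} {x} h a = begin
      Πᵣ x *ᵣ a               ≈⟨ *ᵣ-cong ≈ᴹ-refl (σ-σ a) ⟨
      Πᵣ x *ᵣ σ (σ a)         ≈⟨ Πᵣ-*ᵣ x (σ a) ⟨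
      Πᵣ (x *ᵣ σ a)           ≈⟨ Πᵣ-cong (h (σ a)) ⟩
      Πᵣ (twist s (σ a) *ₗ x) ≈⟨ Πᵣ-*ₗ _ _ ⟩
      twist s (σ a) *ₗ Πᵣ x   ≈⟨ *ₗ-cong (twist-not s a) ≈ᴹ-refl ⟨
      twist (not s) a *ₗ Πᵣ x ∎

    -- Every scalar is b + cζ with b and c fixed by σ, and fixed scalars act alike on both sides, so
    -- ζ alone decides the degree.
    homogeneous-from-ζ : ∀ s {x} → x *ᵣ ζ ≈ᴹ twist s ζ *ₗ x → Homogeneous s x
    homogeneous-from-ζ s {x} h a with fixed-coordinates a
    ... | b , c , b-fixed , c-fixed , a≈ = begin
      x *ᵣ a                                   ≈⟨ *ᵣ-cong ≈ᴹ-refl a≈ ⟩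
      x *ᵣ (b + c * ζ)                         ≈⟨ *ᵣ-distribˡ _ _ _ ⟩
      x *ᵣ b +ᴹ x *ᵣ (c * ζ)                   ≈⟨ +ᴹ-cong (fixed-central b-fixed x) (*ᵣ-assoc x c ζ) ⟨
      b *ₗ x +ᴹ (x *ᵣ c) *ᵣ ζ                  ≈⟨ +ᴹ-congˡ (*ᵣ-cong (fixed-central c-fixed x) refl) ⟨
      b *ₗ x +ᴹ (c *ₗ x) *ᵣ ζ                  ≈⟨ +ᴹ-congˡ (*ₗ-*ᵣ-assoc c x ζ) ⟩
      b *ₗ x +ᴹ c *ₗ (x *ᵣ ζ)                  ≈⟨ +ᴹ-congˡ (*ₗ-cong refl h) ⟩
      b *ₗ x +ᴹ c *ₗ twist s ζ *ₗ x            ≈⟨ +ᴹ-congˡ (*ₗ-assoc _ _ _) ⟨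
      b *ₗ x +ᴹ (c * twist s ζ) *ₗ x           ≈⟨ *ₗ-distribʳ _ _ _ ⟨
      (b + c * twist s ζ) *ₗ x                 ≈⟨ *ₗ-cong twist-a ≈ᴹ-refl ⟨
      twist s a *ₗ x                           ∎
      where
      twist-a : twist s a ≈ b + c * twist s ζ
      twist-a = trans (twist-cong s a≈) (trans (twist-+ s _ _)
        (+-cong (twist-fixed s b-fixed) (trans (twist-* s _ _) (*-congʳ (twist-fixed s c-fixed)))))

    private
      δδ⁻¹ : ∀ y → δ *ₗ δ⁻¹ *ₗ y ≈ᴹ y
      δδ⁻¹ y = ≈ᴹ-trans (≈ᴹ-sym (*ₗ-assoc _ _ _))
        (≈ᴹ-trans (*ₗ-cong (trans (*-comm _ _) δ⁻¹δ≈1) ≈ᴹ-refl) (*ₗ-identityˡ y))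

      x+[y-x] : ∀ x y → x +ᴹ (y +ᴹ -ᴹ x) ≈ᴹ y
      x+[y-x] = x∙[y-x]≈y +ᴹ-abelianGroup

      σζ*ₗ : ∀ x → σ ζ *ₗ x ≈ᴹ ζ *ₗ x +ᴹ δ *ₗ x
      σζ*ₗ x = ≈ᴹ-trans (*ₗ-cong (sym (x+[y-x]≈y ζ (σ ζ))) ≈ᴹ-refl) (*ₗ-distribʳ _ _ _)

      -- ζ is a root of X² - (ζ + σζ) X + ζ σζ, whose coefficients are fixed.
      commutator-twisted : ∀ {x y} → x *ᵣ ζ ≈ᴹ ζ *ₗ x +ᴹ y → y *ᵣ ζ ≈ᴹ σ ζ *ₗ y
      commutator-twisted {x} {y} e = cancel (begin
        (ζ * ζ) *ₗ x +ᴹ (ζ *ₗ y +ᴹ y *ᵣ ζ)      ≈⟨ +ᴹ-assoc _ _ _ ⟨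
        ((ζ * ζ) *ₗ x +ᴹ ζ *ₗ y) +ᴹ y *ᵣ ζ      ≈⟨ +ᴹ-congʳ (+ᴹ-congʳ (*ₗ-assoc ζ ζ x)) ⟩
        (ζ *ₗ ζ *ₗ x +ᴹ ζ *ₗ y) +ᴹ y *ᵣ ζ       ≈⟨ +ᴹ-congʳ (≈ᴹ-trans (*ₗ-cong refl e) (*ₗ-distribˡ _ _ _)) ⟨
        ζ *ₗ (x *ᵣ ζ) +ᴹ y *ᵣ ζ                 ≈⟨ +ᴹ-congʳ (*ₗ-*ᵣ-assoc ζ x ζ) ⟨
        (ζ *ₗ x) *ᵣ ζ +ᴹ y *ᵣ ζ                 ≈⟨ *ᵣ-distribʳ ζ _ _ ⟨
        (ζ *ₗ x +ᴹ y) *ᵣ ζ                      ≈⟨ *ᵣ-cong (≈ᴹ-sym e) refl ⟩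
        (x *ᵣ ζ) *ᵣ ζ                           ≈⟨ *ᵣ-assoc x ζ ζ ⟩
        x *ᵣ (ζ * ζ)                            ≈⟨ *ᵣ-cong ≈ᴹ-refl ζ²≈ ⟩
        x *ᵣ (t * ζ + - n)                      ≈⟨ *ᵣ-distribˡ x _ _ ⟩
        x *ᵣ (t * ζ) +ᴹ x *ᵣ (- n)              ≈⟨ +ᴹ-cong (≈ᴹ-sym (*ᵣ-assoc x t ζ)) (≈ᴹ-sym (fixed-central -n-fixed x)) ⟩
        (x *ᵣ t) *ᵣ ζ +ᴹ (- n) *ₗ x             ≈⟨ +ᴹ-congʳ (*ᵣ-cong (≈ᴹ-sym (fixed-central t-fixed x)) refl) ⟩
        (t *ₗ x) *ᵣ ζ +ᴹ (- n) *ₗ x             ≈⟨ +ᴹ-congʳ (*ₗ-*ᵣ-assoc t x ζ) ⟩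
        t *ₗ (x *ᵣ ζ) +ᴹ (- n) *ₗ x             ≈⟨ +ᴹ-congʳ (≈ᴹ-trans (*ₗ-cong refl e) (*ₗ-distribˡ _ _ _)) ⟩
        (t *ₗ ζ *ₗ x +ᴹ t *ₗ y) +ᴹ (- n) *ₗ x   ≈⟨ ≈ᴹ-trans (+ᴹ-congʳ (+ᴹ-congʳ (≈ᴹ-sym (*ₗ-assoc t ζ x)))) (xy∙z≈xz∙y _ _ _) ⟩
        ((t * ζ) *ₗ x +ᴹ (- n) *ₗ x) +ᴹ t *ₗ y  ≈⟨ +ᴹ-congʳ (≈ᴹ-trans (≈ᴹ-sym (*ₗ-distribʳ _ _ _)) (*ₗ-cong (sym ζ²≈) ≈ᴹ-refl)) ⟩
        (ζ * ζ) *ₗ x +ᴹ t *ₗ y                  ≈⟨ +ᴹ-congˡ (*ₗ-distribʳ y ζ (σ ζ)) ⟩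
        (ζ * ζ) *ₗ x +ᴹ (ζ *ₗ y +ᴹ σ ζ *ₗ y)    ∎)
        where
        open CommutativeSemigroupProperties
          (CommutativeMonoid.commutativeSemigroup +ᴹ-commutativeMonoid) using (xy∙z≈xz∙y)
        open AbelianGroupProperties +ᴹ-abelianGroup using (∙-cancelˡ)
        t n : Carrier
        t = ζ + σ ζ
        n = σ ζ * ζ
        t-fixed : Fixed t
        t-fixed = trans (σ-+ _ _) (trans (+-congˡ (σ-σ ζ)) (+-comm _ _))
        -n-fixed : Fixed (- n)
        -n-fixed = trans (σ-neg n) (-‿cong (trans (σ-* _ _) (trans (*-congʳ (σ-σ ζ)) (*-comm _ _))))
        ζ²≈ : ζ * ζ ≈ t * ζ + - n
        ζ²≈ = sym (trans (+-congʳ (distribʳ ζ ζ (σ ζ))) (trans (+-assoc _ _ _)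
          (trans (+-congˡ (-‿inverseʳ n)) (+-identityʳ _))))
        cancel : ∀ {p q r s} → p +ᴹ (q +ᴹ r) ≈ᴹ p +ᴹ (q +ᴹ s) → r ≈ᴹ s
        cancel f = ∙-cancelˡ _ _ _ (∙-cancelˡ _ _ _ f)

    -- The commutator xζ - ζx annihilates a part of degree 0 and multiplies a part of degree 1 by δ.
    -- So δ⁻¹ times the commutator is the only candidate for the second component; that it has
    -- degree 1 is `commutator-twisted`.
    homogeneous-decomposition :
      ∀ x → ∃ λ (c : Bool → Carrierᴹ) → (∀ s → Homogeneous s (c s)) × x ≈ᴹ c false +ᴹ c true
    homogeneous-decomposition x = c , c-hom , ≈ᴹ-sym (≈ᴹ-trans (+ᴹ-comm _ _) (x+[y-x] x₁ x))
      where
      y x₁ x₀ : Carrierᴹ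
      y  = x *ᵣ ζ +ᴹ -ᴹ (ζ *ₗ x)
      x₁ = δ⁻¹ *ₗ y
      x₀ = x +ᴹ -ᴹ x₁
      x₁-hom : Homogeneous true x₁
      x₁-hom = homogeneous-from-ζ true (begin
        (δ⁻¹ *ₗ y) *ᵣ ζ      ≈⟨ *ₗ-*ᵣ-assoc _ _ _ ⟩
        δ⁻¹ *ₗ (y *ᵣ ζ)      ≈⟨ *ₗ-cong refl (commutator-twisted (≈ᴹ-sym (x+[y-x] _ _))) ⟩
        δ⁻¹ *ₗ σ ζ *ₗ y      ≈⟨ *ₗ-assoc _ _ _ ⟨
        (δ⁻¹ * σ ζ) *ₗ y     ≈⟨ *ₗ-cong (*-comm _ _) ≈ᴹ-refl ⟩
        (σ ζ * δ⁻¹) *ₗ y     ≈⟨ *ₗ-assoc _ _ _ ⟩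
        σ ζ *ₗ δ⁻¹ *ₗ y      ∎)
      x₀+x₁ : x₀ +ᴹ x₁ ≈ᴹ x
      x₀+x₁ = ≈ᴹ-trans (+ᴹ-comm _ _) (x+[y-x] x₁ x)
      x₀-hom : Homogeneous false x₀
      x₀-hom = homogeneous-from-ζ false (∙-cancelʳ (σ ζ *ₗ x₁) _ _ (begin
        x₀ *ᵣ ζ +ᴹ σ ζ *ₗ x₁           ≈⟨ +ᴹ-congˡ (x₁-hom ζ) ⟨
        x₀ *ᵣ ζ +ᴹ x₁ *ᵣ ζ             ≈⟨ *ᵣ-distribʳ ζ _ _ ⟨
        (x₀ +ᴹ x₁) *ᵣ ζ                ≈⟨ *ᵣ-cong x₀+x₁ refl ⟩
        x *ᵣ ζ                         ≈⟨ x+[y-x] (ζ *ₗ x) (x *ᵣ ζ) ⟨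
        ζ *ₗ x +ᴹ y                    ≈⟨ +ᴹ-cong (*ₗ-cong refl x₀+x₁) (δδ⁻¹ y) ⟨
        ζ *ₗ (x₀ +ᴹ x₁) +ᴹ δ *ₗ x₁     ≈⟨ +ᴹ-congʳ (*ₗ-distribˡ _ _ _) ⟩
        (ζ *ₗ x₀ +ᴹ ζ *ₗ x₁) +ᴹ δ *ₗ x₁ ≈⟨ +ᴹ-assoc _ _ _ ⟩
        ζ *ₗ x₀ +ᴹ (ζ *ₗ x₁ +ᴹ δ *ₗ x₁) ≈⟨ +ᴹ-congˡ (σζ*ₗ x₁) ⟨
        ζ *ₗ x₀ +ᴹ σ ζ *ₗ x₁           ∎))
        where open AbelianGroupProperties +ᴹ-abelianGroup using (∙-cancelʳ)
      c : Bool → Carrierᴹ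
      c false = x₀
      c true  = x₁
      c-hom : ∀ s → Homogeneous s (c s)
      c-hom false = x₀-hom
      c-hom true  = x₁-hom

    -- Stated for a sum on either side, so that no difference has to be formed.
    homogeneous-unique :
      ∀ {x y : Bool → Carrierᴹ} → (∀ s → Homogeneous s (x s)) → (∀ s → Homogeneous s (y s)) →
      x false +ᴹ x true ≈ᴹ y false +ᴹ y true → ∀ s → x s ≈ᴹ y s
    homogeneous-unique {x} {y} hx hy e = λ { false → e₀ ; true → e₁ }
      where
      open AbelianGroupProperties +ᴹ-abelianGroup using (∙-cancelˡ; ∙-cancelʳ)
      -- Right multiplication by ζ recovers δ times the term of degree 1 from the sum alone, and δ
      -- is a unit.
      split : ∀ {z : Bool → Carrierᴹ} → (∀ s → Homogeneous s (z s)) →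
              (z false +ᴹ z true) *ᵣ ζ ≈ᴹ ζ *ₗ (z false +ᴹ z true) +ᴹ δ *ₗ z true
      split {z} h = begin
        (z false +ᴹ z true) *ᵣ ζ                               ≈⟨ *ᵣ-distribʳ ζ _ _ ⟩
        z false *ᵣ ζ +ᴹ z true *ᵣ ζ                            ≈⟨ +ᴹ-cong (h false ζ) (≈ᴹ-trans (h true ζ) (σζ*ₗ _)) ⟩
        ζ *ₗ z false +ᴹ (ζ *ₗ z true +ᴹ δ *ₗ z true)           ≈⟨ +ᴹ-assoc _ _ _ ⟨
        (ζ *ₗ z false +ᴹ ζ *ₗ z true) +ᴹ δ *ₗ z true           ≈⟨ +ᴹ-congʳ (*ₗ-distribˡ _ _ _) ⟨
        ζ *ₗ (z false +ᴹ z true) +ᴹ δ *ₗ z true                ∎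
      δ-cancel : ∀ {z w} → δ *ₗ z ≈ᴹ δ *ₗ w → z ≈ᴹ w
      δ-cancel {z} {w} f = begin
        z                ≈⟨ inv z ⟨
        δ⁻¹ *ₗ δ *ₗ z    ≈⟨ *ₗ-cong refl f ⟩
        δ⁻¹ *ₗ δ *ₗ w    ≈⟨ inv w ⟩
        w                ∎
        where
        inv : ∀ v → δ⁻¹ *ₗ δ *ₗ v ≈ᴹ v
        inv v = ≈ᴹ-trans (≈ᴹ-sym (*ₗ-assoc _ _ _))
                  (≈ᴹ-trans (*ₗ-cong δ⁻¹δ≈1 ≈ᴹ-refl) (*ₗ-identityˡ v))
      e₁ : x true ≈ᴹ y true
      e₁ = δ-cancel (∙-cancelˡ _ _ _ (≈ᴹ-trans (≈ᴹ-sym (split hx))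
             (≈ᴹ-trans (*ᵣ-cong e refl) (≈ᴹ-trans (split hy)
               (+ᴹ-congʳ (*ₗ-cong refl (≈ᴹ-sym e)))))))
      e₀ : x false ≈ᴹ y false
      e₀ = ∙-cancelʳ _ _ _ (≈ᴹ-trans e (+ᴹ-congˡ (≈ᴹ-sym e₁)))

at : ℕ × ℕ → Bool → ℕ
at (m , n) false = m
at (m , n) true  = n

at-injective : ∀ {m n} → (∀ s → at m s ≡ at n s) → m ≡ n
at-injective e = ≡.cong₂ _,_ (e false) (e true)

-- The differential on A / AΠ and adapted bases

module _ {ℓ} (𝒦 : UnramifiedInvolution ℓ) where
  open UnramifiedInvolution 𝒦

  module Filtration (A : Π-Bimodule 𝒦) where
    open Π-Bimodule A
    open LinearAlgebra leftModule
    open Grading 𝒦 A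
    open CommutativeSemigroupProperties
      (CommutativeMonoid.commutativeSemigroup +ᴹ-commutativeMonoid) using (interchange)
    open SetoidReasoning ≈ᴹ-setoid

    Πₗ-0 : Πₗ 0ᴹ ≈ᴹ 0ᴹ
    Πₗ-0 = ≈ᴹ-trans (Πₗ-cong (≈ᴹ-sym (*ₗ-zeroˡ 0ᴹ)))
             (≈ᴹ-trans (Πₗ-*ₗ _ _) (≈ᴹ-trans (*ₗ-cong σ-0 ≈ᴹ-refl) (*ₗ-zeroˡ _)))

    Πᵣ-0 : Πᵣ 0ᴹ ≈ᴹ 0ᴹ
    Πᵣ-0 = ≈ᴹ-trans (Πᵣ-cong (≈ᴹ-sym (*ₗ-zeroˡ 0ᴹ))) (≈ᴹ-trans (Πᵣ-*ₗ _ _) (*ₗ-zeroˡ _))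

    AΠ : Pred Carrierᴹ ℓ
    AΠ x = ∃[ y ] x ≈ᴹ Πᵣ y

    -- The kernel and the image of Πₗ on A / AΠ.
    Kernel Image : Pred Carrierᴹ ℓ
    Kernel x = AΠ (Πₗ x)
    Image  x = ∃[ y ] ∃[ z ] x ≈ᴹ Πₗ y +ᴹ Πᵣ z

    AΠ-isSubmodule : IsSubmodule AΠ
    AΠ-isSubmodule = record
      { ≈-resp = λ e (y , f) → y , ≈ᴹ-trans (≈ᴹ-sym e) f
      ; 0∈ = 0ᴹ , ≈ᴹ-sym Πᵣ-0
      ; +∈ = λ (y , e) (z , f) → y +ᴹ z , ≈ᴹ-trans (+ᴹ-cong e f) (≈ᴹ-sym (Πᵣ-+ y z))
      ; *∈ = λ a (y , e) → a *ₗ y , ≈ᴹ-trans (*ₗ-cong refl e) (≈ᴹ-sym (Πᵣ-*ₗ a y))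
      }
    private module AΠ = IsSubmodule AΠ-isSubmodule

    Πₗ-AΠ : ∀ {x} → AΠ x → AΠ (Πₗ x)
    Πₗ-AΠ (y , e) = Πₗ y , ≈ᴹ-trans (Πₗ-cong e) (Πₗ-Πᵣ y)

    Kernel-isSubmodule : IsSubmodule Kernel
    Kernel-isSubmodule = record
      { ≈-resp = λ e → AΠ.≈-resp (Πₗ-cong e)
      ; 0∈ = AΠ.≈-resp (≈ᴹ-sym Πₗ-0) AΠ.0∈
      ; +∈ = λ h k → AΠ.≈-resp (≈ᴹ-sym (Πₗ-+ _ _)) (AΠ.+∈ h k)
      ; *∈ = λ a h → AΠ.≈-resp (≈ᴹ-sym (Πₗ-*ₗ _ _)) (AΠ.*∈ (σ a) h)
      }

    Image-isSubmodule : IsSubmodule Image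
    Image-isSubmodule = record
      { ≈-resp = λ e (y , z , f) → y , z , ≈ᴹ-trans (≈ᴹ-sym e) f
      ; 0∈ = 0ᴹ , 0ᴹ , ≈ᴹ-sym (≈ᴹ-trans (+ᴹ-cong Πₗ-0 Πᵣ-0) (+ᴹ-identityˡ 0ᴹ))
      ; +∈ = λ (y , z , e) (y′ , z′ , e′) → y +ᴹ y′ , z +ᴹ z′ ,
          ≈ᴹ-trans (+ᴹ-cong e e′) (≈ᴹ-trans (interchange _ _ _ _)
            (≈ᴹ-sym (+ᴹ-cong (Πₗ-+ y y′) (Πᵣ-+ z z′))))
      ; *∈ = λ a (y , z , e) → σ a *ₗ y , a *ₗ z ,
          ≈ᴹ-trans (*ₗ-cong refl e) (≈ᴹ-trans (*ₗ-distribˡ a _ _)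
            (≈ᴹ-sym (+ᴹ-cong (≈ᴹ-trans (Πₗ-*ₗ _ _) (*ₗ-cong (σ-σ a) ≈ᴹ-refl)) (Πᵣ-*ₗ a z))))
      }

    π∈AΠ : ∀ x → AΠ (π *ₗ x)
    π∈AΠ x = Πᵣ x , ≈ᴹ-sym (Πᵣ²ₗ x)

    AΠ⊆Kernel : AΠ ⊆ Kernel
    AΠ⊆Kernel = Πₗ-AΠ

    AΠ⊆Image : AΠ ⊆ Image
    AΠ⊆Image (z , e) = 0ᴹ , z , ≈ᴹ-trans e (≈ᴹ-sym (≈ᴹ-trans (+ᴹ-congʳ Πₗ-0) (+ᴹ-identityˡ _)))

    Πₗ∈Image : ∀ y → Image (Πₗ y)
    Πₗ∈Image y = y , 0ᴹ , ≈ᴹ-sym (≈ᴹ-trans (+ᴹ-congˡ Πᵣ-0) (+ᴹ-identityʳ _))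

    -- The square of the differential vanishes because Πₗ² = π = Πᵣ².
    Image⊆Kernel : Image ⊆ Kernel
    Image⊆Kernel (y , z , e) = Kernel.≈-resp (≈ᴹ-sym e) (Kernel.+∈
      (AΠ.≈-resp (≈ᴹ-sym (Πₗ² y)) (π∈AΠ y)) (AΠ⊆Kernel (z , ≈ᴹ-refl)))
      where module Kernel = IsSubmodule Kernel-isSubmodule

    -- Since Πᵣ has degree 1, the degree s component of Πᵣ z is Πᵣ of the other component of z.
    AΠ-graded : ∀ {c : Bool → Carrierᴹ} → (∀ s → Homogeneous s (c s)) →
                AΠ (c false +ᴹ c true) → ∀ s → AΠ (c s)
    AΠ-graded {c} hc (z , e) s with homogeneous-decomposition z
    ... | d , hd , z≈ = d (not s) , homogeneous-unique {x = c}
            {y = λ s → Πᵣ (d (not s))} hc (λ { false → Πᵣ-homogeneous (hd true) ; true → Πᵣ-homogeneous (hd false) })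
            (≈ᴹ-trans e (≈ᴹ-trans (Πᵣ-cong z≈) (≈ᴹ-trans (Πᵣ-+ _ _) (+ᴹ-comm _ _)))) s

    -- The degree s part of a minimal system of homogeneous generators of A
    -- over O_B ⊗ O_B: the e's are a basis of A / AΠ modulo the kernel of Πₗ, and
    -- the f's one of the homology of Πₗ on A / AΠ.
    record DegreeBasis (s : Bool) (m n : ℕ) : Set ℓ where
      field
        e             : Vector Carrierᴹ m
        f             : Vector Carrierᴹ n
        e-homogeneous : ∀ i → Homogeneous s (e i)
        f-homogeneous : ∀ j → Homogeneous s (f j)
        -- An equation in A itself. Modulo AΠ it would say no more than that `f j` is in the kernel.
        Πₗf≈Πᵣf       : ∀ j → Πₗ (f j) ≈ᴹ Πᵣ (f j)
        e-independent : Independent e Kernel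
        f-independent : Independent f Image
        e-spans       : ∀ {x} → Homogeneous s x → Adjoin e Kernel x
        f-spans       : ∀ {x} → Homogeneous s x → Kernel x → Adjoin f Image x

    AdaptedBasis : ℕ × ℕ → ℕ × ℕ → Set ℓ
    AdaptedBasis m n = ∀ s → DegreeBasis s (at m s) (at n s)

    FinitelyGeneratedₗ : Set ℓ
    FinitelyGeneratedₗ = ∃[ n ] ∃ λ (g : Vector Carrierᴹ n) → ∀ x → ∃[ a ] x ≈ᴹ comb a g

    Balanced : Bool → Pred Carrierᴹ ℓ
    Balanced s t = Homogeneous s t × Πₗ t ≈ᴹ Πᵣ t

    -- Balanced elements are stable only under scalars fixed by σ, so a kernel element is a
    -- combination of several of them. Two are enough because O_K has rank 2 over its fixed ring.
    BalancedSpan : Bool → Pred Carrierᴹ ℓ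
    BalancedSpan s x = ∃[ t ] ∃[ t′ ] Balanced s t × Balanced s t′ ×
                       ∃[ c ] ∃[ c′ ] x ≈ᴹ c *ₗ t +ᴹ c′ *ₗ t′

    homogeneous-component : ∀ s {x} → Homogeneous s x → ∀ {c : Bool → Carrierᴹ} →
                            (∀ t → Homogeneous t (c t)) → x ≈ᴹ c false +ᴹ c true → x ≈ᴹ c s
    homogeneous-component s {x} hx {c} hc x≈ = at-s s hx
      where
      0-hom : ∀ t → Homogeneous t 0ᴹ
      0-hom t = IsSubmodule.0∈ (homogeneous-isSubmodule t)
      at-s : ∀ s → Homogeneous s x → x ≈ᴹ c s
      at-s false hx = homogeneous-unique {x = λ { false → x ; true → 0ᴹ }} {y = c}
        (λ { false → hx ; true → 0-hom true }) hc (≈ᴹ-trans (+ᴹ-identityʳ x) x≈) false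
      at-s true hx = homogeneous-unique {x = λ { false → 0ᴹ ; true → x }} {y = c}
        (λ { false → 0-hom false ; true → hx }) hc (≈ᴹ-trans (+ᴹ-identityˡ x) x≈) true

    homogeneous-generators :
      FinitelyGeneratedₗ → ∀ s → ∃[ n ] ∃ λ (g : Vector Carrierᴹ n) →
      (∀ i → Homogeneous s (g i)) × (∀ {x} → Homogeneous s x → ∃[ a ] x ≈ᴹ comb a g)
    homogeneous-generators (n , g , generates) s =
      n , c s , c-hom s , λ {x} hx → let a , x≈ = generates x in
        a , homogeneous-component s hx
          {c = λ t → comb a (c t)} (λ t → IsSubmodule.comb∈ (homogeneous-isSubmodule t) a (c-hom t))
          (≈ᴹ-trans x≈ (≈ᴹ-trans (comb-cong (λ _ → refl) c-sum) (comb-+ᴹ a (c false) (c true))))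
      where
      c : Bool → Vector Carrierᴹ n
      c s i = proj₁ (homogeneous-decomposition (g i)) s
      c-hom : ∀ s i → Homogeneous s (c s i)
      c-hom s i = proj₁ (proj₂ (homogeneous-decomposition (g i))) s
      c-sum : ∀ i → g i ≈ᴹ c false i +ᴹ c true i
      c-sum i = proj₂ (proj₂ (homogeneous-decomposition (g i)))

    private
      π∈Kernel : ∀ x → Kernel (π *ₗ x)
      π∈Kernel x = AΠ⊆Kernel (π∈AΠ x)

      π∈Image : ∀ x → Image (π *ₗ x)
      π∈Image x = AΠ⊆Image (π∈AΠ x)

    module _
      (em : ExcludedMiddle ℓ) (s : Bool)
      (balanced : ∀ {x} → Homogeneous s x → Kernel x → BalancedSpan s x)
      {N} {g : Vector Carrierᴹ N} (g-hom : ∀ i → Homogeneous s (g i))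
      (generates : ∀ {x} → Homogeneous s x → ∃[ a ] x ≈ᴹ comb a g)
      where

      private
        module Hom = IsSubmodule (homogeneous-isSubmodule s)
        module Kernel = IsSubmodule Kernel-isSubmodule

        module _ (E : Extraction Kernel-isSubmodule π∈Kernel g) where
          module E = Extraction E

          E-hom : ∀ k → Homogeneous s (E.basis k)
          E-hom k = ≡.subst (Homogeneous s) (≡.sym (proj₂ (E.basis⊆ k))) (g-hom _)

          -- Subtracting a combination of the e's moves `g i` into the kernel, where balanced
          -- elements are available. The e's have the same degree as `g i`, so the remainder is
          -- again homogeneous.
          remainder : ∀ i → ∃[ k ] Homogeneous s k × Kernel k ×
                            ∃[ a ] g i ≈ᴹ comb a E.basis +ᴹ k
          remainder i = let a , k , k∈ , eq = E.spans i in
            k , Hom.+-cancel∈ (Hom.comb∈ a E-hom) (Hom.≈-resp eq (g-hom i)) , k∈ , a , eq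

          module _ (t t′ : Vector Carrierᴹ N)
                   (t-balanced : ∀ i → Balanced s (t i)) (t′-balanced : ∀ i → Balanced s (t′ i))
                   (remainder≈ : ∀ i → ∃[ c ] ∃[ c′ ] proj₁ (remainder i) ≈ᴹ c *ₗ t i +ᴹ c′ *ₗ t′ i)
                   (F : Extraction Image-isSubmodule π∈Image (t ++ t′))
            where
            module F = Extraction F

            ++-balanced : ∀ i → Balanced s ((t ++ t′) i)
            ++-balanced i with splitAt N i
            ... | inj₁ j = t-balanced j
            ... | inj₂ j = t′-balanced j

            F-balanced : ∀ k → Balanced s (F.basis k)
            F-balanced k = ≡.subst (Balanced s) (≡.sym (proj₂ (F.basis⊆ k))) (++-balanced _)

            X-isSub : IsSubmodule (Adjoin F.basis Image)
            X-isSub = Adjoin-isSubmodule Image-isSubmodule F.basis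
            module X = IsSubmodule X-isSub

            remainder∈ : ∀ i → Adjoin F.basis Image (proj₁ (remainder i))
            remainder∈ i = let c , c′ , k≈ = remainder≈ i in
              X.≈-resp (≈ᴹ-sym k≈) (X.+∈ (X.*∈ c t∈) (X.*∈ c′ t′∈))
              where
              t∈ : Adjoin F.basis Image (t i)
              t∈ = ≡.subst (Adjoin F.basis Image) (lookup-++ˡ t t′ i) (F.spans (i ↑ˡ N))
              t′∈ : Adjoin F.basis Image (t′ i)
              t′∈ = ≡.subst (Adjoin F.basis Image) (lookup-++ʳ t t′ i) (F.spans (N ↑ʳ i))

            -- Everything but the e-part of x is in the kernel, so for x in the kernel independence
            -- puts the e-coefficients in `𝔪`. The e-part is then a multiple of π, hence in the
            -- image.
            F-spans-remainder : ∀ {x} → Kernel x → Adjoin E.basis (Adjoin F.basis Image) x →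
                                Adjoin F.basis Image x
            F-spans-remainder {x} kx (c , y , y∈ , x≈) = X.≈-resp (≈ᴹ-sym x≈) (X.+∈ low y∈)
              where
              y∈Kernel : Kernel y
              y∈Kernel = Adjoin-least Image-isSubmodule Kernel-isSubmodule Image⊆Kernel
                (λ k → _ , proj₂ (F-balanced k)) y∈
              low : Adjoin F.basis Image (comb c E.basis)
              low = base⊆Adjoin Image-isSubmodule F.basis
                (comb-𝔪∈ Image-isSubmodule π∈Image
                  (E.independent c (Kernel.+-cancel∈ y∈Kernel
                    (Kernel.≈-resp (≈ᴹ-trans x≈ (+ᴹ-comm _ _)) kx))) E.basis)

            degreeBasis′ : DegreeBasis s E.size F.size
            degreeBasis′ = record
              { e = E.basis
              ; f = F.basis
              ; e-homogeneous = E-hom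
              ; f-homogeneous = proj₁ ∘ F-balanced
              ; Πₗf≈Πᵣf = proj₂ ∘ F-balanced
              ; e-independent = E.independent
              ; f-independent = F.independent
              ; e-spans = λ hx → let b , x≈ = generates hx in
                  EX.≈-resp (≈ᴹ-sym x≈) (EX.comb∈ b E.spans)
              ; f-spans = λ hx kx → let b , x≈ = generates hx in
                  F-spans-remainder kx (FX.≈-resp (≈ᴹ-sym x≈) (FX.comb∈ b g∈))
              }
              where
              module EX = IsSubmodule (Adjoin-isSubmodule Kernel-isSubmodule E.basis)
              module FX = IsSubmodule (Adjoin-isSubmodule X-isSub E.basis)
              g∈ : ∀ i → Adjoin E.basis (Adjoin F.basis Image) (g i)
              g∈ i = let k , _ , _ , a , eq = remainder i in a , k , remainder∈ i , eq

      degreeBasis : ∃[ m ] ∃[ n ] DegreeBasis s m n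
      degreeBasis = _ , _ , degreeBasis′ E
        (λ i → proj₁ (bal i)) (λ i → proj₁ (proj₂ (bal i)))
        (λ i → proj₁ (proj₂ (proj₂ (bal i)))) (λ i → proj₁ (proj₂ (proj₂ (proj₂ (bal i)))))
        (λ i → proj₂ (proj₂ (proj₂ (proj₂ (bal i)))))
        (extract Image-isSubmodule π∈Image em _)
        where
        E : Extraction Kernel-isSubmodule π∈Kernel g
        E = extract Kernel-isSubmodule π∈Kernel em g
        bal : ∀ i → BalancedSpan s (proj₁ (remainder E i))
        bal i = balanced (proj₁ (proj₂ (remainder E i))) (proj₁ (proj₂ (proj₂ (remainder E i))))

    adaptedBasis : ExcludedMiddle ℓ → FinitelyGeneratedₗ →
                   (∀ s {x} → Homogeneous s x → Kernel x → BalancedSpan s x) →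
                   ∃[ m ] ∃[ n ] AdaptedBasis m n
    adaptedBasis em fg balanced = _ , _ , λ { false → basis false ; true → basis true }
      where
      sized : ∀ s → ∃[ m ] ∃[ n ] DegreeBasis s m n
      sized s = let _ , _ , g-hom , generates = homogeneous-generators fg s in
        degreeBasis em s (balanced s) g-hom generates
      basis : ∀ s → DegreeBasis s (proj₁ (sized s)) (proj₁ (proj₂ (sized s)))
      basis s = proj₂ (proj₂ (sized s))

    -- Steinitz exchange in both directions, modulo the kernel for the e's and modulo the image for
    -- the f's. The f's of one basis are in the span of those of the other because `Πₗf≈Πᵣf` places
    -- them in the kernel.
    adaptedBasis-unique : ∀ {m n m′ n′} → AdaptedBasis m n → AdaptedBasis m′ n′ →
                          m ≡ m′ × n ≡ n′
    adaptedBasis-unique b c =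
      at-injective (λ s → ℕ.≤-antisym (e-≤ b c s) (e-≤ c b s)) ,
      at-injective (λ s → ℕ.≤-antisym (f-≤ b c s) (f-≤ c b s))
      where
      e-≤ : ∀ {m n m′ n′} → AdaptedBasis m n → AdaptedBasis m′ n′ → ∀ s → at m s ℕ.≤ at m′ s
      e-≤ b c s = independent≤spanning Kernel-isSubmodule π∈Kernel
        B.e C.e B.e-independent (λ i → C.e-spans (B.e-homogeneous i))
        where
        module B = DegreeBasis (b s)
        module C = DegreeBasis (c s)
      f-≤ : ∀ {m n m′ n′} → AdaptedBasis m n → AdaptedBasis m′ n′ → ∀ s → at n s ℕ.≤ at n′ s
      f-≤ b c s = independent≤spanning Image-isSubmodule π∈Image
        B.f C.f B.f-independent
        (λ j → C.f-spans (B.f-homogeneous j) (_ , B.Πₗf≈Πᵣf j))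
        where
        module B = DegreeBasis (b s)
        module C = DegreeBasis (c s)

    -- When Πᵣ vanishes, a kernel element satisfies Πₗ x = 0 = Πᵣ x and is itself balanced; the
    -- second element is taken to be zero.
    balanced-killed : (∀ x → Πᵣ x ≈ᴹ 0ᴹ) →
                      ∀ s {x} → Homogeneous s x → Kernel x → BalancedSpan s x
    balanced-killed Πᵣ≈0 s {x} hx (y , p) = x , 0ᴹ ,
      (hx , ≈ᴹ-trans p (≈ᴹ-trans (Πᵣ≈0 y) (≈ᴹ-sym (Πᵣ≈0 x)))) ,
      (IsSubmodule.0∈ (homogeneous-isSubmodule s) , ≈ᴹ-trans Πₗ-0 (≈ᴹ-sym Πᵣ-0)) ,
      1# , 0# , ≈ᴹ-sym (≈ᴹ-trans (+ᴹ-cong (*ₗ-identityˡ x) (*ₗ-zeroˡ _)) (+ᴹ-identityʳ x))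

    -- x ↦ y with Πx = yΠ is a σ-semilinear involution, so by Galois descent
    -- its fixed points x + y and ζx + (σζ)y span x.
    balanced-torsionFree : (∀ {x} → Πᵣ x ≈ᴹ 0ᴹ → x ≈ᴹ 0ᴹ) →
                           ∀ s {x} → Homogeneous s x → Kernel x → BalancedSpan s x
    balanced-torsionFree Πᵣ-injective s {x} hx (y , Πx≈yΠ) = t , t′ ,
      (Hom.+∈ hx hy , t-balanced) , (Hom.+∈ (Hom.*∈ ζ hx) (Hom.*∈ (σ ζ) hy) , t′-balanced) ,
      -- Eliminating y from t = x + y and t′ = ζx + (σζ)y gives (σζ)t - t′ = δx.
      δ⁻¹ * σ ζ , - δ⁻¹ , ≈ᴹ-sym (begin
        (δ⁻¹ * σ ζ) *ₗ t +ᴹ (- δ⁻¹) *ₗ t′            ≈⟨ +ᴹ-cong (*ₗ-assoc _ _ _) (-‿*ₗ _ _) ⟩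
        δ⁻¹ *ₗ σ ζ *ₗ t +ᴹ -ᴹ (δ⁻¹ *ₗ t′)            ≈⟨ +ᴹ-congʳ (*ₗ-cong refl σζt) ⟩
        δ⁻¹ *ₗ (t′ +ᴹ δ *ₗ x) +ᴹ -ᴹ (δ⁻¹ *ₗ t′)      ≈⟨ +ᴹ-congʳ (*ₗ-distribˡ _ _ _) ⟩
        (δ⁻¹ *ₗ t′ +ᴹ δ⁻¹ *ₗ δ *ₗ x) +ᴹ -ᴹ (δ⁻¹ *ₗ t′) ≈⟨ xyx⁻¹≈y _ _ ⟩
        δ⁻¹ *ₗ δ *ₗ x                                ≈⟨ *ₗ-assoc _ _ _ ⟨
        (δ⁻¹ * δ) *ₗ x                               ≈⟨ *ₗ-cong δ⁻¹δ≈1 ≈ᴹ-refl ⟩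
        1# *ₗ x                                      ≈⟨ *ₗ-identityˡ x ⟩
        x                                            ∎)
      where
      module Hom = IsSubmodule (homogeneous-isSubmodule s)
      open AbelianGroupProperties +ᴹ-abelianGroup using (x∙y⁻¹≈ε⇒x≈y; xyx⁻¹≈y)

      cancel : ∀ {v w} → Πᵣ v ≈ᴹ Πᵣ w → v ≈ᴹ w
      cancel {v} {w} p = x∙y⁻¹≈ε⇒x≈y _ _ (≈ᴹ-trans (+ᴹ-congˡ (≈ᴹ-sym (-1*ₗ w))) (Πᵣ-injective (begin
        Πᵣ (v +ᴹ (- 1#) *ₗ w)      ≈⟨ ≈ᴹ-trans (Πᵣ-+ _ _) (+ᴹ-cong p (Πᵣ-*ₗ _ _)) ⟩
        Πᵣ w +ᴹ (- 1#) *ₗ Πᵣ w     ≈⟨ +ᴹ-congˡ (-1*ₗ _) ⟩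
        Πᵣ w +ᴹ -ᴹ (Πᵣ w)          ≈⟨ -ᴹ‿inverseʳ _ ⟩
        0ᴹ                         ∎)))

      hy : Homogeneous s y
      hy a = cancel (begin
        Πᵣ (y *ᵣ a)                  ≈⟨ Πᵣ-*ᵣ y a ⟩
        Πᵣ y *ᵣ σ a                  ≈⟨ *ᵣ-cong (≈ᴹ-sym Πx≈yΠ) refl ⟩
        Πₗ x *ᵣ σ a                  ≈⟨ Πₗ-*ᵣ x (σ a) ⟨
        Πₗ (x *ᵣ σ a)                ≈⟨ Πₗ-cong (hx (σ a)) ⟩
        Πₗ (twist s (σ a) *ₗ x)      ≈⟨ Πₗ-*ₗ _ x ⟩
        σ (twist s (σ a)) *ₗ Πₗ x    ≈⟨ *ₗ-cong (trans (σ-twist s (σ a)) (twist-cong s (σ-σ a))) Πx≈yΠ ⟩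
        twist s a *ₗ Πᵣ y            ≈⟨ Πᵣ-*ₗ _ y ⟨
        Πᵣ (twist s a *ₗ y)          ∎)

      -- That x ↦ y is an involution comes from Πₗ² = Πᵣ², after cancelling one Πᵣ.
      Πy≈xΠ : Πₗ y ≈ᴹ Πᵣ x
      Πy≈xΠ = cancel (begin
        Πᵣ (Πₗ y)    ≈⟨ Πₗ-Πᵣ y ⟨
        Πₗ (Πᵣ y)    ≈⟨ Πₗ-cong Πx≈yΠ ⟨
        Πₗ (Πₗ x)    ≈⟨ Πₗ² x ⟩
        π *ₗ x       ≈⟨ Πᵣ²ₗ x ⟨
        Πᵣ (Πᵣ x)    ∎)

      t t′ : Carrierᴹ
      t  = x +ᴹ y
      t′ = ζ *ₗ x +ᴹ σ ζ *ₗ y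

      t-balanced : Πₗ t ≈ᴹ Πᵣ t
      t-balanced = ≈ᴹ-trans (Πₗ-+ x y) (≈ᴹ-trans (+ᴹ-cong Πx≈yΠ Πy≈xΠ)
        (≈ᴹ-trans (+ᴹ-comm _ _) (≈ᴹ-sym (Πᵣ-+ x y))))

      t′-balanced : Πₗ t′ ≈ᴹ Πᵣ t′
      t′-balanced = begin
        Πₗ t′                                  ≈⟨ Πₗ-+ _ _ ⟩
        Πₗ (ζ *ₗ x) +ᴹ Πₗ (σ ζ *ₗ y)           ≈⟨ +ᴹ-cong (Πₗ-*ₗ ζ x) (Πₗ-*ₗ (σ ζ) y) ⟩
        σ ζ *ₗ Πₗ x +ᴹ σ (σ ζ) *ₗ Πₗ y         ≈⟨ +ᴹ-cong (*ₗ-cong refl Πx≈yΠ) (*ₗ-cong (σ-σ ζ) Πy≈xΠ) ⟩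
        σ ζ *ₗ Πᵣ y +ᴹ ζ *ₗ Πᵣ x               ≈⟨ +ᴹ-comm _ _ ⟩
        ζ *ₗ Πᵣ x +ᴹ σ ζ *ₗ Πᵣ y               ≈⟨ +ᴹ-cong (Πᵣ-*ₗ ζ x) (Πᵣ-*ₗ (σ ζ) y) ⟨
        Πᵣ (ζ *ₗ x) +ᴹ Πᵣ (σ ζ *ₗ y)           ≈⟨ Πᵣ-+ _ _ ⟨
        Πᵣ t′                                  ∎

      σζt : σ ζ *ₗ t ≈ᴹ t′ +ᴹ δ *ₗ x
      σζt = begin
        σ ζ *ₗ (x +ᴹ y)                        ≈⟨ *ₗ-distribˡ _ x y ⟩
        σ ζ *ₗ x +ᴹ σ ζ *ₗ y                   ≈⟨ +ᴹ-congʳ (*ₗ-cong (sym (x+[y-x]≈y ζ (σ ζ))) ≈ᴹ-refl) ⟩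
        (ζ + δ) *ₗ x +ᴹ σ ζ *ₗ y               ≈⟨ +ᴹ-congʳ (*ₗ-distribʳ x ζ δ) ⟩
        (ζ *ₗ x +ᴹ δ *ₗ x) +ᴹ σ ζ *ₗ y         ≈⟨ xy∙z≈xz∙y _ _ _ ⟩
        t′ +ᴹ δ *ₗ x                           ∎
        where open CommutativeSemigroupProperties
                (CommutativeMonoid.commutativeSemigroup +ᴹ-commutativeMonoid) using (xy∙z≈xz∙y)

-- Transport of adapted bases along reductions, and the standard bimodule

module _ {ℓ} (𝒦 : UnramifiedInvolution ℓ) where
  open UnramifiedInvolution 𝒦

  module _ {A B : Π-Bimodule 𝒦} (h : Π-Hom 𝒦 A B) where
    private
      module A = Π-Bimodule A
      module B = Π-Bimodule B
      module AL = LinearAlgebra A.leftModule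
      module BL = LinearAlgebra B.leftModule
      module AG = Grading 𝒦 A
      module BG = Grading 𝒦 B
      module AF = Filtration 𝒦 A
      module BF = Filtration 𝒦 B
    open Π-Hom h

    comb-homo : ∀ {n} (a : Vector Carrier n) x → fun (AL.comb a x) B.≈ᴹ BL.comb a (fun ∘ x)
    comb-homo {zero}  a x = 0-homo
    comb-homo {suc n} a x = B.≈ᴹ-trans (+-homo _ _)
      (B.+ᴹ-cong (*ₗ-homo _ _) (comb-homo (tail a) (tail x)))

    homogeneous-homo : ∀ s {x} → AG.Homogeneous s x → BG.Homogeneous s (fun x)
    homogeneous-homo s hx a = B.≈ᴹ-trans (B.≈ᴹ-sym (*ᵣ-homo _ a))
      (B.≈ᴹ-trans (cong (hx a)) (*ₗ-homo _ _))

    -- h induces an isomorphism A/AΠ ≅ B/BΠ.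
    module _ (surjective : ∀ y → ∃[ x ] fun x B.≈ᴹ y)
             (kernel : ∀ {x y} → fun x B.≈ᴹ fun y → ∃[ z ] x A.≈ᴹ y A.+ᴹ A.Πᵣ z) where

      private
        AΠ-reflect : ∀ {x} → BF.AΠ (fun x) → AF.AΠ x
        AΠ-reflect (y , e) with surjective y
        ... | y′ , e′ with kernel (B.≈ᴹ-trans e (B.≈ᴹ-trans (B.Πᵣ-cong (B.≈ᴹ-sym e′)) (B.≈ᴹ-sym (Πᵣ-homo y′))))
        ... | z , f = y′ A.+ᴹ z , A.≈ᴹ-trans f (A.≈ᴹ-sym (A.Πᵣ-+ y′ z))

        AΠ-preserve : ∀ {x} → AF.AΠ x → BF.AΠ (fun x)
        AΠ-preserve (y , e) = fun y , B.≈ᴹ-trans (cong e) (Πᵣ-homo y)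

        Kernel-reflect : ∀ {x} → BF.Kernel (fun x) → AF.Kernel x
        Kernel-reflect k = AΠ-reflect (BAΠ.≈-resp (B.≈ᴹ-sym (Πₗ-homo _)) k)
          where module BAΠ = BL.IsSubmodule BF.AΠ-isSubmodule

        Kernel-preserve : ∀ {x} → AF.Kernel x → BF.Kernel (fun x)
        Kernel-preserve k = BAΠ.≈-resp (Πₗ-homo _) (AΠ-preserve k)
          where module BAΠ = BL.IsSubmodule BF.AΠ-isSubmodule

        homo-image : ∀ y z → fun (A.Πₗ y A.+ᴹ A.Πᵣ z) B.≈ᴹ B.Πₗ (fun y) B.+ᴹ B.Πᵣ (fun z)
        homo-image y z = B.≈ᴹ-trans (+-homo _ _) (B.+ᴹ-cong (Πₗ-homo y) (Πᵣ-homo z))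

        Image-preserve : ∀ {x} → AF.Image x → BF.Image (fun x)
        Image-preserve (y , z , e) = fun y , fun z , B.≈ᴹ-trans (cong e) (homo-image y z)

        Image-reflect : ∀ {x} → BF.Image (fun x) → AF.Image x
        Image-reflect (y , z , e) with surjective y | surjective z
        ... | y′ , ey | z′ , ez
          with kernel (B.≈ᴹ-trans e (B.≈ᴹ-trans
                 (B.+ᴹ-cong (B.Πₗ-cong (B.≈ᴹ-sym ey)) (B.Πᵣ-cong (B.≈ᴹ-sym ez)))
                 (B.≈ᴹ-sym (homo-image y′ z′))))
        ... | w , f = y′ , z′ A.+ᴹ w , A.≈ᴹ-trans f (A.≈ᴹ-trans (A.+ᴹ-assoc _ _ _)
                        (A.+ᴹ-congˡ (A.≈ᴹ-sym (A.Πᵣ-+ z′ w))))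

        Adjoin-preserve : ∀ {W W′ n} {x : Vector A.Carrierᴹ n} → (∀ {z} → W z → W′ (fun z)) →
                          ∀ {z} → AL.Adjoin x W z → BL.Adjoin (fun ∘ x) W′ (fun z)
        Adjoin-preserve p (a , t , q , e) = a , fun t , p q ,
          B.≈ᴹ-trans (cong e) (B.≈ᴹ-trans (+-homo _ _) (B.+ᴹ-congʳ (comb-homo a _)))

        -- A preimage may have parts in both degrees, but its component of degree `s` already maps
        -- to `y`, which has no part in the other degree.
        homogeneous-lift : ∀ s {y} → BG.Homogeneous s y →
                           ∃[ x ] AG.Homogeneous s x × y B.≈ᴹ fun x
        homogeneous-lift s {y} hy with surjective y
        ... | x , e with AG.homogeneous-decomposition x
        ... | c , hc , x≈ = c s , hc s ,
          BF.homogeneous-component s hy (λ t → homogeneous-homo t (hc t))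
            (B.≈ᴹ-trans (B.≈ᴹ-sym e) (B.≈ᴹ-trans (cong x≈) (+-homo _ _)))

      -- Homogeneity and Πf = fΠ are equations and pass along `h`. Independence and spanning concern
      -- only the quotient by the multiples of Πᵣ, on which `h` is an isomorphism.
      degreeBasis-map : ∀ {s m n} → AF.DegreeBasis s m n → BF.DegreeBasis s m n
      degreeBasis-map {s} b = record
        { e = fun ∘ e
        ; f = fun ∘ f
        ; e-homogeneous = λ i → homogeneous-homo s (e-homogeneous i)
        ; f-homogeneous = λ j → homogeneous-homo s (f-homogeneous j)
        ; Πₗf≈Πᵣf = λ j → B.≈ᴹ-trans (B.≈ᴹ-sym (Πₗ-homo _))
                            (B.≈ᴹ-trans (cong (Πₗf≈Πᵣf j)) (Πᵣ-homo _))
        ; e-independent = λ a p → e-independent a (Kernel-reflect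
            (BL.IsSubmodule.≈-resp BF.Kernel-isSubmodule (B.≈ᴹ-sym (comb-homo a e)) p))
        ; f-independent = λ a p → f-independent a (Image-reflect
            (BL.IsSubmodule.≈-resp BF.Image-isSubmodule (B.≈ᴹ-sym (comb-homo a f)) p))
        ; e-spans = λ hy → let x , hx , y≈ = homogeneous-lift s hy in
            BL.IsSubmodule.≈-resp (BL.Adjoin-isSubmodule BF.Kernel-isSubmodule (fun ∘ e)) (B.≈ᴹ-sym y≈)
              (Adjoin-preserve Kernel-preserve (e-spans hx))
        ; f-spans = λ hy ky → let x , hx , y≈ = homogeneous-lift s hy in
            BL.IsSubmodule.≈-resp (BL.Adjoin-isSubmodule BF.Image-isSubmodule (fun ∘ f)) (B.≈ᴹ-sym y≈)
              (Adjoin-preserve Image-preserve (f-spans hx (Kernel-reflect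
                (BL.IsSubmodule.≈-resp BF.Kernel-isSubmodule y≈ ky))))
        }
        where open AF.DegreeBasis b

  -- ixE s i x y stands for Πˣ e Πʸ with e = e s i, and ixF s j y for f Πʸ with f = f s j.
  data Index (m n : ℕ × ℕ) : Set where
    ixE : ∀ s → Fin (at m s) → Bool → Bool → Index m n
    ixF : ∀ s → Fin (at n s) → Bool → Index m n

  shift : Bool → Bool → Bool
  shift false s = s
  shift true  s = not s

  -- The carry when 1 is added to an exponent modulo 2: Π times Πˣ is `π^ x` times Π to the power
  -- `not x`.
  π^ : Bool → Carrier
  π^ false = 1#
  π^ true  = π

  σπ^ : ∀ x → σ (π^ x) ≈ π^ x
  σπ^ false = σ-1
  σπ^ true  = σπ≈π

  twist-shift-not : ∀ y s a → twist (shift (not y) s) a ≈ twist (shift y s) (σ a)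
  twist-shift-not false s     a = twist-not s a
  twist-shift-not true  false a = sym (σ-σ a)
  twist-shift-not true  true  a = refl

  module _ {m n : ℕ × ℕ} where
    left right : Index m n → Index m n
    left  (ixE s i x y) = ixE s i (not x) y
    left  (ixF s j y)   = ixF s j (not y)
    right (ixE s i x y) = ixE s i x (not y)
    right (ixF s j y)   = ixF s j (not y)

    degree : Index m n → Bool
    degree (ixE s i x y) = shift y (shift x s)
    degree (ixF s j y)   = shift y s

    -- The two coefficients with Π b = leftCoef b · left b and b Π = rightCoef b · right b.
    leftCoef rightCoef : Index m n → Carrier
    leftCoef  (ixE s i x y) = π^ x
    leftCoef  (ixF s j y)   = π^ y
    rightCoef (ixE s i x y) = π^ y
    rightCoef (ixF s j y)   = π^ y

    σ-leftCoef : ∀ b → σ (leftCoef b) ≈ leftCoef b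
    σ-leftCoef (ixE s i x y) = σπ^ x
    σ-leftCoef (ixF s j y)   = σπ^ y

    σ-rightCoef : ∀ b → σ (rightCoef b) ≈ rightCoef b
    σ-rightCoef (ixE s i x y) = σπ^ y
    σ-rightCoef (ixF s j y)   = σπ^ y

    twist-left : ∀ b a → twist (degree (left b)) a ≈ twist (degree b) (σ a)
    twist-left (ixE s i false false) a = twist-shift-not false s a
    twist-left (ixE s i false true)  a = twist-shift-not false (not s) a
    twist-left (ixE s i true false)  a = twist-shift-not true s a
    twist-left (ixE s i true true)   a = twist-shift-not true (not s) a
    twist-left (ixF s j y)           a = twist-shift-not y s a

    twist-right : ∀ b a → twist (degree (right b)) a ≈ twist (degree b) (σ a)
    twist-right (ixE s i x y) a = twist-shift-not y (shift x s) a
    twist-right (ixF s j y)   a = twist-shift-not y s a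

  open CommutativeSemigroupProperties *-commutativeSemigroup using (x∙yz≈y∙xz)

  -- A family `u` stands for the sum of the terms `u b` times `b`, so this is free as a left
  -- O_K-module. Since `left` and `right` are involutions, the coefficient at `b` after
  -- multiplication by Π comes from the index `left b` or `right b`, which is why `Πₗ` and `Πᵣ`
  -- evaluate `u` there.
  standard : ℕ × ℕ → ℕ × ℕ → Π-Bimodule 𝒦
  standard m n = record
    { bimodule = record
      { Carrierᴹ = Index m n → Carrier
      ; _≈ᴹ_ = λ u v → ∀ b → u b ≈ v b
      ; _+ᴹ_ = λ u v b → u b + v b
      ; _*ₗ_ = λ a u b → a * u b
      ; _*ᵣ_ = λ u a b → twist (degree b) a * u b
      ; 0ᴹ = λ _ → 0#
      ; -ᴹ_ = λ u b → - u b
      ; isBimodule = record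
        { isBisemimodule = record
          { +ᴹ-isCommutativeMonoid = record
            { isMonoid = record
              { isSemigroup = record
                { isMagma = record
                  { isEquivalence = record
                    { refl = λ _ → refl ; sym = λ e b → sym (e b) ; trans = λ e f b → trans (e b) (f b) }
                  ; ∙-cong = λ e f b → +-cong (e b) (f b)
                  }
                ; assoc = λ u v w b → +-assoc (u b) (v b) (w b)
                }
              ; identity = (λ u b → +-identityˡ (u b)) , (λ u b → +-identityʳ (u b))
              }
            ; comm = λ u v b → +-comm (u b) (v b)
            }
          ; isPreleftSemimodule = record
            { *ₗ-cong = λ e f b → *-cong e (f b)
            ; *ₗ-zeroˡ = λ u b → zeroˡ (u b)
            ; *ₗ-distribʳ = λ u a c b → distribʳ (u b) a c
            ; *ₗ-identityˡ = λ u b → *-identityˡ (u b)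
            ; *ₗ-assoc = λ a c u b → *-assoc a c (u b)
            ; *ₗ-zeroʳ = λ a b → zeroʳ a
            ; *ₗ-distribˡ = λ a u v b → distribˡ a (u b) (v b)
            }
          ; isPrerightSemimodule = record
            { *ᵣ-cong = λ e f b → *-cong (twist-cong (degree b) f) (e b)
            ; *ᵣ-zeroʳ = λ u b → trans (*-congʳ (twist-0 (degree b))) (zeroˡ (u b))
            ; *ᵣ-distribˡ = λ u a c b → trans (*-congʳ (twist-+ (degree b) a c)) (distribʳ (u b) _ _)
            ; *ᵣ-identityʳ = λ u b → trans (*-congʳ (twist-1 (degree b))) (*-identityˡ (u b))
            ; *ᵣ-assoc = λ u a c b → trans (sym (*-assoc _ _ _))
                (*-congʳ (trans (*-comm _ _) (sym (twist-* (degree b) a c))))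
            ; *ᵣ-zeroˡ = λ a b → zeroʳ _
            ; *ᵣ-distribʳ = λ a u v b → distribˡ _ (u b) (v b)
            }
          ; *ₗ-*ᵣ-assoc = λ a u c b → x∙yz≈y∙xz _ _ _
          }
        ; -ᴹ‿cong = λ e b → -‿cong (e b)
        ; -ᴹ‿inverse = (λ u b → -‿inverseˡ (u b)) , (λ u b → -‿inverseʳ (u b))
        }
      }
    ; Πₗ = λ u b → leftCoef (left b) * σ (u (left b))
    ; Πᵣ = λ u b → rightCoef (right b) * u (right b)
    ; Πₗ-cong = λ e b → *-congˡ (σ-cong (e (left b)))
    ; Πᵣ-cong = λ e b → *-congˡ (e (right b))
    ; Πₗ-+ = λ u v b → trans (*-congˡ (σ-+ _ _)) (distribˡ _ _ _)
    ; Πᵣ-+ = λ u v b → distribˡ _ _ _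
    ; Πₗ-*ₗ = λ a u b → trans (*-congˡ (σ-* _ _)) (x∙yz≈y∙xz _ _ _)
    ; Πᵣ-*ₗ = λ a u b → x∙yz≈y∙xz _ _ _
    ; Πₗ-*ᵣ = λ u a b → trans (*-congˡ (trans (σ-* _ _) (*-congʳ (σ-twist-left b a)))) (x∙yz≈y∙xz _ _ _)
    ; Πᵣ-*ᵣ = λ u a b → trans (*-congˡ (*-congʳ (twist-right b a))) (x∙yz≈y∙xz _ _ _)
    ; Πₗ-Πᵣ = λ u b → trans (*-congˡ (trans (σ-* _ _) (*-congʳ (σ-rightCoef (right (left b))))))
                        (commute u b)
    ; Πₗ² = λ u b → trans (*-congˡ (trans (σ-* _ _)
              (*-cong (σ-leftCoef (left (left b))) (σ-σ _))))
              (trans (sym (*-assoc _ _ _)) (left² u b))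
    ; Πᵣ² = λ u b → trans (sym (*-assoc _ _ _)) (trans (right² u b) (*-congʳ (sym (twist-fixed (degree b) σπ≈π))))
    ; fixed-central = λ fixed u b → *-congʳ (sym (twist-fixed (degree b) fixed))
    }
    where
    σ-twist-left : ∀ (b : Index m n) a → σ (twist (degree (left b)) a) ≈ twist (degree b) a
    σ-twist-left b a = trans (σ-twist (degree (left b)) a)
      (trans (twist-left b (σ a)) (twist-cong (degree b) (σ-σ a)))
    -- On the e's, `left` and `right` change separate exponents; on the f's they coincide, which
    -- encodes Πf = fΠ.
    commute : ∀ (u : Index m n → Carrier) b →
              leftCoef (left b) * (rightCoef (right (left b)) * σ (u (right (left b)))) ≈
              rightCoef (right b) * (leftCoef (left (right b)) * σ (u (left (right b))))
    commute u (ixE s i x y) = x∙yz≈y∙xz _ _ _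
    commute u (ixF s j y)   = refl
    π^-π^ : ∀ x → π^ (not x) * π^ (not (not x)) ≈ π
    π^-π^ false = *-identityʳ π
    π^-π^ true  = *-identityˡ π
    not-not : ∀ (p : Bool → Carrier) x → p (not (not x)) ≈ p x
    not-not p false = refl
    not-not p true  = refl
    left² : ∀ (u : Index m n → Carrier) b →
            (leftCoef (left b) * leftCoef (left (left b))) * u (left (left b)) ≈ π * u b
    left² u (ixE s i x y) = *-cong (π^-π^ x) (not-not (λ x → u (ixE s i x y)) x)
    left² u (ixF s j y)   = *-cong (π^-π^ y) (not-not (λ y → u (ixF s j y)) y)
    right² : ∀ (u : Index m n → Carrier) b →
            (rightCoef (right b) * rightCoef (right (right b))) * u (right (right b)) ≈ π * u b
    right² u (ixE s i x y) = *-cong (π^-π^ y) (not-not (λ y → u (ixE s i x y)) y)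
    right² u (ixF s j y)   = *-cong (π^-π^ y) (not-not (λ y → u (ixF s j y)) y)

-- Coordinates with respect to an adapted basis

module _ {ℓ} (𝒦 : UnramifiedInvolution ℓ) where
  open UnramifiedInvolution 𝒦

  module Parametrization (A : Π-Bimodule 𝒦) {m n : ℕ × ℕ}
                         (basis : Filtration.AdaptedBasis 𝒦 A m n) where
    open Π-Bimodule A
    open LinearAlgebra leftModule
    open Grading 𝒦 A
    open Filtration 𝒦 A
    open module Basis s = DegreeBasis (basis s)
    private
      module Std = Π-Bimodule (standard 𝒦 m n)
      module AΠ = IsSubmodule AΠ-isSubmodule
      module Kernel = IsSubmodule Kernel-isSubmodule
      module Image = IsSubmodule Image-isSubmodule
    open CommutativeSemigroupProperties
      (CommutativeMonoid.commutativeSemigroup +ᴹ-commutativeMonoid) using (interchange)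
    open SetoidReasoning ≈ᴹ-setoid

    comb-Πᵣ : ∀ {k} (a : Vector Carrier k) x → Πᵣ (comb a x) ≈ᴹ comb a (Πᵣ ∘ x)
    comb-Πᵣ {zero}  a x = Πᵣ-0
    comb-Πᵣ {suc k} a x = ≈ᴹ-trans (Πᵣ-+ _ _) (+ᴹ-cong (Πᵣ-*ₗ _ _) (comb-Πᵣ (tail a) (tail x)))

    comb-Πₗ : ∀ {k} (a : Vector Carrier k) x → Πₗ (comb a x) ≈ᴹ comb (σ ∘ a) (Πₗ ∘ x)
    comb-Πₗ {zero}  a x = Πₗ-0
    comb-Πₗ {suc k} a x = ≈ᴹ-trans (Πₗ-+ _ _) (+ᴹ-cong (Πₗ-*ₗ _ _) (comb-Πₗ (tail a) (tail x)))

    comb-*ᵣ : ∀ {k} s (a : Vector Carrier k) {x} → (∀ i → Homogeneous s (x i)) →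
              ∀ c → comb (λ i → twist s c * a i) x ≈ᴹ comb a x *ᵣ c
    comb-*ᵣ s a hx c = ≈ᴹ-trans (comb-* (twist s c) a _)
      (≈ᴹ-sym (IsSubmodule.comb∈ (homogeneous-isSubmodule s) a hx c))

    comb-1* : ∀ {k} (a : Vector Carrier k) x → comb (λ i → 1# * a i) x ≈ᴹ comb a x
    comb-1* a x = comb-cong (λ i → *-identityˡ (a i)) (λ _ → ≈ᴹ-refl)

    -- Coordinates with respect to e, Πe and f, and, for y = true, to eΠ, ΠeΠ and fΠ.
    eCoord gCoord : ∀ s → Bool → Std.Carrierᴹ → Vector Carrier (at m s)
    eCoord s y u i = u (ixE s i false y)
    gCoord s y u i = u (ixE s i true y)

    fCoord : ∀ s → Bool → Std.Carrierᴹ → Vector Carrier (at n s)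
    fCoord s y u j = u (ixF s j y)

    ePart fPart part : Bool → Bool → Std.Carrierᴹ → Carrierᴹ
    ePart s y u = comb (eCoord s y u) (e s) +ᴹ comb (gCoord s y u) (Πₗ ∘ e s)
    fPart s y u = comb (fCoord s y u) (f s)
    part  s y u = ePart s y u +ᴹ fPart s y u

    -- Coefficients are written on the left, where Πᵣ is linear. So the terms ending in Π form Πᵣ of
    -- a combination of the same e, Πe, f as the terms without it.
    layer : Bool → Std.Carrierᴹ → Carrierᴹ
    layer y u = part false y u +ᴹ part true y u

    param : Std.Carrierᴹ → Carrierᴹ
    param u = layer false u +ᴹ Πᵣ (layer true u)

    layer-cong : ∀ y {u v} → u Std.≈ᴹ v → layer y u ≈ᴹ layer y v
    layer-cong y {u} {v} p = +ᴹ-cong (part-cong false) (part-cong true)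
      where
      part-cong : ∀ s → part s y u ≈ᴹ part s y v
      part-cong s = +ᴹ-cong
        (+ᴹ-cong (comb-cong (λ i → p (ixE s i false y)) (λ _ → ≈ᴹ-refl))
                 (comb-cong (λ i → p (ixE s i true y)) (λ _ → ≈ᴹ-refl)))
        (comb-cong (λ j → p (ixF s j y)) (λ _ → ≈ᴹ-refl))

    layer-+ : ∀ y u v → layer y (u Std.+ᴹ v) ≈ᴹ layer y u +ᴹ layer y v
    layer-+ y u v = ≈ᴹ-trans (+ᴹ-cong (part-+ false) (part-+ true)) (interchange _ _ _ _)
      where
      part-+ : ∀ s → part s y (u Std.+ᴹ v) ≈ᴹ part s y u +ᴹ part s y v
      part-+ s = ≈ᴹ-trans
        (+ᴹ-cong (≈ᴹ-trans (+ᴹ-cong (comb-+ (eCoord s y u) (eCoord s y v) (e s)) (comb-+ (gCoord s y u) (gCoord s y v) (Πₗ ∘ e s)))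
                            (interchange _ _ _ _))
                 (comb-+ (fCoord s y u) (fCoord s y v) (f s)))
        (interchange _ _ _ _)

    layer-*ₗ : ∀ y a u → layer y (a Std.*ₗ u) ≈ᴹ a *ₗ layer y u
    layer-*ₗ y a u = ≈ᴹ-trans (+ᴹ-cong (part-*ₗ false) (part-*ₗ true)) (≈ᴹ-sym (*ₗ-distribˡ a _ _))
      where
      part-*ₗ : ∀ s → part s y (a Std.*ₗ u) ≈ᴹ a *ₗ part s y u
      part-*ₗ s = ≈ᴹ-trans
        (+ᴹ-cong (≈ᴹ-trans (+ᴹ-cong (comb-* a (eCoord s y u) (e s)) (comb-* a (gCoord s y u) (Πₗ ∘ e s)))
                            (≈ᴹ-sym (*ₗ-distribˡ a _ _)))
                 (comb-* a (fCoord s y u) (f s)))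
        (≈ᴹ-sym (*ₗ-distribˡ a _ _))

    -- In layer `true` the scalar appears as σa, because it turns back into a when it is moved past
    -- the Πᵣ that `param` applies to that layer.
    layer-*ᵣ : ∀ y u a → layer y (u Std.*ᵣ a) ≈ᴹ layer y u *ᵣ twist y a
    layer-*ᵣ y u a = ≈ᴹ-trans (+ᴹ-cong (part-*ᵣ false) (part-*ᵣ true)) (≈ᴹ-sym (*ᵣ-distribʳ _ _ _))
      where
      twist-shift : ∀ y s → twist (shift 𝒦 y s) a ≈ twist s (twist y a)
      twist-shift false s = refl
      twist-shift true  s = twist-not s a
      summand : ∀ s {k} (c : Vector Carrier k) {x} → (∀ i → Homogeneous s (x i)) →
                comb (λ i → twist (shift 𝒦 y s) a * c i) x ≈ᴹ comb c x *ᵣ twist y a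
      summand s c {x} hx = ≈ᴹ-trans (comb-cong {y = x} (λ i → *-congʳ (twist-shift y s)) (λ _ → ≈ᴹ-refl))
        (comb-*ᵣ s c hx (twist y a))
      part-*ᵣ : ∀ s → part s y (u Std.*ᵣ a) ≈ᴹ part s y u *ᵣ twist y a
      part-*ᵣ s = ≈ᴹ-trans
        (+ᴹ-cong
          (≈ᴹ-trans (+ᴹ-cong (summand s (eCoord s y u) (e-homogeneous s))
                             (summand (not s) (gCoord s y u) (λ i → Πₗ-homogeneous {s} (e-homogeneous s i))))
                    (≈ᴹ-sym (*ᵣ-distribʳ _ _ _)))
          (summand s (fCoord s y u) (f-homogeneous s)))
        (≈ᴹ-sym (*ᵣ-distribʳ _ _ _))

    layer-Πᵣ-false : ∀ u → layer false (Std.Πᵣ u) ≈ᴹ π *ₗ layer true u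
    layer-Πᵣ-false u = ≈ᴹ-trans (+ᴹ-cong (go false) (go true)) (≈ᴹ-sym (*ₗ-distribˡ π _ _))
      where
      go : ∀ s → part s false (Std.Πᵣ u) ≈ᴹ π *ₗ part s true u
      go s = ≈ᴹ-trans
        (+ᴹ-cong (≈ᴹ-trans (+ᴹ-cong (comb-* π (eCoord s true u) (e s)) (comb-* π (gCoord s true u) (Πₗ ∘ e s)))
                            (≈ᴹ-sym (*ₗ-distribˡ π _ _)))
                 (comb-* π (fCoord s true u) (f s)))
        (≈ᴹ-sym (*ₗ-distribˡ π _ _))

    layer-Πᵣ-true : ∀ u → layer true (Std.Πᵣ u) ≈ᴹ layer false u
    layer-Πᵣ-true u = +ᴹ-cong (go false) (go true)
      where
      go : ∀ s → part s true (Std.Πᵣ u) ≈ᴹ part s false u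
      go s = +ᴹ-cong (+ᴹ-cong (comb-1* (eCoord s false u) (e s)) (comb-1* (gCoord s false u) (Πₗ ∘ e s)))
        (comb-1* (fCoord s false u) (f s))

    ePart-Πₗ : ∀ s y u → ePart s y (Std.Πₗ u) ≈ᴹ Πₗ (ePart s y u)
    ePart-Πₗ s y u = begin
      comb (λ i → π * σ (gCoord s y u i)) (e s) +ᴹ comb (λ i → 1# * σ (eCoord s y u i)) (Πₗ ∘ e s)
        ≈⟨ +ᴹ-cong (comb-* π (σ ∘ gCoord s y u) (e s)) (comb-1* (σ ∘ eCoord s y u) (Πₗ ∘ e s)) ⟩
      π *ₗ comb (σ ∘ gCoord s y u) (e s) +ᴹ comb (σ ∘ eCoord s y u) (Πₗ ∘ e s)
        ≈⟨ +ᴹ-cong (Πₗ² _) (comb-Πₗ (eCoord s y u) (e s)) ⟨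
      Πₗ (Πₗ (comb (σ ∘ gCoord s y u) (e s))) +ᴹ Πₗ (comb (eCoord s y u) (e s))
        ≈⟨ +ᴹ-congʳ (Πₗ-cong (≈ᴹ-trans (comb-Πₗ (σ ∘ gCoord s y u) (e s)) (comb-cong {y = Πₗ ∘ e s} (λ i → σ-σ (gCoord s y u i)) (λ _ → ≈ᴹ-refl)))) ⟩
      Πₗ (comb (gCoord s y u) (Πₗ ∘ e s)) +ᴹ Πₗ (comb (eCoord s y u) (e s))
        ≈⟨ +ᴹ-comm _ _ ⟩
      Πₗ (comb (eCoord s y u) (e s)) +ᴹ Πₗ (comb (gCoord s y u) (Πₗ ∘ e s))
        ≈⟨ Πₗ-+ _ _ ⟨
      Πₗ (ePart s y u) ∎

    -- Πₗ exchanges the two layers of the f's, on which it agrees with Πᵣ.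
    fPart-Πₗ : ∀ s u → fPart s false (Std.Πₗ u) +ᴹ Πᵣ (fPart s true (Std.Πₗ u)) ≈ᴹ
                       Πₗ (fPart s false u) +ᴹ Πᵣ (Πₗ (fPart s true u))
    fPart-Πₗ s u = begin
      comb (λ j → π * σ (fCoord s true u j)) (f s) +ᴹ Πᵣ (comb (λ j → 1# * σ (fCoord s false u j)) (f s))
        ≈⟨ +ᴹ-cong (comb-* π (σ ∘ fCoord s true u) (f s)) (Πᵣ-cong (comb-1* (σ ∘ fCoord s false u) (f s))) ⟩
      π *ₗ comb (σ ∘ fCoord s true u) (f s) +ᴹ Πᵣ (comb (σ ∘ fCoord s false u) (f s))
        ≈⟨ +ᴹ-cong (≈ᴹ-trans (≈ᴹ-sym (Πᵣ²ₗ _)) (Πᵣ-cong (Πᵣ-σ (fCoord s true u)))) (Πᵣ-σ (fCoord s false u)) ⟩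
      Πᵣ (Πₗ (fPart s true u)) +ᴹ Πₗ (fPart s false u)
        ≈⟨ +ᴹ-comm _ _ ⟩
      Πₗ (fPart s false u) +ᴹ Πᵣ (Πₗ (fPart s true u)) ∎
      where
      Πᵣ-σ : ∀ a → Πᵣ (comb (σ ∘ a) (f s)) ≈ᴹ Πₗ (comb a (f s))
      Πᵣ-σ a = ≈ᴹ-trans (comb-Πᵣ (σ ∘ a) (f s)) (≈ᴹ-trans
        (comb-cong {a = σ ∘ a} (λ _ → refl) (λ j → ≈ᴹ-sym (Πₗf≈Πᵣf s j))) (≈ᴹ-sym (comb-Πₗ a (f s))))

    param-Πₗ : ∀ u → param (Std.Πₗ u) ≈ᴹ Πₗ (param u)
    param-Πₗ u = begin
      layer false (Std.Πₗ u) +ᴹ Πᵣ (layer true (Std.Πₗ u))                 ≈⟨ regroup (Std.Πₗ u) ⟩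
      column (Std.Πₗ u) false +ᴹ column (Std.Πₗ u) true                    ≈⟨ +ᴹ-cong (column-Πₗ false) (column-Πₗ true) ⟩
      Πₗ (column u false) +ᴹ Πₗ (column u true)                            ≈⟨ Πₗ-+ _ _ ⟨
      Πₗ (column u false +ᴹ column u true)                                 ≈⟨ Πₗ-cong (regroup u) ⟨
      Πₗ (param u)                                                         ∎
      where
      column : Std.Carrierᴹ → Bool → Carrierᴹ
      column u s = part s false u +ᴹ Πᵣ (part s true u)
      regroup : ∀ u → param u ≈ᴹ column u false +ᴹ column u true
      regroup u = ≈ᴹ-trans (+ᴹ-congˡ (Πᵣ-+ _ _)) (interchange _ _ _ _)
      split : ∀ u s → column u s ≈ᴹ (ePart s false u +ᴹ Πᵣ (ePart s true u)) +ᴹ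
                                    (fPart s false u +ᴹ Πᵣ (fPart s true u))
      split u s = ≈ᴹ-trans (+ᴹ-congˡ (Πᵣ-+ _ _)) (interchange _ _ _ _)
      column-Πₗ : ∀ s → column (Std.Πₗ u) s ≈ᴹ Πₗ (column u s)
      column-Πₗ s = begin
        column (Std.Πₗ u) s
          ≈⟨ split (Std.Πₗ u) s ⟩
        (ePart s false (Std.Πₗ u) +ᴹ Πᵣ (ePart s true (Std.Πₗ u))) +ᴹ
        (fPart s false (Std.Πₗ u) +ᴹ Πᵣ (fPart s true (Std.Πₗ u)))
          ≈⟨ +ᴹ-cong (+ᴹ-cong (ePart-Πₗ s false u) (Πᵣ-cong (ePart-Πₗ s true u))) (fPart-Πₗ s u) ⟩
        (Πₗ (ePart s false u) +ᴹ Πᵣ (Πₗ (ePart s true u))) +ᴹ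
        (Πₗ (fPart s false u) +ᴹ Πᵣ (Πₗ (fPart s true u)))
          ≈⟨ +ᴹ-cong (pull _ _) (pull _ _) ⟨
        Πₗ (ePart s false u +ᴹ Πᵣ (ePart s true u)) +ᴹ Πₗ (fPart s false u +ᴹ Πᵣ (fPart s true u))
          ≈⟨ Πₗ-+ _ _ ⟨
        Πₗ ((ePart s false u +ᴹ Πᵣ (ePart s true u)) +ᴹ (fPart s false u +ᴹ Πᵣ (fPart s true u)))
          ≈⟨ Πₗ-cong (split u s) ⟨
        Πₗ (column u s) ∎
        where
        pull : ∀ x y → Πₗ (x +ᴹ Πᵣ y) ≈ᴹ Πₗ x +ᴹ Πᵣ (Πₗ y)
        pull x y = ≈ᴹ-trans (Πₗ-+ _ _) (+ᴹ-congˡ (Πₗ-Πᵣ y))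

    paramHom : Π-Hom 𝒦 (standard 𝒦 m n) A
    paramHom = record
      { fun = param
      ; cong = λ p → +ᴹ-cong (layer-cong false p) (Πᵣ-cong (layer-cong true p))
      ; +-homo = λ u v → ≈ᴹ-trans
          (+ᴹ-cong (layer-+ false u v) (≈ᴹ-trans (Πᵣ-cong (layer-+ true u v)) (Πᵣ-+ _ _)))
          (interchange _ _ _ _)
      ; *ₗ-homo = λ a u → ≈ᴹ-trans
          (+ᴹ-cong (layer-*ₗ false a u) (≈ᴹ-trans (Πᵣ-cong (layer-*ₗ true a u)) (Πᵣ-*ₗ _ _)))
          (≈ᴹ-sym (*ₗ-distribˡ a _ _))
      ; *ᵣ-homo = λ u a → ≈ᴹ-trans
          (+ᴹ-cong (layer-*ᵣ false u a) (≈ᴹ-trans (Πᵣ-cong (layer-*ᵣ true u a))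
            (≈ᴹ-trans (Πᵣ-*ᵣ _ _) (*ᵣ-cong ≈ᴹ-refl (σ-σ a)))))
          (≈ᴹ-sym (*ᵣ-distribʳ a _ _))
      ; Πₗ-homo = param-Πₗ
      ; Πᵣ-homo = λ u → begin
          layer false (Std.Πᵣ u) +ᴹ Πᵣ (layer true (Std.Πᵣ u))  ≈⟨ +ᴹ-cong (layer-Πᵣ-false u) (Πᵣ-cong (layer-Πᵣ-true u)) ⟩
          π *ₗ layer true u +ᴹ Πᵣ (layer false u)               ≈⟨ +ᴹ-comm _ _ ⟩
          Πᵣ (layer false u) +ᴹ π *ₗ layer true u               ≈⟨ +ᴹ-congˡ (Πᵣ²ₗ _) ⟨
          Πᵣ (layer false u) +ᴹ Πᵣ (Πᵣ (layer true u))          ≈⟨ Πᵣ-+ _ _ ⟨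
          Πᵣ (param u)                                          ∎
      }

    Range : Pred Carrierᴹ ℓ
    Range z = ∃[ u ] z ≈ᴹ param u

    private module param = Π-Hom paramHom

    Range-isSubmodule : IsSubmodule Range
    Range-isSubmodule = record
      { ≈-resp = λ p (u , q) → u , ≈ᴹ-trans (≈ᴹ-sym p) q
      ; 0∈ = Std.0ᴹ , ≈ᴹ-sym param.0-homo
      ; +∈ = λ (u , p) (v , q) → u Std.+ᴹ v , ≈ᴹ-trans (+ᴹ-cong p q) (≈ᴹ-sym (param.+-homo u v))
      ; *∈ = λ a (u , p) → a Std.*ₗ u , ≈ᴹ-trans (*ₗ-cong refl p) (≈ᴹ-sym (param.*ₗ-homo a u))
      }

    comb-0# : ∀ {k} {a : Vector Carrier k} → (∀ i → a i ≈ 0#) → ∀ x → comb a x ≈ᴹ 0ᴹ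
    comb-0# p x = ≈ᴹ-trans (comb-cong {y = x} p (λ _ → ≈ᴹ-refl)) (comb-0 x)

    private
      +-zeroʳ : ∀ {x y} → y ≈ᴹ 0ᴹ → x +ᴹ y ≈ᴹ x
      +-zeroʳ p = ≈ᴹ-trans (+ᴹ-congˡ p) (+ᴹ-identityʳ _)

      +-zeroˡ : ∀ {x y} → x ≈ᴹ 0ᴹ → x +ᴹ y ≈ᴹ y
      +-zeroˡ p = ≈ᴹ-trans (+ᴹ-congʳ p) (+ᴹ-identityˡ _)

      ePart-0 : ∀ s y u → (∀ i x → u (ixE s i x y) ≈ 0#) → ePart s y u ≈ᴹ 0ᴹ
      ePart-0 s y u p = ≈ᴹ-trans (+-zeroʳ (comb-0# (λ i → p i true) (Πₗ ∘ e s))) (comb-0# (λ i → p i false) (e s))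

      fPart-0 : ∀ s y u → (∀ j → u (ixF s j y) ≈ 0#) → fPart s y u ≈ᴹ 0ᴹ
      fPart-0 s y u q = comb-0# q (f s)

      part-0 : ∀ s y u → (∀ i x → u (ixE s i x y) ≈ 0#) → (∀ j → u (ixF s j y) ≈ 0#) → part s y u ≈ᴹ 0ᴹ
      part-0 s y u p q = ≈ᴹ-trans (+-zeroʳ (fPart-0 s y u q)) (ePart-0 s y u p)

      param-layer : ∀ u → layer true u ≈ᴹ 0ᴹ → param u ≈ᴹ layer false u
      param-layer u p = +-zeroʳ (≈ᴹ-trans (Πᵣ-cong p) Πᵣ-0)

      includeE : ∀ s → Vector Carrier (at m s) → Std.Carrierᴹ
      includeE false a (ixE false i false false) = a i
      includeE true  a (ixE true i false false)  = a i
      includeE _     a _                       = 0#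

      includeF : ∀ s → Vector Carrier (at n s) → Std.Carrierᴹ
      includeF false a (ixF false j false) = a j
      includeF true  a (ixF true j false)  = a j
      includeF _     a _                 = 0#

      e-range : ∀ s a → Range (comb a (e s))
      e-range s a = includeE s a , ≈ᴹ-sym (≈ᴹ-trans (param-layer (includeE s a) (high s)) (low s a))
        where
        high : ∀ s {a} → layer true (includeE s a) ≈ᴹ 0ᴹ
        high false {a} = ≈ᴹ-trans (+-zeroˡ (part-0 false true (includeE false a) (λ { i false → refl ; i true → refl }) (λ _ → refl)))
          (part-0 true true (includeE false a) (λ _ _ → refl) (λ _ → refl))
        high true {a} = ≈ᴹ-trans (+-zeroˡ (part-0 false true (includeE true a) (λ _ _ → refl) (λ _ → refl)))
          (part-0 true true (includeE true a) (λ { i false → refl ; i true → refl }) (λ _ → refl))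
        low : ∀ s a → layer false (includeE s a) ≈ᴹ comb a (e s)
        low false a = ≈ᴹ-trans (+-zeroʳ (part-0 true false (includeE false a) (λ _ _ → refl) (λ _ → refl)))
          (≈ᴹ-trans (+-zeroʳ (fPart-0 false false (includeE false a) (λ _ → refl))) (+-zeroʳ (comb-0# (λ _ → refl) (Πₗ ∘ e false))))
        low true a = ≈ᴹ-trans (+-zeroˡ (part-0 false false (includeE true a) (λ _ _ → refl) (λ _ → refl)))
          (≈ᴹ-trans (+-zeroʳ (fPart-0 true false (includeE true a) (λ _ → refl))) (+-zeroʳ (comb-0# (λ _ → refl) (Πₗ ∘ e true))))

      f-range : ∀ s a → Range (comb a (f s))
      f-range s a = includeF s a , ≈ᴹ-sym (≈ᴹ-trans (param-layer (includeF s a) (high s)) (low s a))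
        where
        high : ∀ s {a} → layer true (includeF s a) ≈ᴹ 0ᴹ
        high false {a} = ≈ᴹ-trans (+-zeroˡ (part-0 false true (includeF false a) (λ _ _ → refl) (λ _ → refl)))
          (part-0 true true (includeF false a) (λ _ _ → refl) (λ _ → refl))
        high true {a} = ≈ᴹ-trans (+-zeroˡ (part-0 false true (includeF true a) (λ _ _ → refl) (λ _ → refl)))
          (part-0 true true (includeF true a) (λ _ _ → refl) (λ _ → refl))
        low : ∀ s a → layer false (includeF s a) ≈ᴹ comb a (f s)
        low false a = ≈ᴹ-trans (+-zeroʳ (part-0 true false (includeF false a) (λ _ _ → refl) (λ _ → refl)))
          (+-zeroˡ (ePart-0 false false (includeF false a) (λ _ _ → refl)))
        low true a = ≈ᴹ-trans (+-zeroˡ (part-0 false false (includeF true a) (λ _ _ → refl) (λ _ → refl)))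
          (+-zeroˡ (ePart-0 true false (includeF true a) (λ _ _ → refl)))

    private
      -- The sum of the range and AΠ, to be shown equal to A. The e's reduce an element to the
      -- kernel, the f's reduce the kernel to the image, and ΠₗA is covered because Πₗ preserves the
      -- range and sends the kernel into AΠ.
      Cover : Pred Carrierᴹ ℓ
      Cover z = ∃[ r ] ∃[ w ] Range r × z ≈ᴹ r +ᴹ Πᵣ w

      module Range = IsSubmodule Range-isSubmodule

      Cover-+ : ∀ {x y} → Cover x → Cover y → Cover (x +ᴹ y)
      Cover-+ (r , w , p , q) (r′ , w′ , p′ , q′) = r +ᴹ r′ , w +ᴹ w′ , Range.+∈ p p′ ,
        ≈ᴹ-trans (+ᴹ-cong q q′) (≈ᴹ-trans (interchange _ _ _ _) (+ᴹ-congˡ (≈ᴹ-sym (Πᵣ-+ w w′))))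

      Cover-resp : ∀ {x y} → x ≈ᴹ y → Cover x → Cover y
      Cover-resp p (r , w , q , t) = r , w , q , ≈ᴹ-trans (≈ᴹ-sym p) t

      Range⊆Cover : Range ⊆ Cover
      Range⊆Cover {x} p = x , 0ᴹ , p , ≈ᴹ-sym (+-zeroʳ Πᵣ-0)

      AΠ⊆Cover : AΠ ⊆ Cover
      AΠ⊆Cover (w , q) = 0ᴹ , w , Range.0∈ , ≈ᴹ-trans q (≈ᴹ-sym (+ᴹ-identityˡ _))

      Πₗ-Range : ∀ {x} → Range x → Range (Πₗ x)
      Πₗ-Range (u , p) = Std.Πₗ u , ≈ᴹ-trans (Πₗ-cong p) (≈ᴹ-sym (param.Πₗ-homo u))

      Πᵣ-Range : ∀ {x} → Range x → Range (Πᵣ x)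
      Πᵣ-Range (u , p) = Std.Πᵣ u , ≈ᴹ-trans (Πᵣ-cong p) (≈ᴹ-sym (param.Πᵣ-homo u))

      Πₗ-cover-homogeneous : ∀ s {y} → Homogeneous s y → Cover (Πₗ y)
      Πₗ-cover-homogeneous s hy with e-spans s hy
      ... | a , k , k∈ , p = Cover-resp (≈ᴹ-sym (≈ᴹ-trans (Πₗ-cong p) (Πₗ-+ _ _)))
              (Cover-+ (Range⊆Cover (Πₗ-Range (e-range s a))) (AΠ⊆Cover k∈))

      Πₗ-cover : ∀ y → Cover (Πₗ y)
      Πₗ-cover y with homogeneous-decomposition y
      ... | c , hc , p = Cover-resp (≈ᴹ-sym (≈ᴹ-trans (Πₗ-cong p) (Πₗ-+ _ _)))
              (Cover-+ (Πₗ-cover-homogeneous false (hc false)) (Πₗ-cover-homogeneous true (hc true)))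

      Kernel-cover : ∀ s {x} → Homogeneous s x → Kernel x → Cover x
      Kernel-cover s hx kx with f-spans s hx kx
      ... | a , _ , (y , z , q) , p = Cover-resp (≈ᴹ-sym (≈ᴹ-trans p (+ᴹ-congˡ q)))
              (Cover-+ (Range⊆Cover (f-range s a)) (Cover-+ (Πₗ-cover y) (AΠ⊆Cover (z , ≈ᴹ-refl))))

      homogeneous-cover : ∀ s {x} → Homogeneous s x → Cover x
      homogeneous-cover s hx with e-spans s hx
      ... | a , k , k∈ , p = Cover-resp (≈ᴹ-sym p) (Cover-+ (Range⊆Cover (e-range s a))
              (Kernel-cover s (Hom.+-cancel∈ (Hom.comb∈ a (e-homogeneous s)) (Hom.≈-resp p hx)) k∈))
        where module Hom = IsSubmodule (homogeneous-isSubmodule s)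

      cover : ∀ x → Cover x
      cover x with homogeneous-decomposition x
      ... | c , hc , p = Cover-resp (≈ᴹ-sym p)
              (Cover-+ (homogeneous-cover false (hc false)) (homogeneous-cover true (hc true)))

    -- Nakayama's lemma is available for π, whereas `cover` leaves an error Πᵣ w. Covering w as well
    -- turns the error into Πᵣ² w′ = πw′.
    param-surjective : FinitelyGeneratedₗ → ∀ x → Range x
    param-surjective (_ , g , generates) = nakayama Range-isSubmodule g
      (λ x → let a , p = generates x in a , 0ᴹ , Range.0∈ , ≈ᴹ-trans p (≈ᴹ-sym (+ᴹ-identityʳ _)))
      step
      where
      step : ∀ z → ∃[ y ] ∃[ s ] Range s × z ≈ᴹ π *ₗ y +ᴹ s
      step z = let r , w , r∈ , p = cover z
                   r′ , w′ , r′∈ , p′ = cover w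
               in w′ , r +ᴹ Πᵣ r′ , Range.+∈ r∈ (Πᵣ-Range r′∈) , (begin
        z                                ≈⟨ p ⟩
        r +ᴹ Πᵣ w                        ≈⟨ +ᴹ-congˡ (≈ᴹ-trans (Πᵣ-cong p′) (Πᵣ-+ _ _)) ⟩
        r +ᴹ (Πᵣ r′ +ᴹ Πᵣ (Πᵣ w′))       ≈⟨ +ᴹ-assoc _ _ _ ⟨
        (r +ᴹ Πᵣ r′) +ᴹ Πᵣ (Πᵣ w′)       ≈⟨ +ᴹ-comm _ _ ⟩
        Πᵣ (Πᵣ w′) +ᴹ (r +ᴹ Πᵣ r′)       ≈⟨ +ᴹ-congʳ (Πᵣ²ₗ w′) ⟩
        π *ₗ w′ +ᴹ (r +ᴹ Πᵣ r′)          ∎)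

    private
      gComb : ∀ s u → Carrierᴹ
      gComb s u = comb (gCoord s false u) (Πₗ ∘ e s)

      gComb≈Πₗ : ∀ s u → gComb s u ≈ᴹ Πₗ (comb (σ ∘ gCoord s false u) (e s))
      gComb≈Πₗ s u = ≈ᴹ-sym (≈ᴹ-trans (comb-Πₗ (σ ∘ gCoord s false u) (e s))
        (comb-cong {y = Πₗ ∘ e s} (λ i → σ-σ (gCoord s false u i)) (λ _ → ≈ᴹ-refl)))

      gComb∈Image : ∀ s u → Image (gComb s u)
      gComb∈Image s u = Image.≈-resp (≈ᴹ-sym (gComb≈Πₗ s u)) (Πₗ∈Image _)

      𝔪-σ : ∀ {a} → 𝔪 (σ a) → 𝔪 a
      𝔪-σ {a} (b , p) = σ b , trans (sym (σ-σ a)) (trans (σ-cong p) (trans (σ-* π b) (*-congʳ σπ≈π)))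

      module _ (u : Std.Carrierᴹ) (h : AΠ (layer false u)) where
        eComb : Bool → Carrierᴹ
        eComb s = comb (eCoord s false u) (e s)

        -- As Πₗ changes the degree, the part of degree `s` combines e and f of degree `s` with Πe
        -- of the other degree.
        component : Bool → Carrierᴹ
        component s = (eComb s +ᴹ gComb (not s) u) +ᴹ fPart s false u

        component-homogeneous : ∀ s → Homogeneous s (component s)
        component-homogeneous s = Hom.+∈ (Hom.+∈ (Hom.comb∈ (eCoord s false u) (e-homogeneous s)) (g-hom s))
                                         (Hom.comb∈ (fCoord s false u) (f-homogeneous s))
          where
          module Hom = IsSubmodule (homogeneous-isSubmodule s)
          g-hom : ∀ s → Homogeneous s (gComb (not s) u)
          g-hom false = IsSubmodule.comb∈ (homogeneous-isSubmodule false) (gCoord true false u)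
            (λ i → Πₗ-homogeneous {true} (e-homogeneous true i))
          g-hom true = IsSubmodule.comb∈ (homogeneous-isSubmodule true) (gCoord false false u)
            (λ i → Πₗ-homogeneous {false} (e-homogeneous false i))

        layer-components : layer false u ≈ᴹ component false +ᴹ component true
        layer-components = ≈ᴹ-trans (interchange _ _ _ _)
          (≈ᴹ-trans (+ᴹ-congʳ (≈ᴹ-trans (+ᴹ-congˡ (+ᴹ-comm _ _))
            (≈ᴹ-trans (interchange _ _ _ _) (+ᴹ-congˡ (+ᴹ-comm _ _)))))
            (interchange _ _ _ _))

        component∈ : ∀ s → AΠ (component s)
        component∈ = AΠ-graded {c = component} component-homogeneous (AΠ.≈-resp layer-components h)

        -- Modulo the kernel the terms in f and Πe disappear, which isolates the e-coefficients.
        -- Once these are known to be in `𝔪`, working modulo the image isolates the f-coefficients.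
        -- What remains is Πₗ of a combination of e's lying in AΠ; that combination is in the
        -- kernel, and independence of the e's applies again, up to σ.
        e-small : ∀ s i → 𝔪 (eCoord s false u i)
        e-small s = e-independent s (eCoord s false u) (Kernel.+-cancel∈
          (Image⊆Kernel (gComb∈Image (not s) u)) (Kernel.≈-resp (+ᴹ-comm _ _)
            (Kernel.+-cancel∈ f∈ (Kernel.≈-resp (+ᴹ-comm _ _) (AΠ⊆Kernel (component∈ s))))))
          where
          f∈ : Kernel (fPart s false u)
          f∈ = Kernel.comb∈ (fCoord s false u) (λ j → f s j , Πₗf≈Πᵣf s j)

        eComb∈ : ∀ s → AΠ (eComb s)
        eComb∈ s = comb-𝔪∈ AΠ-isSubmodule π∈AΠ (e-small s) (e s)

        f-small : ∀ s j → 𝔪 (fCoord s false u j)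
        f-small s = f-independent s (fCoord s false u) (Image.+-cancel∈
          (Image.+∈ (AΠ⊆Image (eComb∈ s)) (gComb∈Image (not s) u)) (AΠ⊆Image (component∈ s)))

        gComb∈ : ∀ s → AΠ (gComb (not s) u)
        gComb∈ s = AΠ.+-cancel∈ (eComb∈ s) (AΠ.+-cancel∈ f∈ (AΠ.≈-resp (+ᴹ-comm _ _) (component∈ s)))
          where
          f∈ : AΠ (fPart s false u)
          f∈ = comb-𝔪∈ AΠ-isSubmodule π∈AΠ (f-small s) (f s)

        g-small : ∀ s → AΠ (gComb s u) → ∀ i → 𝔪 (gCoord s false u i)
        g-small s g∈ i = 𝔪-σ (e-independent s (σ ∘ gCoord s false u) (AΠ.≈-resp (gComb≈Πₗ s u) g∈) i)

        coordinates-small : ∀ s → (∀ i x → 𝔪 (u (ixE s i x false))) × (∀ j → 𝔪 (u (ixF s j false)))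
        coordinates-small s = (λ { i false → e-small s i ; i true → g s i }) , f-small s
          where
          g : ∀ s i → 𝔪 (gCoord s false u i)
          g false = g-small false (gComb∈ true)
          g true  = g-small true (gComb∈ false)

    -- The coordinates of `u` in layer `true` are those of a multiple of Πᵣ as they stand and move
    -- to layer `false` of `v`. Those in layer `false` are multiples of π = Πᵣ², and their quotients
    -- by π become layer `true`.
    param-kernel : ∀ u → AΠ (param u) → ∃[ v ] u Std.≈ᴹ Std.Πᵣ v
    param-kernel u h = v , λ where
        (ixE s i x false) → proj₂ (proj₁ (small s) i x)
        (ixE s i x true)  → sym (*-identityˡ _)
        (ixF s j false)   → proj₂ (proj₂ (small s) j)
        (ixF s j true)    → sym (*-identityˡ _)
      where
      small = coordinates-small u (AΠ.+-cancel∈ (layer true u , ≈ᴹ-refl) (AΠ.≈-resp (+ᴹ-comm _ _) h))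
      v : Std.Carrierᴹ
      v (ixE s i x false) = u (ixE s i x true)
      v (ixE s i x true)  = proj₁ (proj₁ (small s) i x)
      v (ixF s j false)   = u (ixF s j true)
      v (ixF s j true)    = proj₁ (proj₂ (small s) j)

    -- The kernel is divisible by Π on the right, hence zero.
    param-injective : (∀ {x} → Πᵣ x ≈ᴹ 0ᴹ → x ≈ᴹ 0ᴹ) → ∀ u → param u ≈ᴹ 0ᴹ → u Std.≈ᴹ Std.0ᴹ
    param-injective Πᵣ-injective u p b = separated (λ k → let v , _ , q = divisible k in v b , q b)
      where
      divide : ∀ u → param u ≈ᴹ 0ᴹ → ∃[ v ] param v ≈ᴹ 0ᴹ × u Std.≈ᴹ Std.Πᵣ v
      divide u p = let v , q = param-kernel u (AΠ.≈-resp (≈ᴹ-sym p) AΠ.0∈) in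
        v , Πᵣ-injective (≈ᴹ-trans (≈ᴹ-sym (param.Πᵣ-homo v)) (≈ᴹ-trans (param.cong (λ b → sym (q b))) p)) , q
      divisible : ∀ k → ∃[ v ] param v ≈ᴹ 0ᴹ × u Std.≈ᴹ (π ^ k) Std.*ₗ v
      divisible zero    = u , p , λ b → sym (*-identityˡ _)
      -- Two divisions by Πᵣ for one more power of π, since Πᵣ² = π.
      divisible (suc k) =
        let v , pv , q   = divisible k
            v′ , pv′ , q′ = divide v pv
            w , pw , r   = divide v′ pv′
        in w , pw , λ b → trans (q b) (trans
             (*-congˡ (trans (q′ b) (trans (Std.Πᵣ-cong r b) (Std.Πᵣ²ₗ w b))))
             (trans (sym (*-assoc _ _ _)) (*-congʳ (*-comm _ _))))

-- Bimodules and restriction of scalars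

module _ {r ℓr s ℓs m ℓm n ℓn} {R : Ring r ℓr} {S : Ring s ℓs}
         (M : Bimodule R S m ℓm) (N : Bimodule R S n ℓn) where
  private
    module M = Bimodule M
    module N = Bimodule N
    module NP = AbelianGroupProperties N.+ᴹ-abelianGroup

  mkIso : (f : M.Carrierᴹ → N.Carrierᴹ) →
          (∀ {x y} → x M.≈ᴹ y → f x N.≈ᴹ f y) →
          (∀ x y → f (x M.+ᴹ y) N.≈ᴹ f x N.+ᴹ f y) →
          (∀ a x → f (a M.*ₗ x) N.≈ᴹ a N.*ₗ f x) →
          (∀ x b → f (x M.*ᵣ b) N.≈ᴹ f x N.*ᵣ b) →
          (∀ {x y} → f x N.≈ᴹ f y → x M.≈ᴹ y) →
          (∀ y → ∃[ x ] f x N.≈ᴹ y) →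
          M ≅ N
  mkIso f f-cong f-+ f-*ₗ f-*ᵣ injective surjective = f , record
    { isBimoduleMonomorphism = record
      { isBimoduleHomomorphism = record
        { +ᴹ-isGroupHomomorphism = record
          { isMonoidHomomorphism = record
            { isMagmaHomomorphism = record
              { isRelHomomorphism = record { cong = f-cong }
              ; homo = f-+
              }
            ; ε-homo = f-0
            }
          ; ⁻¹-homo = λ x → NP.inverseʳ-unique _ _
              (N.≈ᴹ-trans (N.≈ᴹ-sym (f-+ x (M.-ᴹ x))) (N.≈ᴹ-trans (f-cong (M.-ᴹ‿inverseʳ x)) f-0))
          }
        ; *ₗ-homo = f-*ₗ
        ; *ᵣ-homo = λ b x → f-*ᵣ x b
        }
      ; injective = injective
      }
    ; surjective = λ y → let x , p = surjective y in x , λ q → N.≈ᴹ-trans (f-cong q) p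
    }
    where
    f-0 : f M.0ᴹ N.≈ᴹ N.0ᴹ
    f-0 = NP.identityʳ-unique _ _ (N.≈ᴹ-trans (N.≈ᴹ-sym (f-+ _ _)) (f-cong (M.+ᴹ-identityˡ M.0ᴹ)))

  module Iso (α : M ≅ N) where
    open BimoduleMorphisms M.rawBimodule N.rawBimodule
    open IsBimoduleIsomorphism (proj₂ α) public using (injective; ⟦⟧-cong; +ᴹ-homo; -ᴹ-homo; *ₗ-homo; *ᵣ-homo)

    to : M.Carrierᴹ → N.Carrierᴹ
    to = proj₁ α

    from : N.Carrierᴹ → M.Carrierᴹ
    from y = proj₁ (IsBimoduleIsomorphism.surjective (proj₂ α) y)

    to-from : ∀ y → to (from y) N.≈ᴹ y
    to-from y = proj₂ (IsBimoduleIsomorphism.surjective (proj₂ α) y) M.≈ᴹ-refl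

module _ {r ℓr s ℓs m ℓm : Level} {R : Ring r ℓr} {S : Ring s ℓs} where

  ≅-refl : (M : Bimodule R S m ℓm) → M ≅ M
  ≅-refl M = mkIso M M id id (λ _ _ → refl) (λ _ _ → refl) (λ _ _ → refl) id (λ y → y , refl)
    where
    refl : ∀ {x} → Bimodule._≈ᴹ_ M x x
    refl = Bimodule.≈ᴹ-refl M

  ≅-sym : (M N : Bimodule R S m ℓm) → M ≅ N → N ≅ M
  ≅-sym M N α = mkIso N M from
    (λ p → injective (N.≈ᴹ-trans (to-from _) (N.≈ᴹ-trans p (N.≈ᴹ-sym (to-from _)))))
    (λ x y → injective (N.≈ᴹ-trans (to-from _) (N.≈ᴹ-sym
      (N.≈ᴹ-trans (+ᴹ-homo _ _) (N.+ᴹ-cong (to-from x) (to-from y))))))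
    (λ a x → injective (N.≈ᴹ-trans (to-from _) (N.≈ᴹ-sym
      (N.≈ᴹ-trans (*ₗ-homo a _) (N.*ₗ-cong (Ring.refl R) (to-from x))))))
    (λ x b → injective (N.≈ᴹ-trans (to-from _) (N.≈ᴹ-sym
      (N.≈ᴹ-trans (*ᵣ-homo b _) (N.*ᵣ-cong (to-from x) (Ring.refl S))))))
    (λ p → N.≈ᴹ-trans (N.≈ᴹ-sym (to-from _)) (N.≈ᴹ-trans (⟦⟧-cong p) (to-from _)))
    (λ x → to x , injective (to-from (to x)))
    where
    module N = Bimodule N
    open Iso M N α

  ≅-trans : (M N P : Bimodule R S m ℓm) → M ≅ N → N ≅ P → M ≅ P
  ≅-trans M N P α β = mkIso M P (β.to ∘ α.to)
    (λ p → β.⟦⟧-cong (α.⟦⟧-cong p))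
    (λ x y → P.≈ᴹ-trans (β.⟦⟧-cong (α.+ᴹ-homo x y)) (β.+ᴹ-homo _ _))
    (λ a x → P.≈ᴹ-trans (β.⟦⟧-cong (α.*ₗ-homo a x)) (β.*ₗ-homo a _))
    (λ x b → P.≈ᴹ-trans (β.⟦⟧-cong (α.*ᵣ-homo b x)) (β.*ᵣ-homo b _))
    (λ p → α.injective (β.injective p))
    (λ z → α.from (β.from z) , P.≈ᴹ-trans (β.⟦⟧-cong (α.to-from _)) (β.to-from z))
    where
    module P = Bimodule P
    module α = Iso M N α
    module β = Iso N P β

  ≅-isEquivalence : IsEquivalence (λ (M N : Bimodule R S m ℓm) → M ≅ N)
  ≅-isEquivalence = record
    { refl  = λ {M} → ≅-refl M
    ; sym   = λ {M} {N} → ≅-sym M N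
    ; trans = λ {M} {N} {P} → ≅-trans M N P
    }

module _ {r ℓr s ℓs r′ ℓr′ s′ ℓs′ m ℓm : Level}
         {R : Ring r ℓr} {S : Ring s ℓs} {R′ : Ring r′ ℓr′} {S′ : Ring s′ ℓs′} where
  private
    module R = Ring R
    module S = Ring S
    module R′ = Ring R′
    module S′ = Ring S′

  restrict : {f : R′.Carrier → R.Carrier} → IsRingHom R′ R f →
             {g : S′.Carrier → S.Carrier} → IsRingHom S′ S g →
             Bimodule R S m ℓm → Bimodule R′ S′ m ℓm
  restrict {f} f-isHom {g} g-isHom M = record
    { Carrierᴹ = Carrierᴹ ; _≈ᴹ_ = _≈ᴹ_ ; _+ᴹ_ = _+ᴹ_
    ; _*ₗ_ = λ a x → f a *ₗ x ; _*ᵣ_ = λ x b → x *ᵣ g b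
    ; 0ᴹ = 0ᴹ ; -ᴹ_ = -ᴹ_
    ; isBimodule = record
      { isBisemimodule = record
        { +ᴹ-isCommutativeMonoid = +ᴹ-isCommutativeMonoid
        ; isPreleftSemimodule = record
          { *ₗ-cong = λ p q → *ₗ-cong (f.⟦⟧-cong p) q
          ; *ₗ-zeroˡ = λ x → ≈ᴹ-trans (*ₗ-cong f.0#-homo ≈ᴹ-refl) (*ₗ-zeroˡ x)
          ; *ₗ-distribʳ = λ x a b → ≈ᴹ-trans (*ₗ-cong (f.+-homo a b) ≈ᴹ-refl) (*ₗ-distribʳ x _ _)
          ; *ₗ-identityˡ = λ x → ≈ᴹ-trans (*ₗ-cong f.1#-homo ≈ᴹ-refl) (*ₗ-identityˡ x)
          ; *ₗ-assoc = λ a b x → ≈ᴹ-trans (*ₗ-cong (f.*-homo a b) ≈ᴹ-refl) (*ₗ-assoc _ _ x)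
          ; *ₗ-zeroʳ = λ a → *ₗ-zeroʳ (f a)
          ; *ₗ-distribˡ = λ a x y → *ₗ-distribˡ (f a) x y
          }
        ; isPrerightSemimodule = record
          { *ᵣ-cong = λ p q → *ᵣ-cong p (g.⟦⟧-cong q)
          ; *ᵣ-zeroʳ = λ x → ≈ᴹ-trans (*ᵣ-cong ≈ᴹ-refl g.0#-homo) (*ᵣ-zeroʳ x)
          ; *ᵣ-distribˡ = λ x a b → ≈ᴹ-trans (*ᵣ-cong ≈ᴹ-refl (g.+-homo a b)) (*ᵣ-distribˡ x _ _)
          ; *ᵣ-identityʳ = λ x → ≈ᴹ-trans (*ᵣ-cong ≈ᴹ-refl g.1#-homo) (*ᵣ-identityʳ x)
          ; *ᵣ-assoc = λ x a b → ≈ᴹ-trans (*ᵣ-assoc x _ _) (*ᵣ-cong ≈ᴹ-refl (S.sym (g.*-homo a b)))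
          ; *ᵣ-zeroˡ = λ b → *ᵣ-zeroˡ (g b)
          ; *ᵣ-distribʳ = λ b x y → *ᵣ-distribʳ (g b) x y
          }
        ; *ₗ-*ᵣ-assoc = λ a x b → *ₗ-*ᵣ-assoc (f a) x (g b)
        }
      ; -ᴹ‿cong = -ᴹ‿cong
      ; -ᴹ‿inverse = -ᴹ‿inverse
      }
    }
    where
    open Bimodule M
    module f = RingMorphisms.IsRingHomomorphism f-isHom
    module g = RingMorphisms.IsRingHomomorphism g-isHom

flip-sides : ∀ {r ℓr m ℓm} (R : CommutativeRing r ℓr) →
             Bimodule (CommutativeRing.ring R) (CommutativeRing.ring R) m ℓm →
             Bimodule (CommutativeRing.ring R) (CommutativeRing.ring R) m ℓm
flip-sides R M = record
  { Carrierᴹ = Carrierᴹ ; _≈ᴹ_ = _≈ᴹ_ ; _+ᴹ_ = _+ᴹ_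
  ; _*ₗ_ = λ a x → x *ᵣ a ; _*ᵣ_ = λ x a → a *ₗ x
  ; 0ᴹ = 0ᴹ ; -ᴹ_ = -ᴹ_
  ; isBimodule = record
    { isBisemimodule = record
      { +ᴹ-isCommutativeMonoid = +ᴹ-isCommutativeMonoid
      ; isPreleftSemimodule = record
        { *ₗ-cong = λ p q → *ᵣ-cong q p
        ; *ₗ-zeroˡ = *ᵣ-zeroʳ
        ; *ₗ-distribʳ = *ᵣ-distribˡ
        ; *ₗ-identityˡ = *ᵣ-identityʳ
        ; *ₗ-assoc = λ a b x → ≈ᴹ-trans (*ᵣ-cong ≈ᴹ-refl (R.*-comm a b)) (≈ᴹ-sym (*ᵣ-assoc x b a))
        ; *ₗ-zeroʳ = *ᵣ-zeroˡ
        ; *ₗ-distribˡ = *ᵣ-distribʳ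
        }
      ; isPrerightSemimodule = record
        { *ᵣ-cong = λ p q → *ₗ-cong q p
        ; *ᵣ-zeroʳ = *ₗ-zeroˡ
        ; *ᵣ-distribˡ = *ₗ-distribʳ
        ; *ᵣ-identityʳ = *ₗ-identityˡ
        ; *ᵣ-assoc = λ x a b → ≈ᴹ-trans (≈ᴹ-sym (*ₗ-assoc b a x)) (*ₗ-cong (R.*-comm b a) ≈ᴹ-refl)
        ; *ᵣ-zeroˡ = *ₗ-zeroʳ
        ; *ᵣ-distribʳ = *ₗ-distribˡ
        }
      ; *ₗ-*ᵣ-assoc = λ a x b → ≈ᴹ-sym (*ₗ-*ᵣ-assoc b x a)
      }
    ; -ᴹ‿cong = -ᴹ‿cong
    ; -ᴹ‿inverse = -ᴹ‿inverse
    }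
  }
  where
  open Bimodule M
  module R = CommutativeRing R

-- Exchange of the two sides, generation, and comparison of bases

module _ {ℓ} {𝒦 : UnramifiedInvolution ℓ} where
  open UnramifiedInvolution 𝒦

  -- The axioms are symmetric: Πᵣ is σ-semilinear for the right action and linear for the left one,
  -- the mirror image of Πₗ.
  swap : Π-Bimodule 𝒦 → Π-Bimodule 𝒦
  swap A = record
    { bimodule = flip-sides commutativeRing bimodule
    ; Πₗ = Πᵣ ; Πᵣ = Πₗ
    ; Πₗ-cong = Πᵣ-cong ; Πᵣ-cong = Πₗ-cong
    ; Πₗ-+ = Πᵣ-+ ; Πᵣ-+ = Πₗ-+
    ; Πₗ-*ₗ = λ a x → Πᵣ-*ᵣ x a
    ; Πᵣ-*ₗ = λ a x → Πₗ-*ᵣ x a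
    ; Πₗ-*ᵣ = λ x a → Πᵣ-*ₗ a x
    ; Πᵣ-*ᵣ = λ x a → Πₗ-*ₗ a x
    ; Πₗ-Πᵣ = λ x → ≈ᴹ-sym (Πₗ-Πᵣ x)
    ; Πₗ² = Πᵣ²
    ; Πᵣ² = Πₗ²
    ; fixed-central = λ p x → ≈ᴹ-sym (fixed-central p x)
    }
    where open Π-Bimodule A

  unswapHom : ∀ {A B} → Π-Hom 𝒦 A (swap B) → Π-Hom 𝒦 (swap A) B
  unswapHom h = record
    { fun = fun ; cong = cong ; +-homo = +-homo
    ; *ₗ-homo = λ a x → *ᵣ-homo x a ; *ᵣ-homo = λ x a → *ₗ-homo a x
    ; Πₗ-homo = Πᵣ-homo ; Πᵣ-homo = Πₗ-homo
    }
    where open Π-Hom h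

  record IsStable (A : Π-Bimodule 𝒦) (S : Pred (Π-Bimodule.Carrierᴹ A) ℓ) : Set ℓ where
    open Π-Bimodule A
    field
      ≈-resp : ∀ {x y} → x ≈ᴹ y → S x → S y
      0∈   : S 0ᴹ
      +∈   : ∀ {x y} → S x → S y → S (x +ᴹ y)
      *ₗ∈  : ∀ a {x} → S x → S (a *ₗ x)
      *ᵣ∈  : ∀ a {x} → S x → S (x *ᵣ a)
      Πₗ∈  : ∀ {x} → S x → S (Πₗ x)
      Πᵣ∈  : ∀ {x} → S x → S (Πᵣ x)

  -- Generation as an induction principle over stable predicates. It follows from `Span` over O_B
  -- and over its quotients alike, holds for the standard bimodule by a direct argument, and is
  -- visibly invariant under `swap`.
  Generates : (A : Π-Bimodule 𝒦) → ∀ {n} → Vector (Π-Bimodule.Carrierᴹ A) n → Set (Level.suc ℓ)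
  Generates A g = ∀ {S} → IsStable A S → (∀ i → S (g i)) → ∀ x → S x

  swap-generates : ∀ {A n} {g : Vector (Π-Bimodule.Carrierᴹ A) n} → Generates A g → Generates (swap A) g
  swap-generates generates stable = generates record
    { ≈-resp = ≈-resp ; 0∈ = 0∈ ; +∈ = +∈ ; *ₗ∈ = *ᵣ∈ ; *ᵣ∈ = *ₗ∈ ; Πₗ∈ = Πᵣ∈ ; Πᵣ∈ = Πₗ∈ }
    where open IsStable stable

  module _ (A : Π-Bimodule 𝒦) where
    open Π-Bimodule A
    open LinearAlgebra leftModule
    open Grading 𝒦 A
    open Filtration 𝒦 A

    private
      Zero : Pred Carrierᴹ ℓ
      Zero x = x ≈ᴹ 0ᴹ

      Zero-isSubmodule : IsSubmodule Zero
      Zero-isSubmodule = record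
        { ≈-resp = λ p q → ≈ᴹ-trans (≈ᴹ-sym p) q
        ; 0∈ = ≈ᴹ-refl
        ; +∈ = λ p q → ≈ᴹ-trans (+ᴹ-cong p q) (+ᴹ-identityˡ 0ᴹ)
        ; *∈ = λ a p → ≈ᴹ-trans (*ₗ-cong refl p) (*ₗ-zeroʳ a)
        }

      Spanned : ∀ {k} → Vector Carrierᴹ k → Pred Carrierᴹ ℓ
      Spanned x = Adjoin x Zero

      Spanned-isSubmodule : ∀ {k} (x : Vector Carrierᴹ k) → IsSubmodule (Spanned x)
      Spanned-isSubmodule = Adjoin-isSubmodule Zero-isSubmodule

      Spanned-least : ∀ {k S} {x : Vector Carrierᴹ k} → IsSubmodule S → (∀ i → S (x i)) → Spanned x ⊆ S
      Spanned-least S-isSub = Adjoin-least Zero-isSubmodule S-isSub (λ p → S.≈-resp (≈ᴹ-sym p) S.0∈)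
        where module S = IsSubmodule S-isSub

      ∈Spanned : ∀ {k} (x : Vector Carrierᴹ k) i → Spanned x (x i)
      ∈Spanned = ∈Adjoin Zero-isSubmodule

      ++-All : ∀ {p} (P : Pred Carrierᴹ p) {k l} (x : Vector Carrierᴹ k) (y : Vector Carrierᴹ l) →
               (∀ i → P (x i)) → (∀ j → P (y j)) → ∀ i → P ((x ++ y) i)
      ++-All P {k} x y p q i with splitAt k i
      ... | inj₁ j = p j
      ... | inj₂ j = q j

      ∈Spanned-++ˡ : ∀ {k l} (x : Vector Carrierᴹ k) (y : Vector Carrierᴹ l) i → Spanned (x ++ y) (x i)
      ∈Spanned-++ˡ {l = l} x y i = ≡.subst (Spanned (x ++ y)) (lookup-++ˡ x y i) (∈Spanned (x ++ y) (i ↑ˡ l))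

      ∈Spanned-++ʳ : ∀ {k l} (x : Vector Carrierᴹ k) (y : Vector Carrierᴹ l) i → Spanned (x ++ y) (y i)
      ∈Spanned-++ʳ {k} x y i = ≡.subst (Spanned (x ++ y)) (lookup-++ʳ x y i) (∈Spanned (x ++ y) (k ↑ʳ i))

      preimage-Πₗ : ∀ {S} → IsSubmodule S → IsSubmodule (λ z → S (Πₗ z))
      preimage-Πₗ S-isSub = record
        { ≈-resp = λ p → S.≈-resp (Πₗ-cong p)
        ; 0∈ = S.≈-resp (≈ᴹ-sym Πₗ-0) S.0∈
        ; +∈ = λ p q → S.≈-resp (≈ᴹ-sym (Πₗ-+ _ _)) (S.+∈ p q)
        ; *∈ = λ a p → S.≈-resp (≈ᴹ-sym (Πₗ-*ₗ a _)) (S.*∈ (σ a) p)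
        }
        where module S = IsSubmodule S-isSub

      preimage-Πᵣ : ∀ {S} → IsSubmodule S → IsSubmodule (λ z → S (Πᵣ z))
      preimage-Πᵣ S-isSub = record
        { ≈-resp = λ p → S.≈-resp (Πᵣ-cong p)
        ; 0∈ = S.≈-resp (≈ᴹ-sym Πᵣ-0) S.0∈
        ; +∈ = λ p q → S.≈-resp (≈ᴹ-sym (Πᵣ-+ _ _)) (S.+∈ p q)
        ; *∈ = λ a p → S.≈-resp (≈ᴹ-sym (Πᵣ-*ₗ a _)) (S.*∈ a p)
        }
        where module S = IsSubmodule S-isSub

      preimage-*ᵣ : ∀ {S} → IsSubmodule S → ∀ c → IsSubmodule (λ z → S (z *ᵣ c))
      preimage-*ᵣ S-isSub c = record
        { ≈-resp = λ p → S.≈-resp (*ᵣ-cong p refl)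
        ; 0∈ = S.≈-resp (≈ᴹ-sym (*ᵣ-zeroˡ c)) S.0∈
        ; +∈ = λ p q → S.≈-resp (≈ᴹ-sym (*ᵣ-distribʳ c _ _)) (S.+∈ p q)
        ; *∈ = λ a p → S.≈-resp (≈ᴹ-sym (*ₗ-*ᵣ-assoc a _ c)) (S.*∈ a p)
        }
        where module S = IsSubmodule S-isSub

      spanned-stable : ∀ {k} (x : Vector Carrierᴹ k) → (∀ i → ∃[ s ] Homogeneous s (x i)) →
                       (∀ i → Spanned x (Πₗ (x i))) → (∀ i → Spanned x (Πᵣ (x i))) →
                       IsStable A (Spanned x)
      spanned-stable x hom left right = record
        { ≈-resp = X.≈-resp ; 0∈ = X.0∈ ; +∈ = X.+∈ ; *ₗ∈ = X.*∈
        ; *ᵣ∈ = λ c → Spanned-least (preimage-*ᵣ X-isSub c)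
            (λ i → X.≈-resp (≈ᴹ-sym (proj₂ (hom i) c)) (X.*∈ _ (∈Spanned x i)))
        ; Πₗ∈ = Spanned-least (preimage-Πₗ X-isSub) left
        ; Πᵣ∈ = Spanned-least (preimage-Πᵣ X-isSub) right
        }
        where
        X-isSub = Spanned-isSubmodule x
        module X = IsSubmodule X-isSub

    -- On the homogeneous components of the generators, right scalars act through left ones. Their
    -- multiples by 1, Πₗ, Πᵣ and ΠᵣΠₗ therefore span a stable left O_K-submodule, the squares of Πₗ
    -- and Πᵣ being scalars.
    generates⇒finitelyGeneratedₗ : ∀ {n} (g : Vector Carrierᴹ n) → Generates A g → FinitelyGeneratedₗ
    generates⇒finitelyGeneratedₗ {n} g generates = _ , g₂ , λ x →
      let a , z , z≈0 , p = generates stable g∈ x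
      in a , ≈ᴹ-trans p (≈ᴹ-trans (+ᴹ-congˡ z≈0) (+ᴹ-identityʳ _))
      where
      c : Bool → Vector Carrierᴹ n
      c s i = proj₁ (homogeneous-decomposition (g i)) s

      g₀ : Vector Carrierᴹ (n ℕ.+ n)
      g₀ = c false ++ c true

      g₁ : Vector Carrierᴹ ((n ℕ.+ n) ℕ.+ (n ℕ.+ n))
      g₁ = g₀ ++ (Πₗ ∘ g₀)

      g₂ : Vector Carrierᴹ (((n ℕ.+ n) ℕ.+ (n ℕ.+ n)) ℕ.+ ((n ℕ.+ n) ℕ.+ (n ℕ.+ n)))
      g₂ = g₁ ++ (Πᵣ ∘ g₁)

      IsHom : Pred Carrierᴹ ℓ
      IsHom x = ∃[ s ] Homogeneous s x

      g₀-hom : ∀ i → IsHom (g₀ i)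
      g₀-hom = ++-All IsHom (c false) (c true) (λ i → false , proj₁ (proj₂ (homogeneous-decomposition (g i))) false)
                      (λ i → true , proj₁ (proj₂ (homogeneous-decomposition (g i))) true)

      g₁-hom : ∀ i → IsHom (g₁ i)
      g₁-hom = ++-All IsHom g₀ (Πₗ ∘ g₀) g₀-hom
        (λ i → let s , h = g₀-hom i in not s , Πₗ-homogeneous {s} h)

      g₂-hom : ∀ i → IsHom (g₂ i)
      g₂-hom = ++-All IsHom g₁ (Πᵣ ∘ g₁) g₁-hom
        (λ i → let s , h = g₁-hom i in not s , Πᵣ-homogeneous {s} h)

      module S₁ = IsSubmodule (Spanned-isSubmodule g₁)
      module S₂ = IsSubmodule (Spanned-isSubmodule g₂)

      g₁-Πₗ : ∀ i → Spanned g₁ (Πₗ (g₁ i))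
      g₁-Πₗ = ++-All (λ z → Spanned g₁ (Πₗ z)) g₀ (Πₗ ∘ g₀) (∈Spanned-++ʳ g₀ (Πₗ ∘ g₀))
        (λ i → S₁.≈-resp (≈ᴹ-sym (Πₗ² (g₀ i))) (S₁.*∈ π (∈Spanned-++ˡ g₀ (Πₗ ∘ g₀) i)))

      Spanned₁⊆Spanned₂ : Spanned g₁ ⊆ Spanned g₂
      Spanned₁⊆Spanned₂ = Spanned-least (Spanned-isSubmodule g₂) (∈Spanned-++ˡ g₁ (Πᵣ ∘ g₁))

      Πᵣ-Spanned₁ : ∀ {z} → Spanned g₁ z → Spanned g₂ (Πᵣ z)
      Πᵣ-Spanned₁ = Spanned-least (preimage-Πᵣ (Spanned-isSubmodule g₂)) (∈Spanned-++ʳ g₁ (Πᵣ ∘ g₁))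

      stable : IsStable A (Spanned g₂)
      stable = spanned-stable g₂ g₂-hom
        (++-All (λ z → Spanned g₂ (Πₗ z)) g₁ (Πᵣ ∘ g₁)
          (λ i → Spanned₁⊆Spanned₂ (g₁-Πₗ i))
          (λ i → S₂.≈-resp (≈ᴹ-sym (Πₗ-Πᵣ (g₁ i))) (Πᵣ-Spanned₁ (g₁-Πₗ i))))
        (++-All (λ z → Spanned g₂ (Πᵣ z)) g₁ (Πᵣ ∘ g₁)
          (∈Spanned-++ʳ g₁ (Πᵣ ∘ g₁))
          (λ i → S₂.≈-resp (≈ᴹ-sym (Πᵣ²ₗ (g₁ i))) (S₂.*∈ π (∈Spanned-++ˡ g₁ (Πᵣ ∘ g₁) i))))

      g∈ : ∀ i → Spanned g₂ (g i)
      g∈ i = Spanned₁⊆Spanned₂ (Spanned-least (Spanned-isSubmodule g₁) (∈Spanned-++ˡ g₀ (Πₗ ∘ g₀))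
        (S₀.≈-resp (≈ᴹ-sym (proj₂ (proj₂ (homogeneous-decomposition (g i)))))
          (S₀.+∈ (∈Spanned-++ˡ (c false) (c true) i) (∈Spanned-++ʳ (c false) (c true) i))))
        where module S₀ = IsSubmodule (Spanned-isSubmodule g₀)

  module _ {m n : ℕ × ℕ} where
    private module Std = Π-Bimodule (standard 𝒦 m n)

    infix 4 _≟_
    _≟_ : DecidableEquality (Index 𝒦 m n)
    ixE false i x y ≟ ixE false i′ x′ y′ = map′ (λ { (≡.refl , ≡.refl , ≡.refl) → ≡.refl }) (λ { ≡.refl → ≡.refl , ≡.refl , ≡.refl })
                                         (i Fin.≟ i′ ×-dec x Bool.≟ x′ ×-dec y Bool.≟ y′)
    ixE true  i x y ≟ ixE true  i′ x′ y′ = map′ (λ { (≡.refl , ≡.refl , ≡.refl) → ≡.refl }) (λ { ≡.refl → ≡.refl , ≡.refl , ≡.refl })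
                                         (i Fin.≟ i′ ×-dec x Bool.≟ x′ ×-dec y Bool.≟ y′)
    ixF false j y   ≟ ixF false j′ y′    = map′ (λ { (≡.refl , ≡.refl) → ≡.refl }) (λ { ≡.refl → ≡.refl , ≡.refl })
                                         (j Fin.≟ j′ ×-dec y Bool.≟ y′)
    ixF true  j y   ≟ ixF true  j′ y′    = map′ (λ { (≡.refl , ≡.refl) → ≡.refl }) (λ { ≡.refl → ≡.refl , ≡.refl })
                                         (j Fin.≟ j′ ×-dec y Bool.≟ y′)
    ixE false _ _ _ ≟ ixE true _ _ _  = no λ ()
    ixE true _ _ _  ≟ ixE false _ _ _ = no λ ()
    ixF false _ _   ≟ ixF true _ _    = no λ ()
    ixF true _ _    ≟ ixF false _ _   = no λ ()
    ixE _ _ _ _     ≟ ixF _ _ _       = no λ ()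
    ixF _ _ _       ≟ ixE _ _ _ _     = no λ ()

    private
      bools : List Bool
      bools = false List.∷ true List.∷ List.[]

      ∈bools : ∀ x → x ∈ bools
      ∈bools false = here ≡.refl
      ∈bools true  = there (here ≡.refl)

      ixE′ : ∀ s → Fin (at m s) → Bool × Bool → Index 𝒦 m n
      ixE′ s i (x , y) = ixE s i x y

      indicesE indicesF indicesEF : Bool → List (Index 𝒦 m n)
      indicesE s = List.cartesianProductWith (ixE′ s)
                     (List.allFin (at m s)) (List.cartesianProduct bools bools)
      indicesF s = List.cartesianProductWith (ixF s) (List.allFin (at n s)) bools
      indicesEF s = indicesE s List.++ indicesF s

      indices : List (Index 𝒦 m n)
      indices = List.concatMap indicesEF bools

      ∈indices : ∀ b → b ∈ indices
      ∈indices (ixE s i x y) = ∈.∈-concatMap⁺ indicesEF (Any.map (λ { ≡.refl → ∈.∈-++⁺ˡ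
        (∈.∈-cartesianProductWith⁺ (ixE′ s) (∈.∈-allFin i) (∈.∈-cartesianProduct⁺ (∈bools x) (∈bools y))) }) (∈bools s))
      ∈indices (ixF s j y) = ∈.∈-concatMap⁺ indicesEF (Any.map (λ { ≡.refl → ∈.∈-++⁺ʳ (indicesE s)
        (∈.∈-cartesianProductWith⁺ (ixF s) (∈.∈-allFin j) (∈bools y)) }) (∈bools s))

    indicator : Index 𝒦 m n → Std.Carrierᴹ
    indicator b b′ with b ≟ b′
    ... | yes _ = 1#
    ... | no  _ = 0#

    standard-generators : Vector Std.Carrierᴹ (List.length indices)
    standard-generators = indicator ∘ List.lookup indices

    -- The index type is finite only through the list `indices`. Along this list one coordinate at a
    -- time is split off as a multiple of an indicator and erased, until nothing is left.
    standard-generates : Generates (standard 𝒦 m n) standard-generators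
    standard-generates {S} stable gens∈ u = go indices u (λ b b∉ → contradiction (∈indices b) b∉)
      where
      open IsStable stable
      indicator∈ : ∀ b → S (indicator b)
      indicator∈ b = ≡.subst (S ∘ indicator) (≡.sym (Any.lookup-index (∈indices b))) (gens∈ (Any.index (∈indices b)))
      erase : Index 𝒦 m n → Std.Carrierᴹ → Std.Carrierᴹ
      erase b u b′ with b ≟ b′
      ... | yes _ = 0#
      ... | no  _ = u b′
      erase-+ : ∀ b u → (u b Std.*ₗ indicator b) Std.+ᴹ erase b u Std.≈ᴹ u
      erase-+ b u b′ with b ≟ b′
      ... | yes ≡.refl = trans (+-identityʳ _) (*-identityʳ _)
      ... | no  _      = trans (+-congʳ (zeroʳ _)) (+-identityˡ _)
      go : ∀ bs u → (∀ b → ¬ b ∈ bs → u b ≈ 0#) → S u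
      go List.[]       u supp = ≈-resp (λ b → sym (supp b λ ())) 0∈
      go (b List.∷ bs) u supp = ≈-resp (erase-+ b u) (+∈ (*ₗ∈ (u b) (indicator∈ b)) (go bs (erase b u) supp′))
        where
        supp′ : ∀ b′ → ¬ b′ ∈ bs → erase b u b′ ≈ 0#
        supp′ b′ b′∉ with b ≟ b′
        ... | yes _  = refl
        ... | no b≢b′ = supp b′ λ { (here p) → b≢b′ (≡.sym p) ; (there p) → b′∉ p }

  HasBasis : Π-Bimodule 𝒦 → ℕ × ℕ → ℕ × ℕ → Set ℓ
  HasBasis A = Filtration.AdaptedBasis 𝒦 A

  RightInjective : Π-Bimodule 𝒦 → Set ℓ
  RightInjective A = ∀ {x} → Πᵣ x ≈ᴹ 0ᴹ → x ≈ᴹ 0ᴹ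
    where open Π-Bimodule A

  RightKilled : Π-Bimodule 𝒦 → Set ℓ
  RightKilled A = ∀ x → Πᵣ x ≈ᴹ 0ᴹ
    where open Π-Bimodule A

  module _ (em : ExcludedMiddle ℓ) {A : Π-Bimodule 𝒦} {k} {g : Vector (Π-Bimodule.Carrierᴹ A) k} (generates : Generates A g) where
    open Π-Bimodule A
    private
      open Filtration 𝒦 A using (adaptedBasis; balanced-torsionFree; balanced-killed)

      fg = generates⇒finitelyGeneratedₗ A g generates

    injective⇒basis : RightInjective A → ∃[ m ] ∃[ n ] HasBasis A m n
    injective⇒basis inj = adaptedBasis em fg (balanced-torsionFree inj)

    killed⇒basis : RightKilled A → ∃[ m ] ∃[ n ] HasBasis A m n
    killed⇒basis killed = adaptedBasis em fg (balanced-killed killed)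

    module _ {m n} (basis : HasBasis A m n) where
      open Parametrization 𝒦 A basis using (paramHom; param; param-surjective; param-kernel; param-injective)
      private
        module Std = Π-Bimodule (standard 𝒦 m n)
        module param = Π-Hom paramHom

      basis⇒surjective : ∀ y → ∃[ u ] param u ≈ᴹ y
      basis⇒surjective y = let u , e = param-surjective fg y in u , ≈ᴹ-sym e

      param-difference : ∀ u v → param u ≈ᴹ param v → param (u Std.+ᴹ Std.-ᴹ v) ≈ᴹ 0ᴹ
      param-difference u v e = ≈ᴹ-trans (param.+-homo u (Std.-ᴹ v)) (≈ᴹ-trans (+ᴹ-congʳ e)
        (≈ᴹ-trans (≈ᴹ-sym (param.+-homo v (Std.-ᴹ v))) (≈ᴹ-trans (param.cong (Std.-ᴹ‿inverseʳ v)) param.0-homo)))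

      basis⇒injective : RightInjective A → ∀ u v → param u ≈ᴹ param v → u Std.≈ᴹ v
      basis⇒injective inj u v e b = RingProperties.x∙y⁻¹≈ε⇒x≈y ring (u b) (v b)
        (param-injective inj (u Std.+ᴹ Std.-ᴹ v) (param-difference u v e) b)

      basis⇒kernel : ∀ u v → param u ≈ᴹ param v → ∃[ w ] (u Std.+ᴹ Std.-ᴹ v) Std.≈ᴹ Std.Πᵣ w
      basis⇒kernel u v e = param-kernel (u Std.+ᴹ Std.-ᴹ v)
        (0ᴹ , ≈ᴹ-trans (param-difference u v e) (≈ᴹ-sym (Filtration.Πᵣ-0 𝒦 A)))

  Reduction : ∀ {A C : Π-Bimodule 𝒦} → Π-Hom 𝒦 A C → Set ℓ
  Reduction {A} {C} h = (∀ y → ∃[ x ] fun x C.≈ᴹ y) ×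
                        (∀ {x y} → fun x C.≈ᴹ fun y → ∃[ z ] x A.≈ᴹ y A.+ᴹ A.Πᵣ z)
    where
    open Π-Hom h
    module A = Π-Bimodule A
    module C = Π-Bimodule C

  -- Both bases are carried to the common reduction `C`, where `adaptedBasis-unique` compares their
  -- sizes.
  commonBasis : ∀ {A A′ C : Π-Bimodule 𝒦} (h : Π-Hom 𝒦 A C) (h′ : Π-Hom 𝒦 A′ C) →
                Reduction h → Reduction h′ →
                ∃[ m ] ∃[ n ] HasBasis A m n → ∃[ m ] ∃[ n ] HasBasis A′ m n →
                ∃[ m ] ∃[ n ] HasBasis A m n × HasBasis A′ m n
  commonBasis {A} {A′} {C} h h′ (surj , ker) (surj′ , ker′) (m , n , b) (m′ , n′ , b′) =
    m , n , b , ≡.subst₂ (HasBasis A′) (≡.sym (proj₁ sizes)) (≡.sym (proj₂ sizes)) b′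
    where
    sizes : m ≡ m′ × n ≡ n′
    sizes = Filtration.adaptedBasis-unique 𝒦 C
      (λ s → degreeBasis-map 𝒦 h surj ker (b s)) (λ s → degreeBasis-map 𝒦 h′ surj′ ker′ (b′ s))

-- Local fields and the unramified extension

module _ {r ℓr s ℓs} (R : Ring r ℓr) (S : Ring s ℓs) (f : Ring.Carrier R → Ring.Carrier S) where
  private
    module R = Ring R
    module S = Ring S

  mkRingHom : (∀ {x y} → x R.≈ y → f x S.≈ f y) →
              (∀ x y → f (x R.+ y) S.≈ f x S.+ f y) → f R.0# S.≈ S.0# →
              (∀ x y → f (x R.* y) S.≈ f x S.* f y) → f R.1# S.≈ S.1# →
              (∀ x → f (R.- x) S.≈ S.- f x) → IsRingHom R S f
  mkRingHom f-cong f-+ f-0 f-* f-1 f-neg = record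
    { isSemiringHomomorphism = record
      { isNearSemiringHomomorphism = record
        { +-isMonoidHomomorphism = record
          { isMagmaHomomorphism = record { isRelHomomorphism = record { cong = f-cong } ; homo = f-+ }
          ; ε-homo = f-0
          }
        ; *-homo = f-*
        }
      ; 1#-homo = f-1
      }
    ; -‿homo = f-neg
    }

Fin-injective⇒surjective : ∀ {n} (f : Fin n → Fin n) → (∀ {i j} → f i ≡ f j → i ≡ j) →
                           ∀ k → ∃[ i ] f i ≡ k
Fin-injective⇒surjective {suc n} f f-inj k with Fin.any? (λ i → f i Fin.≟ k)
... | yes p = p
... | no  ∄ = contradiction (Fin.injective⇒≤ {f = λ i → punchOut (k≢f i)}
                (λ {i} {j} e → f-inj (Fin.punchOut-injective (k≢f i) (k≢f j) e))) (ℕ.<⇒≱ ℕ.≤-refl)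
  where
  k≢f : ∀ i → ¬ k ≡ f i
  k≢f i e = ∄ (i , ≡.sym e)

module Valuation {ℓ} (K : DiscretelyValuedField ℓ) where
  open DiscretelyValuedField K
  open RingProperties ring using (⁻¹-anti-homo‿-)
  open SetoidReasoning setoid

  *-cancel-0 : ∀ {a b} → ¬ a ≈ 0# → a * b ≈ 0# → b ≈ 0#
  *-cancel-0 {a} {b} a≉0 ab≈0 = let a⁻¹ , _ , a⁻¹a≈1 = inverse a a≉0 in begin
    b                ≈⟨ *-identityˡ b ⟨
    1# * b           ≈⟨ *-congʳ a⁻¹a≈1 ⟨
    (a⁻¹ * a) * b    ≈⟨ *-assoc _ _ _ ⟩
    a⁻¹ * (a * b)    ≈⟨ *-congˡ ab≈0 ⟩
    a⁻¹ * 0#         ≈⟨ zeroʳ _ ⟩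
    0#               ∎

  *-cancelˡ-≉0 : ∀ {a b c} → ¬ a ≈ 0# → a * b ≈ a * c → b ≈ c
  *-cancelˡ-≉0 {a} {b} {c} a≉0 e = let a⁻¹ , _ , a⁻¹a≈1 = inverse a a≉0 in begin
    b                ≈⟨ *-identityˡ b ⟨
    1# * b           ≈⟨ *-congʳ a⁻¹a≈1 ⟨
    (a⁻¹ * a) * b    ≈⟨ *-assoc _ _ _ ⟩
    a⁻¹ * (a * b)    ≈⟨ *-congˡ e ⟩
    a⁻¹ * (a * c)    ≈⟨ *-assoc _ _ _ ⟨
    (a⁻¹ * a) * c    ≈⟨ *-congʳ a⁻¹a≈1 ⟩
    1# * c           ≈⟨ *-identityˡ c ⟩
    c                ∎

  finite-valuation⇒≉0 : ∀ {a k} → v a ≡ [ k ] → ¬ a ≈ 0#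
  finite-valuation⇒≉0 e a≈0 with () ← ≡.trans (≡.sym e) (≡.trans (v-cong a≈0) v-0#)

  ≈0-or-≉0 : ∀ a → a ≈ 0# ⊎ ¬ a ≈ 0#
  ≈0-or-≉0 a = go (v a) ≡.refl
    where
    go : ∀ w → v a ≡ w → a ≈ 0# ⊎ ¬ a ≈ 0#
    go ⊤⁺    e = inj₁ (v-⊤⁺ e)
    go [ k ] e = inj₂ (finite-valuation⇒≉0 e)

  Small : Carrier → Set
  Small x = [ 1ℤ ] ≤⁺ v x

  Small-resp : ∀ {x y} → x ≈ y → Small x → Small y
  Small-resp e = ≡.subst ([ 1ℤ ] ≤⁺_) (v-cong e)

  private
    module 𝒪 = IsSubring 𝒪-isSubring
    module 𝔪 = IsIdeal 𝔪-isIdeal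
    module 𝔪-sub = IsSubgroup 𝔪.isSubgroup

  1≤⇒0≤ : ∀ {w} → [ 1ℤ ] ≤⁺ w → [ 0ℤ ] ≤⁺ w
  1≤⇒0≤ [ p ]     = [ ℤ.≤-trans (ℤ.+≤+ z≤n) p ]
  1≤⇒0≤ (_ ≤⊤⁺)   = _ ≤⊤⁺

  Small⊆𝒪 : ∀ {x} → Small x → 𝒪 x
  Small⊆𝒪 = 1≤⇒0≤

  Small-* : ∀ {a x} → 𝒪 a → Small x → Small (a * x)
  Small-* {a} {x} a∈ s = 𝔪.*∈ˡ (a , a∈) {x , Small⊆𝒪 s} s

  Small-neg : ∀ {x} → Small x → Small (- x)
  Small-neg {x} s = 𝔪-sub.⁻¹∈ {x , Small⊆𝒪 s} s

  Small-0 : Small 0#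
  Small-0 = 𝔪-sub.ε∈

  Small-cancel : ∀ {x y} → Small x → Small (x + y) → Small y
  Small-cancel {x} {y} s t = Small-resp (begin
    - x + (x + y)    ≈⟨ +-assoc _ _ _ ⟨
    (- x + x) + y    ≈⟨ +-congʳ (-‿inverseˡ x) ⟩
    0# + y           ≈⟨ +-identityˡ y ⟩
    y                ∎) (v-+ (Small-neg s) t)

  Small-flip : ∀ {x y} → Small (x - y) → Small (y - x)
  Small-flip {x} {y} s = Small-resp (⁻¹-anti-homo‿- x y) (Small-neg s)

  v-1# : v 1# ≡ [ 0ℤ ]
  v-1# = go (v 1#) ≡.refl (≡.trans (≡.sym (v-* 1# 1#)) (v-cong (*-identityˡ 1#)))
    where
    []-inj : ∀ {m n : ℤ} → _≡_ {A = ℤ ⁺} [ m ] [ n ] → m ≡ n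
    []-inj ≡.refl = ≡.refl
    go : ∀ w → v 1# ≡ w → w +⁺ w ≡ w → w ≡ [ 0ℤ ]
    go ⊤⁺    e _ = ⊥-elim (1≉0 (v-⊤⁺ e))
    go [ m ] _ e = ≡.cong [_] (RingProperties.x+x≈x⇒x≈0 ℤ.+-*-ring m ([]-inj e))

  Small-1 : ¬ Small 1#
  Small-1 s with ≡.subst ([ 1ℤ ] ≤⁺_) v-1# s
  ... | [ ℤ.+≤+ () ]

  unit-or-small : ∀ {a} → 𝒪 a → v a ≡ [ 0ℤ ] ⊎ Small a
  unit-or-small {a} a∈ = go (v a) ≡.refl a∈
    where
    go : ∀ w → v a ≡ w → [ 0ℤ ] ≤⁺ w → v a ≡ [ 0ℤ ] ⊎ Small a
    go ⊤⁺            e _ = inj₂ (≡.subst ([ 1ℤ ] ≤⁺_) (≡.sym e) (_ ≤⊤⁺))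
    go [ + zero ]    e _ = inj₁ e
    go [ + suc n ]   e _ = inj₂ (≡.subst ([ 1ℤ ] ≤⁺_) (≡.sym e) [ ℤ.+≤+ (s≤s z≤n) ])
    go [ -[1+ n ] ] e [ () ]

  unit-inverse : ∀ {a} → v a ≡ [ 0ℤ ] → ∃[ b ] 𝒪 b × b * a ≈ 1#
  unit-inverse {a} e = let b , _ , ba≈1 = inverse a (finite-valuation⇒≉0 e) in
    b , go (v b) (≡.trans (≡.sym (≡.trans (v-* b a) (≡.cong (v b +⁺_) e))) (≡.trans (v-cong ba≈1) v-1#)) , ba≈1
    where
    go : ∀ w → w +⁺ [ 0ℤ ] ≡ [ 0ℤ ] → [ 0ℤ ] ≤⁺ w
    go ⊤⁺    ()
    go [ m ] e = ≡.subst ([ 0ℤ ] ≤⁺_) (≡.sym (≡.trans (≡.cong [_] (≡.sym (ℤ.+-identityʳ m))) e)) [ ℤ.≤-refl ]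

  small-divide : ∀ {ϖ a} → Uniformizer ϖ → Small a → ∃[ b ] 𝒪 b × a ≈ ϖ * b
  small-divide {ϖ} {a} e s = let ϖ⁻¹ , ϖϖ⁻¹≈1 , _ = inverse ϖ (finite-valuation⇒≉0 e)
                                 eq = trans (sym (*-identityˡ a)) (trans (*-congʳ (sym ϖϖ⁻¹≈1)) (*-assoc _ _ _))
                             in ϖ⁻¹ * a , go _ (≡.subst ([ 1ℤ ] ≤⁺_)
                                 (≡.trans (v-cong eq) (≡.trans (v-* _ _) (≡.cong (_+⁺ v (ϖ⁻¹ * a)) e))) s) , eq
    where
    go : ∀ w → [ 1ℤ ] ≤⁺ [ 1ℤ ] +⁺ w → [ 0ℤ ] ≤⁺ w
    go ⊤⁺            _     = _ ≤⊤⁺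
    go [ + n ]       _     = [ ℤ.+≤+ z≤n ]
    go [ -[1+ zero ] ]  [ ℤ.+≤+ () ]
    go [ -[1+ suc n ] ] [ () ]

  uniformizer-* : ∀ {ϖ a n} → Uniformizer ϖ → [ + n ] ≤⁺ v a → [ + suc n ] ≤⁺ v (ϖ * a)
  uniformizer-* {ϖ} {a} {n} e s = ≡.subst ([ + suc n ] ≤⁺_)
    (≡.sym (≡.trans (v-* ϖ a) (≡.cong (_+⁺ v a) e))) (go (v a) s)
    where
    go : ∀ w → [ + n ] ≤⁺ w → [ + suc n ] ≤⁺ [ 1ℤ ] +⁺ w
    go ⊤⁺    _     = _ ≤⊤⁺
    go [ m ] [ p ] = [ ℤ.+-mono-≤ (ℤ.≤-refl {1ℤ}) p ]

  unbounded⇒≈0 : ∀ {a} → (∀ n → [ + n ] ≤⁺ v a) → a ≈ 0#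
  unbounded⇒≈0 {a} h = go (v a) ≡.refl
    where
    go : ∀ w → v a ≡ w → a ≈ 0#
    go ⊤⁺             e = v-⊤⁺ e
    go [ + k ]        e with ≡.subst ([ + suc k ] ≤⁺_) e (h (suc k))
    ... | [ ℤ.+≤+ p ] = contradiction p ℕ.1+n≰n
    go [ -[1+ k ] ]   e with ≡.subst ([ 0ℤ ] ≤⁺_) e (h 0)
    ... | [ () ]

  small-square : ∀ {x} → Small (x * x) → Small x
  small-square {x} s = go (v x) ≡.refl (≡.subst ([ 1ℤ ] ≤⁺_) (v-* x x) s)
    where
    go : ∀ w → v x ≡ w → [ 1ℤ ] ≤⁺ w +⁺ w → Small x
    go ⊤⁺            e _ = ≡.subst ([ 1ℤ ] ≤⁺_) (≡.sym e) (_ ≤⊤⁺)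
    go [ + zero ]    e [ ℤ.+≤+ () ]
    go [ + suc n ]   e _ = ≡.subst ([ 1ℤ ] ≤⁺_) (≡.sym e) [ ℤ.+≤+ (s≤s z≤n) ]
    go [ -[1+ n ] ]  e [ () ]

module _ {ℓ} (F : NonarchimedeanLocalField ℓ) where
  open NonarchimedeanLocalField F
  open Valuation discretelyValuedField
  open Bijection residueField-card using (to; cong; injective; surjective)
  open SemiringSolver (CommutativeRing.commutativeSemiring commutativeRing)
  open SetoidReasoning setoid

  private
    𝒪-square : Ring.Carrier 𝒪-ring → Ring.Carrier 𝒪-ring
    𝒪-square x = Ring._*_ 𝒪-ring x x

    lift : Fin q → Ring.Carrier 𝒪-ring
    lift i = proj₁ (surjective i)

    to-lift : ∀ i → to (lift i) ≡ i
    to-lift i = proj₂ (surjective i) {lift i} (Ring.refl residueField {lift i})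

  -- In residue characteristic 2 squaring is injective on the finite residue field.
  square-root-mod-𝔪 : Small (1# + 1#) → ∀ {n} → 𝒪 n → ∃[ m ] 𝒪 m × Small (m * m - n)
  square-root-mod-𝔪 2-small {n} n∈ =
    let i , e = Fin-injective⇒surjective square square-injective (to (n , n∈)) in
    proj₁ (lift i) , proj₂ (lift i) , injective {𝒪-square (lift i)} {n , n∈} e
    where
    square : Fin q → Fin q
    square i = to (𝒪-square (lift i))
    square-injective : ∀ {i j} → square i ≡ square j → i ≡ j
    -- With d = x - y one has x² - y² = 2yd + d². As 2 is small, d² is small, and so is d.
    square-injective {i} {j} e = ≡.trans (≡.sym (to-lift i))
      (≡.trans (cong {lift i} {lift j} (small-square (Small-cancel 2yd-small
        (Small-resp x²-y² (injective {𝒪-square (lift i)} {𝒪-square (lift j)} e))))) (to-lift j))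
      where
      x = proj₁ (lift i)
      y = proj₁ (lift j)
      d = x - y
      y∈ = proj₂ (lift j)
      module 𝒪 = IsSubring 𝒪-isSubring
      d∈ : 𝒪 d
      d∈ = 𝒪.+∈ (proj₂ (lift i)) (𝒪.-∈ y∈)
      2yd-small : Small ((y * d) * (1# + 1#))
      2yd-small = Small-* (𝒪.*∈ y∈ d∈) 2-small
      x²-y² : x * x - y * y ≈ (y * d) * (1# + 1#) + d * d
      x²-y² = begin
        x * x - y * y                                            ≈⟨ +-congʳ (*-cong x≈ x≈) ⟨
        (y + d) * (y + d) - y * y
          ≈⟨ solve 3 (λ y d z → (y :+ d) :* (y :+ d) :+ z := (y :* y :+ z) :+ ((y :* d :+ y :* d) :+ d :* d)) refl y d (- (y * y)) ⟩
        (y * y - y * y) + ((y * d + y * d) + d * d)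
          ≈⟨ trans (+-congʳ (-‿inverseʳ _)) (+-identityˡ _) ⟩
        (y * d + y * d) + d * d
          ≈⟨ +-congʳ (trans (distribˡ _ _ _) (+-cong (*-identityʳ _) (*-identityʳ _))) ⟨
        (y * d) * (1# + 1#) + d * d                              ∎
        where
        x≈ : y + d ≈ x
        x≈ = x∙[y-x]≈y +-abelianGroup y x

-- Fixed elements of σ and its action on residues

module _ {ℓ} {F : NonarchimedeanLocalField ℓ} (D : QuaternionDatum F) where
  private module F = NonarchimedeanLocalField F
  open QuaternionDatum D
  open RingMorphisms.IsRingHomomorphism K.ι-isHom
    using () renaming (⟦⟧-cong to ι-cong; +-homo to ι-+; *-homo to ι-*; 1#-homo to ι-1; 0#-homo to ι-0)
  open RingMorphisms.IsRingHomomorphism (RingMorphisms.IsRingIsomorphism.isRingHomomorphism K.σ-isAut)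
    using () renaming (⟦⟧-cong to σ-cong; +-homo to σ-+; *-homo to σ-*; 1#-homo to σ-1)
  private
    module VF = Valuation F.discretelyValuedField
    module VK = Valuation K.extension
    module 𝒪F = IsSubring F.𝒪-isSubring
    module 𝒪K = IsSubring K.𝒪-isSubring
  open K using (_≈_; _+_; _*_; -_; _-_; 0#; 1#; ι; σ; 𝒪; +-cong; +-congˡ; +-congʳ; *-cong; *-congˡ; *-congʳ; trans; sym; refl)
  open SemiringSolver (CommutativeRing.commutativeSemiring K.commutativeRing)
  open SetoidReasoning K.setoid

  ι-𝒪 : ∀ {a} → F.𝒪 a → 𝒪 (ι a)
  ι-𝒪 {a} = ≡.subst ([ 0ℤ ] ≤⁺_) (≡.sym (K.v-ι a))

  ι-𝒪⁻ : ∀ {a} → 𝒪 (ι a) → F.𝒪 a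
  ι-𝒪⁻ {a} = ≡.subst ([ 0ℤ ] ≤⁺_) (K.v-ι a)

  ι-small : ∀ {a} → VF.Small a → VK.Small (ι a)
  ι-small {a} = ≡.subst ([ 1ℤ ] ≤⁺_) (≡.sym (K.v-ι a))

  ι-≉0 : ∀ {a} → ¬ a F.≈ F.0# → ¬ ι a ≈ 0#
  ι-≉0 {a} a≉0 ιa≈0 = a≉0 (F.v-⊤⁺ (≡.trans (≡.sym (K.v-ι a)) (≡.trans (K.v-cong ιa≈0) K.v-0#)))

  module _ where
    open RingProperties K.ring using (+-cancelˡ)

    -- The degree 2 extension K/F has no room for an element outside F fixed by σ.
    fixed⇒ι : ∀ {x} → σ x ≈ x → ∃[ a ] x ≈ ι a
    fixed⇒ι {x} σx≈x = go (VF.≈0-or-≉0 (a₀ F.* c₁ F.- a₁ F.* c₀))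
      where
      e = proj₁ K.degree
      e₀ = e zero
      e₁ = e (suc zero)
      1-coord = proj₁ (proj₂ K.degree) 1#
      x-coord = proj₁ (proj₂ K.degree) x
      a₀ = proj₁ 1-coord zero
      a₁ = proj₁ 1-coord (suc zero)
      c₀ = proj₁ x-coord zero
      c₁ = proj₁ x-coord (suc zero)
      -- The determinant of the coordinates of 1 and x. If it vanishes, x is proportional to 1.
      -- Otherwise Cramer's rule expresses e₀ and e₁ through 1 and x, so that σ would fix the whole
      -- basis.
      d = a₀ F.* c₁ F.- a₁ F.* c₀

      -- The final `0#` is the empty sum at the end of `linearCombination`; the solver calls below
      -- carry it along as a variable.
      1≈ : 1# ≈ ι a₀ * e₀ + (ι a₁ * e₁ + 0#)
      1≈ = proj₂ 1-coord
      x≈ : x ≈ ι c₀ * e₀ + (ι c₁ * e₁ + 0#)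
      x≈ = proj₂ x-coord

      ιd : ι a₀ * ι c₁ ≈ ι a₁ * ι c₀ + ι d
      ιd = begin
        ι a₀ * ι c₁                                  ≈⟨ ι-* _ _ ⟨
        ι (a₀ F.* c₁)                                ≈⟨ ι-cong (x∙[y-x]≈y F.+-abelianGroup _ _) ⟨
        ι (a₁ F.* c₀ F.+ d)                          ≈⟨ ι-+ _ _ ⟩
        ι (a₁ F.* c₀) + ι d                          ≈⟨ +-congʳ (ι-* _ _) ⟩
        ι a₁ * ι c₀ + ι d                            ∎

      c₁≈ : ι c₁ * 1# ≈ ι a₁ * x + ι d * e₀
      c₁≈ = begin
        ι c₁ * 1#                                                 ≈⟨ *-congˡ 1≈ ⟩
        ι c₁ * (ι a₀ * e₀ + (ι a₁ * e₁ + 0#))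
          ≈⟨ solve 6 (λ c₁ a₀ a₁ e₀ e₁ z → c₁ :* (a₀ :* e₀ :+ (a₁ :* e₁ :+ z)) := (a₀ :* c₁) :* e₀ :+ (c₁ :* a₁) :* e₁ :+ c₁ :* z) refl (ι c₁) (ι a₀) (ι a₁) e₀ e₁ 0# ⟩
        (ι a₀ * ι c₁) * e₀ + (ι c₁ * ι a₁) * e₁ + ι c₁ * 0#
          ≈⟨ +-cong (+-congʳ (*-congʳ ιd)) (trans (K.zeroʳ _) (sym (K.zeroʳ _))) ⟩
        (ι a₁ * ι c₀ + ι d) * e₀ + (ι c₁ * ι a₁) * e₁ + ι a₁ * 0#
          ≈⟨ solve 7 (λ a₁ c₀ d e₀ c₁ e₁ z → (a₁ :* c₀ :+ d) :* e₀ :+ (c₁ :* a₁) :* e₁ :+ a₁ :* z := a₁ :* (c₀ :* e₀ :+ (c₁ :* e₁ :+ z)) :+ d :* e₀) refl (ι a₁) (ι c₀) (ι d) e₀ (ι c₁) e₁ 0# ⟩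
        ι a₁ * (ι c₀ * e₀ + (ι c₁ * e₁ + 0#)) + ι d * e₀          ≈⟨ +-congʳ (*-congˡ x≈) ⟨
        ι a₁ * x + ι d * e₀                                       ∎

      a₀x≈ : ι a₀ * x ≈ ι c₀ * 1# + ι d * e₁
      a₀x≈ = begin
        ι a₀ * x                                                  ≈⟨ *-congˡ x≈ ⟩
        ι a₀ * (ι c₀ * e₀ + (ι c₁ * e₁ + 0#))
          ≈⟨ solve 6 (λ a₀ c₀ c₁ e₀ e₁ z → a₀ :* (c₀ :* e₀ :+ (c₁ :* e₁ :+ z)) := (a₀ :* c₁) :* e₁ :+ (a₀ :* c₀) :* e₀ :+ a₀ :* z) refl (ι a₀) (ι c₀) (ι c₁) e₀ e₁ 0# ⟩
        (ι a₀ * ι c₁) * e₁ + (ι a₀ * ι c₀) * e₀ + ι a₀ * 0#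
          ≈⟨ +-cong (+-congʳ (*-congʳ ιd)) (trans (K.zeroʳ _) (sym (K.zeroʳ _))) ⟩
        (ι a₁ * ι c₀ + ι d) * e₁ + (ι a₀ * ι c₀) * e₀ + ι c₀ * 0#
          ≈⟨ solve 7 (λ a₁ c₀ d e₀ a₀ e₁ z → (a₁ :* c₀ :+ d) :* e₁ :+ (a₀ :* c₀) :* e₀ :+ c₀ :* z := c₀ :* (a₀ :* e₀ :+ (a₁ :* e₁ :+ z)) :+ d :* e₁) refl (ι a₁) (ι c₀) (ι d) e₀ (ι a₀) e₁ 0# ⟩
        ι c₀ * (ι a₀ * e₀ + (ι a₁ * e₁ + 0#)) + ι d * e₁          ≈⟨ +-congʳ (*-congˡ 1≈) ⟨
        ι c₀ * 1# + ι d * e₁                                      ∎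

      σι* : ∀ b {y} → σ y ≈ y → σ (ι b * y) ≈ ι b * y
      σι* b p = trans (σ-* _ _) (*-cong (K.σ-ι b) p)

      cancel-fixed : ¬ d F.≈ F.0# → ∀ {y} → σ (ι d * y) ≈ ι d * y → σ y ≈ y
      cancel-fixed d≉0 {y} p = VK.*-cancelˡ-≉0 (ι-≉0 d≉0)
        (trans (*-congʳ (sym (K.σ-ι d))) (trans (sym (σ-* _ _)) p))

      summand-fixed : ∀ {y w z} → σ y ≈ y → σ w ≈ w → w ≈ y + z → σ z ≈ z
      summand-fixed {y} {w} {z} σy σw p = +-cancelˡ y _ _ (begin
        y + σ z      ≈⟨ +-congʳ σy ⟨
        σ y + σ z    ≈⟨ σ-+ _ _ ⟨
        σ (y + z)    ≈⟨ σ-cong p ⟨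
        σ w          ≈⟨ σw ⟩
        w            ≈⟨ p ⟩
        y + z        ∎)

      divide : ∀ {b c} → ¬ b F.≈ F.0# → ι c * 1# ≈ ι b * x → ∃[ a ] x ≈ ι a
      divide {b} {c} b≉0 p = let b⁻¹ , bb⁻¹≈1 , _ = F.inverse b b≉0 in b⁻¹ F.* c ,
        VK.*-cancelˡ-≉0 (ι-≉0 b≉0) (begin
          ι b * x               ≈⟨ p ⟨
          ι c * 1#              ≈⟨ K.*-identityʳ _ ⟩
          ι c                   ≈⟨ ι-cong (F.trans (F.sym (F.*-assoc _ _ _)) (F.trans (F.*-congʳ bb⁻¹≈1) (F.*-identityˡ c))) ⟨
          ι (b F.* (b⁻¹ F.* c)) ≈⟨ ι-* _ _ ⟩
          ι b * ι (b⁻¹ F.* c)   ∎)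

      0*≈0 : ∀ {b} → b F.≈ F.0# → ∀ y → ι b * y ≈ 0#
      0*≈0 p y = trans (*-congʳ (trans (ι-cong p) ι-0)) (K.zeroˡ y)

      go : d F.≈ F.0# ⊎ ¬ d F.≈ F.0# → ∃[ a ] x ≈ ι a
      go (inj₁ d≈0) with VF.≈0-or-≉0 a₁ | VF.≈0-or-≉0 a₀
      ... | inj₂ a₁≉0 | _         = divide a₁≉0 (trans c₁≈ (trans (+-congˡ (0*≈0 d≈0 e₀)) (K.+-identityʳ _)))
      ... | inj₁ a₁≈0 | inj₂ a₀≉0 = divide a₀≉0 (sym (trans a₀x≈ (trans (+-congˡ (0*≈0 d≈0 e₁)) (K.+-identityʳ _))))
      ... | inj₁ a₁≈0 | inj₁ a₀≈0 = contradiction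
        (trans 1≈ (trans (+-cong (0*≈0 a₀≈0 e₀) (trans (+-congʳ (0*≈0 a₁≈0 e₁)) (K.+-identityˡ _))) (K.+-identityˡ _)))
        K.1≉0
      go (inj₂ d≉0) = contradiction σ-trivial (proj₂ K.σ-nontrivial)
        where
        σe₀ : σ e₀ ≈ e₀
        σe₀ = cancel-fixed d≉0 (summand-fixed (σι* a₁ σx≈x) (σι* c₁ σ-1) c₁≈)
        σe₁ : σ e₁ ≈ e₁
        σe₁ = cancel-fixed d≉0 (summand-fixed (σι* c₀ σ-1) (σι* a₀ σx≈x) a₀x≈)
        σ-trivial : σ (proj₁ K.σ-nontrivial) ≈ proj₁ K.σ-nontrivial
        σ-trivial = let b , y≈ = proj₁ (proj₂ K.degree) (proj₁ K.σ-nontrivial) in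
          trans (σ-cong y≈) (trans (trans (σ-+ _ _) (+-cong (σι* (b zero) σe₀)
            (trans (σ-+ _ _) (+-cong (σι* (b (suc zero)) σe₁) σ-0)))) (sym y≈))
          where
          σ-0 : σ 0# ≈ 0#
          σ-0 = RingMorphisms.IsRingHomomorphism.0#-homo (RingMorphisms.IsRingIsomorphism.isRingHomomorphism K.σ-isAut)

  private
    module κ = RingMorphisms.IsRingHomomorphism κ-isHom

  κ-injective : ∀ {a b} → 𝒪 a → 𝒪 b → κ a B.≈ κ b → a ≈ b
  κ-injective {a} {b} a∈ b∈ e = KP.x∙y⁻¹≈ε⇒x≈y a b (proj₁ (O-direct (𝒪K.+∈ a∈ (𝒪K.-∈ b∈)) 𝒪K.0∈ vanish))
    where
    module KP = RingProperties K.ring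
    vanish : κ (a - b) B.+ κ 0# B.* Π B.≈ B.0#
    vanish = B.trans (B.+-cong
      (B.trans (κ.+-homo a (- b)) (B.trans (B.+-cong e (κ.-‿homo b)) (B.-‿inverseʳ (κ b))))
      (B.trans (B.*-congʳ κ.0#-homo) (B.zeroˡ Π))) (B.+-identityˡ B.0#)

  ιπ : K.Carrier
  ιπ = ι π

  ιπ-uniformizer : K.Uniformizer ιπ
  ιπ-uniformizer = ≡.trans (K.v-ι π) π-uniformizer

  Π²≈κιπ : Π B.* Π B.≈ κ ιπ
  Π²≈κιπ = B.trans Π²≈π (B.sym (κ-ι π))

  -- Conjugation by Π² = π is trivial.
  σ-involutive : ∀ {a} → 𝒪 a → σ (σ a) ≈ a
  σ-involutive {a} a∈ = VK.*-cancelˡ-≉0 (VK.finite-valuation⇒≉0 ιπ-uniformizer)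
    (trans (K.*-comm _ _) (trans (κ-injective (𝒪K.*∈ (σ-𝒪 (σ-𝒪 a∈)) π∈) (𝒪K.*∈ a∈ π∈) eq) (K.*-comm _ _)))
    where
    π∈ = K.Uniformizer⊆𝒪 ιπ-uniformizer
    module BR = SetoidReasoning B.setoid
    eq : κ (σ (σ a) * ιπ) B.≈ κ (a * ιπ)
    eq = BR.begin
      κ (σ (σ a) * ιπ)             BR.≈⟨ κ.*-homo _ _ ⟩
      κ (σ (σ a)) B.* κ ιπ         BR.≈⟨ B.*-congˡ Π²≈κιπ ⟨
      κ (σ (σ a)) B.* (Π B.* Π)    BR.≈⟨ B.*-assoc _ _ _ ⟨
      (κ (σ (σ a)) B.* Π) B.* Π    BR.≈⟨ B.*-congʳ (Π-σ (σ-𝒪 a∈)) ⟨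
      (Π B.* κ (σ a)) B.* Π        BR.≈⟨ B.*-assoc _ _ _ ⟩
      Π B.* (κ (σ a) B.* Π)        BR.≈⟨ B.*-congˡ (Π-σ a∈) ⟨
      Π B.* (Π B.* κ a)            BR.≈⟨ B.*-assoc _ _ _ ⟨
      (Π B.* Π) B.* κ a            BR.≈⟨ B.*-congʳ Π²≈π ⟩
      B.ι π B.* κ a                BR.≈⟨ B.ι-central π (κ a) ⟩
      κ a B.* B.ι π                BR.≈⟨ B.*-congˡ (κ-ι π) ⟨
      κ a B.* κ ιπ                 BR.≈⟨ κ.*-homo _ _ ⟨
      κ (a * ιπ)                   BR.∎

  private
    x+[y-x]≈y : ∀ x y → x + (y - x) ≈ y
    x+[y-x]≈y = x∙[y-x]≈y K.+-abelianGroup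

    small-diff : ∀ {x y d} → x ≈ y + d → VK.Small d → VK.Small (x - y)
    small-diff {x} {y} {d} e s = VK.Small-resp (sym (trans (+-congʳ e) (RingProperties.xyx⁻¹≈y K.ring y d))) s

    ι2 : 1# + 1# ≈ ι (F.1# F.+ F.1#)
    ι2 = sym (trans (ι-+ _ _) (+-cong ι-1 ι-1))

    double : ∀ x → x * (1# + 1#) ≈ x + x
    double x = trans (K.distribˡ x 1# 1#) (+-cong (K.*-identityʳ x) (K.*-identityʳ x))

    module _ (σ-trivial-mod-𝔪 : ∀ {a} → 𝒪 a → VK.Small (σ a - a)) where

      -- An integer congruent to its conjugate is a root of X² - t X + n, where
      -- its trace t = 2X and norm n = X² modulo 𝔪 are in F.
      residue-in-F : ∀ {r} → 𝒪 r → ∃[ c ] F.𝒪 c × VK.Small (r - ι c)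
      residue-in-F {r} r∈ = go (VF.unit-or-small (𝒪F.+∈ 𝒪F.1∈ 𝒪F.1∈))
        where
        g : K.Carrier
        g = σ r - r
        g-small : VK.Small g
        g-small = σ-trivial-mod-𝔪 r∈
        σr≈ : σ r ≈ r + g
        σr≈ = sym (x+[y-x]≈y r (σ r))

        go : F.v (F.1# F.+ F.1#) ≡ [ 0ℤ ] ⊎ VF.Small (F.1# F.+ F.1#) → ∃[ c ] F.𝒪 c × VK.Small (r - ι c)
        -- Half the trace: (r + σr)/2 = r + g/2, which differs from r by a small element.
        go (inj₁ 2-unit) = h F.* t′ , 𝒪F.*∈ h∈ t′∈ ,
            VK.Small-flip (small-diff ιc≈ (VK.Small-* (ι-𝒪 h∈) g-small))
          where
          h = proj₁ (VF.unit-inverse 2-unit)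
          h∈ = proj₁ (proj₂ (VF.unit-inverse 2-unit))
          h2≈1 = proj₂ (proj₂ (VF.unit-inverse 2-unit))
          t = fixed⇒ι {r + σ r} (trans (σ-+ _ _) (trans (+-congˡ (σ-involutive r∈)) (K.+-comm _ _)))
          t′ = proj₁ t
          t′∈ : F.𝒪 t′
          t′∈ = ι-𝒪⁻ (𝒪K.resp (proj₂ t) (𝒪K.+∈ r∈ (σ-𝒪 r∈)))
          ιc≈ : ι (h F.* t′) ≈ r + ι h * g
          ιc≈ = begin
            ι (h F.* t′)                     ≈⟨ ι-* _ _ ⟩
            ι h * ι t′                       ≈⟨ *-congˡ (proj₂ t) ⟨
            ι h * (r + σ r)                  ≈⟨ *-congˡ (+-congˡ σr≈) ⟩
            ι h * (r + (r + g))              ≈⟨ solve 3 (λ h r g → h :* (r :+ (r :+ g)) := h :* (r :+ r) :+ h :* g) refl (ι h) r g ⟩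
            ι h * (r + r) + ι h * g          ≈⟨ +-congʳ (*-congˡ (double r)) ⟨
            ι h * (r * (1# + 1#)) + ι h * g  ≈⟨ +-congʳ (trans (*-congˡ (K.*-comm _ _)) (sym (K.*-assoc _ _ _))) ⟩
            (ι h * (1# + 1#)) * r + ι h * g  ≈⟨ +-congʳ (trans (*-congʳ (trans (*-congˡ ι2) (trans (sym (ι-* _ _)) (trans (ι-cong h2≈1) ι-1)))) (K.*-identityˡ r)) ⟩
            r + ι h * g                      ∎
        go (inj₂ 2-small) = m , m∈ , VK.small-square (VK.Small-cancel A-small (VK.Small-resp (sym A+d²≈0) VK.Small-0))
          where
          n = fixed⇒ι {r * σ r} (trans (σ-* _ _) (trans (*-congˡ (σ-involutive r∈)) (K.*-comm _ _)))
          n′ = proj₁ n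
          n′∈ : F.𝒪 n′
          n′∈ = ι-𝒪⁻ (𝒪K.resp (proj₂ n) (𝒪K.*∈ r∈ (σ-𝒪 r∈)))
          root = square-root-mod-𝔪 F 2-small n′∈
          m = proj₁ root
          m∈ = proj₁ (proj₂ root)
          f = m F.* m F.- n′
          d = r - ι m
          -- With r = m + d and m² = n + f, the norm n = rσr = r² + rg becomes n + f + 2md + d² +
          -- rg. Hence A + d² = 0, where every term of A is small, and d² is small.
          A : K.Carrier
          A = ι f + ((ι m * d) * (1# + 1#) + r * g)
          A-small : VK.Small A
          A-small = K.v-+ (ι-small (proj₂ (proj₂ root)))
            (K.v-+ (VK.Small-* (𝒪K.*∈ (ι-𝒪 m∈) (𝒪K.+∈ r∈ (𝒪K.-∈ (ι-𝒪 m∈)))) (VK.Small-resp (sym ι2) (ι-small 2-small)))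
                   (VK.Small-* r∈ g-small))
          m²≈ : ι m * ι m ≈ ι n′ + ι f
          m²≈ = begin
            ι m * ι m              ≈⟨ ι-* _ _ ⟨
            ι (m F.* m)            ≈⟨ ι-cong (x∙[y-x]≈y F.+-abelianGroup _ _) ⟨
            ι (n′ F.+ f)           ≈⟨ ι-+ _ _ ⟩
            ι n′ + ι f             ∎
          A+d²≈0 : A + d * d ≈ 0#
          A+d²≈0 = RingProperties.+-identityʳ-unique K.ring (ι n′) (A + d * d) (begin
            ι n′ + (A + d * d)
              ≈⟨ solve 5 (λ n f md rg d → n :+ ((f :+ (md :+ rg)) :+ d :* d) := ((n :+ f) :+ md :+ d :* d) :+ rg) refl (ι n′) (ι f) ((ι m * d) * (1# + 1#)) (r * g) d ⟩
            ((ι n′ + ι f) + (ι m * d) * (1# + 1#) + d * d) + r * g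
              ≈⟨ +-congʳ (+-congʳ (+-cong (sym m²≈) (double _))) ⟩
            (ι m * ι m + (ι m * d + ι m * d) + d * d) + r * g
              ≈⟨ +-congʳ (solve 2 (λ m d → m :* m :+ (m :* d :+ m :* d) :+ d :* d := (m :+ d) :* (m :+ d)) refl (ι m) d) ⟩
            (ι m + d) * (ι m + d) + r * g
              ≈⟨ +-congʳ (*-cong (x+[y-x]≈y (ι m) r) (x+[y-x]≈y (ι m) r)) ⟩
            r * r + r * g
              ≈⟨ K.distribˡ r r g ⟨
            r * (r + g)
              ≈⟨ *-congˡ σr≈ ⟨
            r * σ r
              ≈⟨ proj₂ n ⟩
            ι n′ ∎)

      -- The residue extension would have degree 1. If the basis residues e₀ and e₁ come from c₀ and
      -- c₁ in F, then c₁e₀ - c₀e₁ is small, so independence makes c₀ small. Then e₀ is small too,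
      -- and independence applied to the coefficients 1 and 0 makes 1 small.
      σ-nontrivial-mod-𝔪 : ⊥
      σ-nontrivial-mod-𝔪 = VF.Small-1 (minus-0 (independent 10-vector 10-vanishes zero))
        where
        basis = proj₁ K.residueDegree
        independent = proj₂ (proj₂ K.residueDegree)
        e₀ = proj₁ (basis zero)
        e₁ = proj₁ (basis (suc zero))
        r₀ = residue-in-F (proj₂ (basis zero))
        r₁ = residue-in-F (proj₂ (basis (suc zero)))
        c₀ = proj₁ r₀
        c₁ = proj₁ r₁
        m₀ = e₀ - ι c₀
        m₁ = e₁ - ι c₁

        minus-0 : ∀ {x} → VF.Small (x F.- F.0#) → VF.Small x
        minus-0 = VF.Small-resp (F.trans (F.+-congˡ (RingProperties.-0#≈0# F.ring)) (F.+-identityʳ _))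

        minus-0⁻ : ∀ {x} → VK.Small x → VK.Small (x - 0#)
        minus-0⁻ = VK.Small-resp (sym (trans (+-congˡ (RingProperties.-0#≈0# K.ring)) (K.+-identityʳ _)))

        relation : Fin 2 → Ring.Carrier F.residueField
        relation zero       = c₁ , proj₁ (proj₂ r₁)
        relation (suc zero) = F.- c₀ , 𝒪F.-∈ (proj₁ (proj₂ r₀))

        relation-vanishes : VK.Small ((ι c₁ * e₀ + (ι (F.- c₀) * e₁ + 0#)) - 0#)
        relation-vanishes = minus-0⁻ (VK.Small-resp (sym (begin
          ι c₁ * e₀ + (ι (F.- c₀) * e₁ + 0#)
            ≈⟨ +-cong (*-congˡ (sym (x+[y-x]≈y _ _))) (trans (K.+-identityʳ _) (*-congˡ (sym (x+[y-x]≈y _ _)))) ⟩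
          ι c₁ * (ι c₀ + m₀) + ι (F.- c₀) * (ι c₁ + m₁)
            ≈⟨ solve 5 (λ c₁ c₀ m₀ n m₁ → c₁ :* (c₀ :+ m₀) :+ n :* (c₁ :+ m₁) := (c₀ :+ n) :* c₁ :+ (c₁ :* m₀ :+ n :* m₁)) refl (ι c₁) (ι c₀) m₀ (ι (F.- c₀)) m₁ ⟩
          (ι c₀ + ι (F.- c₀)) * ι c₁ + (ι c₁ * m₀ + ι (F.- c₀) * m₁)
            ≈⟨ +-congʳ (trans (*-congʳ (trans (sym (ι-+ _ _)) (trans (ι-cong (F.-‿inverseʳ c₀)) ι-0))) (K.zeroˡ _)) ⟩
          0# + (ι c₁ * m₀ + ι (F.- c₀) * m₁)
            ≈⟨ K.+-identityˡ _ ⟩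
          ι c₁ * m₀ + ι (F.- c₀) * m₁ ∎))
          (K.v-+ (VK.Small-* (ι-𝒪 (proj₁ (proj₂ r₁))) (proj₂ (proj₂ r₀)))
                 (VK.Small-* (ι-𝒪 (𝒪F.-∈ (proj₁ (proj₂ r₀)))) (proj₂ (proj₂ r₁)))))

        e₀-small : VK.Small e₀
        e₀-small = VK.Small-resp (x+[y-x]≈y (ι c₀) e₀) (K.v-+ (ι-small c₀-small) (proj₂ (proj₂ r₀)))
          where
          c₀-small : VF.Small c₀
          c₀-small = VF.Small-resp (RingProperties.-‿involutive F.ring c₀)
            (VF.Small-neg (minus-0 (independent relation relation-vanishes (suc zero))))

        10-vector : Fin 2 → Ring.Carrier F.residueField
        10-vector zero       = F.1# , 𝒪F.1∈
        10-vector (suc zero) = F.0# , 𝒪F.0∈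

        10-vanishes : VK.Small ((ι F.1# * e₀ + (ι F.0# * e₁ + 0#)) - 0#)
        10-vanishes = minus-0⁻ (VK.Small-resp (sym (trans
          (+-cong (trans (*-congʳ ι-1) (K.*-identityˡ e₀))
                  (trans (+-congʳ (trans (*-congʳ ι-0) (K.zeroˡ e₁))) (K.+-identityˡ 0#)))
          (K.+-identityʳ e₀))) e₀-small)

  -- If no such ζ existed, every σa - a would be a nonunit of O_K, which is the situation just
  -- excluded.
  unramified-generator : ExcludedMiddle ℓ → ∃[ ζ ] 𝒪 ζ × K.v (σ ζ - ζ) ≡ [ 0ℤ ]
  unramified-generator em with em {∃[ ζ ] 𝒪 ζ × K.v (σ ζ - ζ) ≡ [ 0ℤ ]}
  ... | yes p = p
  ... | no  ∄ = ⊥-elim (σ-nontrivial-mod-𝔪 trivial)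
    where
    trivial : ∀ {a} → 𝒪 a → VK.Small (σ a - a)
    trivial {a} a∈ with VK.unit-or-small (𝒪K.+∈ (σ-𝒪 a∈) (𝒪K.-∈ a∈))
    ... | inj₁ unit  = contradiction (a , a∈ , unit) ∄
    ... | inj₂ small = small

-- Bilattices and their truncations

module _ {ℓ} (em : ExcludedMiddle ℓ) {F : NonarchimedeanLocalField ℓ} (D : QuaternionDatum F) where
  private module F = NonarchimedeanLocalField F
  open QuaternionDatum D
  private
    module VK = Valuation K.extension
    module κ = RingMorphisms.IsRingHomomorphism κ-isHom
    module σ = RingMorphisms.IsRingHomomorphism (RingMorphisms.IsRingIsomorphism.isRingHomomorphism K.σ-isAut)
    module BR = SetoidReasoning B.setoid

  𝒪K : CommutativeRing ℓ ℓ
  𝒪K = record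
    { isCommutativeRing = record
      { isRing = Ring.isRing K.𝒪-ring
      ; *-comm = λ (x , _) (y , _) → K.*-comm x y
      }
    }

  private
    module R = CommutativeRing 𝒪K

    ζ-data = unramified-generator D em

    πR : R.Carrier
    πR = K.ι π , K.Uniformizer⊆𝒪 (ιπ-uniformizer D)

    σR : R.Carrier → R.Carrier
    σR (a , a∈) = K.σ a , σ-𝒪 a∈

    σR-isHom : IsRingHom R.ring R.ring σR
    σR-isHom = mkRingHom R.ring R.ring σR σ.⟦⟧-cong (λ (x , _) (y , _) → σ.+-homo x y) σ.0#-homo
      (λ (x , _) (y , _) → σ.*-homo x y) σ.1#-homo (λ (x , _) → σ.-‿homo x)

    unit-or-𝔪R : ∀ a → (∃[ b ] b R.* a R.≈ R.1#) ⊎ (∃[ b ] a R.≈ πR R.* b)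
    unit-or-𝔪R (a , a∈) with VK.unit-or-small a∈
    ... | inj₁ unit  = let b , b∈ , e = VK.unit-inverse unit in inj₁ ((b , b∈) , e)
    ... | inj₂ small = let b , b∈ , e = VK.small-divide (ιπ-uniformizer D) small in inj₂ ((b , b∈) , e)

    1∉𝔪R : ¬ (∃[ b ] R.1# R.≈ πR R.* b)
    1∉𝔪R ((b , b∈) , e) = VK.Small-1 (VK.Small-resp (K.sym e) (VK.uniformizer-* {n = 0} (ιπ-uniformizer D) b∈))

    open Exp R.semiring using (_^_)

    separatedR : ∀ {a} → (∀ n → ∃[ b ] a R.≈ (πR ^ n) R.* b) → a R.≈ R.0#
    separatedR h = VK.unbounded⇒≈0 λ n → let b , e = h n in
      ≡.subst ([ + n ] ≤⁺_) (K.v-cong (K.sym e)) (power n b)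
      where
      power : ∀ n b → [ + n ] ≤⁺ K.v (proj₁ ((πR ^ n) R.* b))
      power zero    (b , b∈) = ≡.subst ([ 0ℤ ] ≤⁺_) (K.v-cong (K.sym (K.*-identityˡ b))) b∈
      power (suc n) b        = ≡.subst ([ + suc n ] ≤⁺_)
        (K.v-cong (K.sym (K.*-assoc (proj₁ πR) (proj₁ (πR ^ n)) (proj₁ b))))
        (VK.uniformizer-* {n = n} (ιπ-uniformizer D) (power n b))

  𝒦 : UnramifiedInvolution ℓ
  𝒦 = record
    { commutativeRing = 𝒪K
    ; σ = σR
    ; σ-isHom = σR-isHom
    ; σ-σ = λ (a , a∈) → σ-involutive D a∈
    ; π = πR
    ; σπ≈π = K.σ-ι π
    ; unit-or-𝔪 = unit-or-𝔪R
    ; 1∉𝔪 = 1∉𝔪R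
    ; separated = λ {a} → separatedR {a}
    ; ζ = proj₁ ζ-data , proj₁ (proj₂ ζ-data)
    ; δ⁻¹ = let b , b∈ , _ = VK.unit-inverse (proj₂ (proj₂ ζ-data)) in b , b∈
    ; δ⁻¹δ≈1 = proj₂ (proj₂ (VK.unit-inverse (proj₂ (proj₂ ζ-data))))
    }

  κO : R.Carrier → O.Carrier
  κO (a , a∈) = κ a , IsSubring.resp O-isSubring
    (B.trans (B.+-congˡ (B.trans (B.*-congʳ κ.0#-homo) (B.zeroˡ Π))) (B.+-identityʳ (κ a)))
    (O-gen a∈ (IsSubring.0∈ K.𝒪-isSubring))

  κO-isHom : IsRingHom R.ring O-ring κO
  κO-isHom = mkRingHom R.ring O-ring κO κ.⟦⟧-cong (λ (x , _) (y , _) → κ.+-homo x y) κ.0#-homo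
    (λ (x , _) (y , _) → κ.*-homo x y) κ.1#-homo (λ (x , _) → κ.-‿homo x)

  coords : O.Carrier → R.Carrier × R.Carrier
  coords (x , x∈) = let a , b , a∈ , b∈ , _ = O-decomp x∈ in (a , a∈) , (b , b∈)

  coord₀ coord₁ : O.Carrier → R.Carrier
  coord₀ p = proj₁ (coords p)
  coord₁ p = proj₂ (coords p)

  coords-≈ : ∀ p → p O.≈ κO (coord₀ p) O.+ κO (coord₁ p) O.* ΠO
  coords-≈ (x , x∈) = let _ , _ , _ , _ , e = O-decomp x∈ in e

  coords-injective : ∀ (a b c d : R.Carrier) → κO a O.+ κO b O.* ΠO O.≈ κO c O.+ κO d O.* ΠO →
                     a R.≈ c × b R.≈ d
  coords-injective (a , a∈) (b , b∈) (c , c∈) (d , d∈) e =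
    KP.x∙y⁻¹≈ε⇒x≈y a c (proj₁ zeros) , KP.x∙y⁻¹≈ε⇒x≈y b d (proj₂ zeros)
    where
    module KP = RingProperties K.ring
    module SK = IsSubring K.𝒪-isSubring
    open CommutativeSemigroupProperties (CommutativeMonoid.commutativeSemigroup B.+-commutativeMonoid)
      using (interchange)
    zeros : a K.- c K.≈ K.0# × b K.- d K.≈ K.0#
    zeros = O-direct (SK.+∈ a∈ (SK.-∈ c∈)) (SK.+∈ b∈ (SK.-∈ d∈)) (BR.begin
      κ (a K.- c) B.+ κ (b K.- d) B.* Π
        BR.≈⟨ B.+-cong (B.trans (κ.+-homo _ _) (B.+-congˡ (κ.-‿homo c)))
                       (B.trans (B.*-congʳ (B.trans (κ.+-homo _ _) (B.+-congˡ (κ.-‿homo d))))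
                                (RingProperties.[y-z]x≈yx-zx B.ring Π (κ b) (κ d))) ⟩
      (κ a B.- κ c) B.+ (κ b B.* Π B.- κ d B.* Π)
        BR.≈⟨ interchange _ _ _ _ ⟩
      (κ a B.+ κ b B.* Π) B.+ (B.- κ c B.+ B.- (κ d B.* Π))
        BR.≈⟨ B.+-cong e (RingProperties.-‿+-comm B.ring _ _) ⟩
      (κ c B.+ κ d B.* Π) B.- (κ c B.+ κ d B.* Π)
        BR.≈⟨ B.-‿inverseʳ _ ⟩
      B.0# BR.∎)

  -- `O-decomp` produces coordinates from a representative and a membership proof. Directness of the
  -- sum makes them independent of that choice and lets each of them be computed by exhibiting any
  -- decomposition.
  coords-unique : ∀ p (a b : R.Carrier) → p O.≈ κO a O.+ κO b O.* ΠO → coord₀ p R.≈ a × coord₁ p R.≈ b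
  coords-unique p a b e = coords-injective (coord₀ p) (coord₁ p) a b (B.trans (B.sym (coords-≈ p)) e)

  coords-κ : ∀ a → coord₀ (κO a) R.≈ a × coord₁ (κO a) R.≈ R.0#
  coords-κ a = coords-unique (κO a) a R.0#
    (B.sym (B.trans (B.+-congˡ (B.trans (B.*-congʳ κ.0#-homo) (B.zeroˡ Π))) (B.+-identityʳ _)))

  coords-Π : coord₀ ΠO R.≈ R.0# × coord₁ ΠO R.≈ R.1#
  coords-Π = coords-unique ΠO R.0# R.1#
    (B.sym (B.trans (B.+-cong κ.0#-homo (B.trans (B.*-congʳ κ.1#-homo) (B.*-identityˡ Π))) (B.+-identityˡ Π)))

  coords-cong : ∀ {p q} → p O.≈ q → coord₀ p R.≈ coord₀ q × coord₁ p R.≈ coord₁ q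
  coords-cong {p} {q} e = coords-unique p (coord₀ q) (coord₁ q) (B.trans e (coords-≈ q))

  coords-+ : ∀ p q → coord₀ (p O.+ q) R.≈ coord₀ p R.+ coord₀ q × coord₁ (p O.+ q) R.≈ coord₁ p R.+ coord₁ q
  coords-+ p q = coords-unique (p O.+ q) (coord₀ p R.+ coord₀ q) (coord₁ p R.+ coord₁ q)
    (B.trans (B.+-cong (coords-≈ p) (coords-≈ q)) (B.trans (interchange _ _ _ _)
      (B.sym (B.+-cong (κ.+-homo _ _) (B.trans (B.*-congʳ (κ.+-homo _ _)) (B.distribʳ Π _ _))))))
    where open CommutativeSemigroupProperties (CommutativeMonoid.commutativeSemigroup B.+-commutativeMonoid)
            using (interchange)

  -- (a + bΠ)(c + dΠ) = (ac + b(σd)π) + (ad + b(σc))Π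
  coords-* : ∀ p q → let a = coord₀ p ; b = coord₁ p ; c = coord₀ q ; d = coord₁ q in
    coord₀ (p O.* q) R.≈ a R.* c R.+ (b R.* σR d) R.* πR ×
    coord₁ (p O.* q) R.≈ a R.* d R.+ b R.* σR c
  coords-* p q = coords-unique (p O.* q) (a R.* c R.+ (b R.* σR d) R.* πR) (a R.* d R.+ b R.* σR c) (BR.begin
    proj₁ p B.* proj₁ q
      BR.≈⟨ B.*-cong (coords-≈ p) (coords-≈ q) ⟩
    (κ a′ B.+ κ b′ B.* Π) B.* (κ c′ B.+ κ d′ B.* Π)
      BR.≈⟨ B.trans (B.distribʳ _ _ _) (B.+-cong (B.distribˡ _ _ _) (B.distribˡ _ _ _)) ⟩
    (κ a′ B.* κ c′ B.+ κ a′ B.* (κ d′ B.* Π)) B.+ ((κ b′ B.* Π) B.* κ c′ B.+ (κ b′ B.* Π) B.* (κ d′ B.* Π))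
      BR.≈⟨ B.+-cong (B.+-cong (B.sym (κ.*-homo _ _)) adΠ) (B.+-cong bΠc bΠdΠ) ⟩
    (κ (a′ K.* c′) B.+ κ (a′ K.* d′) B.* Π) B.+ (κ (b′ K.* K.σ c′) B.* Π B.+ κ ((b′ K.* K.σ d′) K.* K.ι π))
      BR.≈⟨ B.trans (B.+-congˡ (B.+-comm _ _)) (interchange _ _ _ _) ⟩
    (κ (a′ K.* c′) B.+ κ ((b′ K.* K.σ d′) K.* K.ι π)) B.+ (κ (a′ K.* d′) B.* Π B.+ κ (b′ K.* K.σ c′) B.* Π)
      BR.≈⟨ B.+-cong (κ.+-homo _ _) (B.trans (B.*-congʳ (κ.+-homo _ _)) (B.distribʳ Π _ _)) ⟨
    κ (a′ K.* c′ K.+ (b′ K.* K.σ d′) K.* K.ι π) B.+ κ (a′ K.* d′ K.+ b′ K.* K.σ c′) B.* Π BR.∎)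
    where
    open CommutativeSemigroupProperties (CommutativeMonoid.commutativeSemigroup B.+-commutativeMonoid)
      using (interchange)
    a = coord₀ p ; b = coord₁ p ; c = coord₀ q ; d = coord₁ q
    a′ = proj₁ a ; b′ = proj₁ b ; c′ = proj₁ c ; d′ = proj₁ d
    adΠ : κ a′ B.* (κ d′ B.* Π) B.≈ κ (a′ K.* d′) B.* Π
    adΠ = B.trans (B.sym (B.*-assoc _ _ _)) (B.*-congʳ (B.sym (κ.*-homo _ _)))
    move : ∀ (e : R.Carrier) → (κ b′ B.* Π) B.* κ (proj₁ e) B.≈ κ (b′ K.* K.σ (proj₁ e)) B.* Π
    move (e , e∈) = B.trans (B.*-assoc _ _ _) (B.trans (B.*-congˡ (Π-σ e∈))
      (B.trans (B.sym (B.*-assoc _ _ _)) (B.*-congʳ (B.sym (κ.*-homo _ _)))))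
    bΠc : (κ b′ B.* Π) B.* κ c′ B.≈ κ (b′ K.* K.σ c′) B.* Π
    bΠc = move c
    bΠdΠ : (κ b′ B.* Π) B.* (κ d′ B.* Π) B.≈ κ ((b′ K.* K.σ d′) K.* K.ι π)
    bΠdΠ = B.trans (B.sym (B.*-assoc _ _ _)) (B.trans (B.*-congʳ (move d)) (B.trans (B.*-assoc _ _ _)
      (B.trans (B.*-congˡ (Π²≈κιπ D)) (B.sym (κ.*-homo _ _)))))

  -- Translation between bimodules over O_B and Π-bimodules

  module _ (X : Bimodule O-ring O-ring ℓ ℓ) (agree : ActionsAgree X ιO ιO) where
    open Bimodule X

    private
      ιπO≈ : ΠO O.* ΠO O.≈ κO πR
      ιπO≈ = Π²≈κιπ D

      Πκ : ∀ a → ΠO O.* κO a O.≈ κO (σR a) O.* ΠO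
      Πκ (a , a∈) = Π-σ a∈

      κΠ : ∀ a → κO a O.* ΠO O.≈ ΠO O.* κO (σR a)
      κΠ (a , a∈) = B.trans (B.*-congʳ (κ.⟦⟧-cong (K.sym (σ-involutive D a∈)))) (B.sym (Π-σ (σ-𝒪 a∈)))

      -- By `fixed⇒ι` such a scalar comes from F, and its preimage is integral since the valuations
      -- agree; there the two actions agree by assumption.
      central : ∀ {a} → σR a R.≈ a → ∀ x → κO a *ₗ x ≈ᴹ x *ᵣ κO a
      central {a , a∈} p x = let c , e = fixed⇒ι D p
                                 c∈ = ι-𝒪⁻ D (IsSubring.resp K.𝒪-isSubring e a∈)
                                 κa≈ = B.trans (κ.⟦⟧-cong e) (κ-ι c)
                             in ≈ᴹ-trans (*ₗ-cong {x = κO (a , a∈)} {y = ιO (c , c∈)} κa≈ ≈ᴹ-refl)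
                                  (≈ᴹ-trans (agree (c , c∈) x) (*ᵣ-cong {u = ιO (c , c∈)} {v = κO (a , a∈)} ≈ᴹ-refl (B.sym κa≈)))

    fromBimodule : Π-Bimodule 𝒦
    fromBimodule = record
      { bimodule = restrict κO-isHom κO-isHom X
      ; Πₗ = ΠO *ₗ_
      ; Πᵣ = _*ᵣ ΠO
      ; Πₗ-cong = *ₗ-cong (O.refl {ΠO})
      ; Πᵣ-cong = λ p → *ᵣ-cong p (O.refl {ΠO})
      ; Πₗ-+ = *ₗ-distribˡ ΠO
      ; Πᵣ-+ = *ᵣ-distribʳ ΠO
      ; Πₗ-*ₗ = λ a x → ≈ᴹ-trans (≈ᴹ-sym (*ₗ-assoc _ _ x)) (≈ᴹ-trans (*ₗ-cong (Πκ a) ≈ᴹ-refl) (*ₗ-assoc _ _ x))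
      ; Πᵣ-*ₗ = λ a x → *ₗ-*ᵣ-assoc _ x _
      ; Πₗ-*ᵣ = λ x a → ≈ᴹ-sym (*ₗ-*ᵣ-assoc _ x _)
      ; Πᵣ-*ᵣ = λ x a → ≈ᴹ-trans (*ᵣ-assoc x _ _) (≈ᴹ-trans (*ᵣ-cong ≈ᴹ-refl (κΠ a)) (≈ᴹ-sym (*ᵣ-assoc x _ _)))
      ; Πₗ-Πᵣ = λ x → ≈ᴹ-sym (*ₗ-*ᵣ-assoc _ x _)
      ; Πₗ² = λ x → ≈ᴹ-trans (≈ᴹ-sym (*ₗ-assoc _ _ x)) (*ₗ-cong ιπO≈ ≈ᴹ-refl)
      ; Πᵣ² = λ x → ≈ᴹ-trans (*ᵣ-assoc x _ _) (*ᵣ-cong ≈ᴹ-refl ιπO≈)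
      ; fixed-central = λ {a} → central {a}
      }

  module _ (A : Π-Bimodule 𝒦) where
    open Π-Bimodule A
    private
      open CommutativeSemigroupProperties
        (CommutativeMonoid.commutativeSemigroup +ᴹ-commutativeMonoid) using (interchange)
      module AR = SetoidReasoning ≈ᴹ-setoid
      module 𝒦 = UnramifiedInvolution 𝒦

    infixr 7 _▷_
    infixl 7 _◁_
    _▷_ : O.Carrier → Carrierᴹ → Carrierᴹ
    p ▷ x = coord₀ p *ₗ x +ᴹ coord₁ p *ₗ Πₗ x

    _◁_ : Carrierᴹ → O.Carrier → Carrierᴹ
    x ◁ p = x *ᵣ coord₀ p +ᴹ Πᵣ (x *ᵣ coord₁ p)

    κ-▷ : ∀ a x → κO a ▷ x ≈ᴹ a *ₗ x
    κ-▷ a x = ≈ᴹ-trans (+ᴹ-cong (*ₗ-cong (proj₁ (coords-κ a)) ≈ᴹ-refl)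
      (≈ᴹ-trans (*ₗ-cong (proj₂ (coords-κ a)) ≈ᴹ-refl) (*ₗ-zeroˡ _))) (+ᴹ-identityʳ _)

    Π-▷ : ∀ x → ΠO ▷ x ≈ᴹ Πₗ x
    Π-▷ x = ≈ᴹ-trans (+ᴹ-cong (≈ᴹ-trans (*ₗ-cong (proj₁ coords-Π) ≈ᴹ-refl) (*ₗ-zeroˡ x))
      (≈ᴹ-trans (*ₗ-cong (proj₂ coords-Π) ≈ᴹ-refl) (*ₗ-identityˡ _))) (+ᴹ-identityˡ _)

    ◁-κ : ∀ x a → x ◁ κO a ≈ᴹ x *ᵣ a
    ◁-κ x a = ≈ᴹ-trans (+ᴹ-cong (*ᵣ-cong ≈ᴹ-refl (proj₁ (coords-κ a)))
      (≈ᴹ-trans (Πᵣ-cong (≈ᴹ-trans (*ᵣ-cong ≈ᴹ-refl (proj₂ (coords-κ a))) (*ᵣ-zeroʳ x)))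
        (Filtration.Πᵣ-0 𝒦 A))) (+ᴹ-identityʳ _)

    ◁-Π : ∀ x → x ◁ ΠO ≈ᴹ Πᵣ x
    ◁-Π x = ≈ᴹ-trans (+ᴹ-cong (≈ᴹ-trans (*ᵣ-cong ≈ᴹ-refl (proj₁ coords-Π)) (*ᵣ-zeroʳ x))
      (Πᵣ-cong (≈ᴹ-trans (*ᵣ-cong ≈ᴹ-refl (proj₂ coords-Π)) (*ᵣ-identityʳ x)))) (+ᴹ-identityˡ _)

    private
      ▷-cong : ∀ {p q x y} → p O.≈ q → x ≈ᴹ y → p ▷ x ≈ᴹ q ▷ y
      ▷-cong {p} {q} e f = let e₀ , e₁ = coords-cong {p} {q} e in
        +ᴹ-cong (*ₗ-cong e₀ f) (*ₗ-cong e₁ (Πₗ-cong f))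

      ◁-cong : ∀ {x y p q} → x ≈ᴹ y → p O.≈ q → x ◁ p ≈ᴹ y ◁ q
      ◁-cong {x} {y} {p} {q} f e = let e₀ , e₁ = coords-cong {p} {q} e in
        +ᴹ-cong (*ᵣ-cong f e₀) (Πᵣ-cong (*ᵣ-cong f e₁))

      ▷-distribˡ : ∀ p x y → p ▷ (x +ᴹ y) ≈ᴹ p ▷ x +ᴹ p ▷ y
      ▷-distribˡ p x y = ≈ᴹ-trans (+ᴹ-cong (*ₗ-distribˡ _ x y)
        (≈ᴹ-trans (*ₗ-congˡ (Πₗ-+ x y)) (*ₗ-distribˡ _ _ _))) (interchange _ _ _ _)

      ▷-distribʳ : ∀ x p q → (p O.+ q) ▷ x ≈ᴹ p ▷ x +ᴹ q ▷ x
      ▷-distribʳ x p q = let e₀ , e₁ = coords-+ p q in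
        ≈ᴹ-trans (+ᴹ-cong (≈ᴹ-trans (*ₗ-cong e₀ ≈ᴹ-refl) (*ₗ-distribʳ x _ _))
                          (≈ᴹ-trans (*ₗ-cong e₁ ≈ᴹ-refl) (*ₗ-distribʳ _ _ _))) (interchange _ _ _ _)

      ◁-distribʳ : ∀ p x y → (x +ᴹ y) ◁ p ≈ᴹ x ◁ p +ᴹ y ◁ p
      ◁-distribʳ p x y = ≈ᴹ-trans (+ᴹ-cong (*ᵣ-distribʳ _ x y)
        (≈ᴹ-trans (Πᵣ-cong (*ᵣ-distribʳ _ x y)) (Πᵣ-+ _ _))) (interchange _ _ _ _)

      ◁-distribˡ : ∀ x p q → x ◁ (p O.+ q) ≈ᴹ x ◁ p +ᴹ x ◁ q
      ◁-distribˡ x p q = let e₀ , e₁ = coords-+ p q in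
        ≈ᴹ-trans (+ᴹ-cong (≈ᴹ-trans (*ᵣ-cong ≈ᴹ-refl e₀) (*ᵣ-distribˡ x _ _))
                          (≈ᴹ-trans (Πᵣ-cong (≈ᴹ-trans (*ᵣ-cong ≈ᴹ-refl e₁) (*ᵣ-distribˡ x _ _))) (Πᵣ-+ _ _)))
                 (interchange _ _ _ _)

      ▷-assoc : ∀ p q x → (p O.* q) ▷ x ≈ᴹ p ▷ (q ▷ x)
      ▷-assoc p q x = AR.begin
        coord₀ (p O.* q) *ₗ x +ᴹ coord₁ (p O.* q) *ₗ Πₗ x
          AR.≈⟨ +ᴹ-cong (*ₗ-cong (proj₁ (coords-* p q)) ≈ᴹ-refl) (*ₗ-cong (proj₂ (coords-* p q)) ≈ᴹ-refl) ⟩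
        (a R.* c R.+ (b R.* σR d) R.* πR) *ₗ x +ᴹ (a R.* d R.+ b R.* σR c) *ₗ Πₗ x
          AR.≈⟨ +ᴹ-cong (≈ᴹ-trans (*ₗ-distribʳ x _ _) (+ᴹ-cong (*ₗ-assoc a c x) bσdπ))
                        (≈ᴹ-trans (*ₗ-distribʳ _ _ _) (+ᴹ-cong (*ₗ-assoc a d _) bσc)) ⟩
        (a *ₗ c *ₗ x +ᴹ b *ₗ Πₗ (d *ₗ Πₗ x)) +ᴹ (a *ₗ d *ₗ Πₗ x +ᴹ b *ₗ Πₗ (c *ₗ x))
          AR.≈⟨ ≈ᴹ-trans (interchange _ _ _ _) (+ᴹ-congˡ (+ᴹ-comm _ _)) ⟩
        (a *ₗ c *ₗ x +ᴹ a *ₗ d *ₗ Πₗ x) +ᴹ (b *ₗ Πₗ (c *ₗ x) +ᴹ b *ₗ Πₗ (d *ₗ Πₗ x))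
          AR.≈⟨ +ᴹ-cong (*ₗ-distribˡ a _ _) (≈ᴹ-trans (*ₗ-congˡ (Πₗ-+ _ _)) (*ₗ-distribˡ b _ _)) ⟨
        p ▷ (q ▷ x) AR.∎
        where
        a = coord₀ p ; b = coord₁ p ; c = coord₀ q ; d = coord₁ q
        bσdπ : ((b R.* σR d) R.* πR) *ₗ x ≈ᴹ b *ₗ Πₗ (d *ₗ Πₗ x)
        bσdπ = ≈ᴹ-trans (*ₗ-assoc _ _ x) (≈ᴹ-trans (*ₗ-assoc _ _ _) (*ₗ-congˡ
          (≈ᴹ-trans (*ₗ-congˡ (≈ᴹ-sym (Πₗ² x))) (≈ᴹ-sym (Πₗ-*ₗ d _)))))
        bσc : (b R.* σR c) *ₗ Πₗ x ≈ᴹ b *ₗ Πₗ (c *ₗ x)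
        bσc = ≈ᴹ-trans (*ₗ-assoc _ _ _) (*ₗ-congˡ (≈ᴹ-sym (Πₗ-*ₗ c x)))

      Πᵣ-*ᵣ′ : ∀ x c → Πᵣ x *ᵣ c ≈ᴹ Πᵣ (x *ᵣ σR c)
      Πᵣ-*ᵣ′ x c = ≈ᴹ-sym (≈ᴹ-trans (Πᵣ-*ᵣ x _) (*ᵣ-cong ≈ᴹ-refl (𝒦.σ-σ c)))

      ◁-assoc : ∀ x p q → (x ◁ p) ◁ q ≈ᴹ x ◁ (p O.* q)
      ◁-assoc x p q = ≈ᴹ-sym (AR.begin
        x *ᵣ coord₀ (p O.* q) +ᴹ Πᵣ (x *ᵣ coord₁ (p O.* q))
          AR.≈⟨ +ᴹ-cong (*ᵣ-cong ≈ᴹ-refl (proj₁ (coords-* p q))) (Πᵣ-cong (*ᵣ-cong ≈ᴹ-refl (proj₂ (coords-* p q)))) ⟩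
        x *ᵣ (a R.* c R.+ (b R.* σR d) R.* πR) +ᴹ Πᵣ (x *ᵣ (a R.* d R.+ b R.* σR c))
          AR.≈⟨ +ᴹ-cong (≈ᴹ-trans (*ᵣ-distribˡ x _ _) (+ᴹ-cong (≈ᴹ-sym (*ᵣ-assoc x a c)) bσdπ))
                        (≈ᴹ-trans (Πᵣ-cong (*ᵣ-distribˡ x _ _)) (≈ᴹ-trans (Πᵣ-+ _ _)
                          (+ᴹ-cong (Πᵣ-cong (≈ᴹ-sym (*ᵣ-assoc x a d))) bσc))) ⟩
        ((x *ᵣ a) *ᵣ c +ᴹ Πᵣ (Πᵣ (x *ᵣ b) *ᵣ d)) +ᴹ (Πᵣ ((x *ᵣ a) *ᵣ d) +ᴹ Πᵣ (x *ᵣ b) *ᵣ c)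
          AR.≈⟨ ≈ᴹ-trans (+ᴹ-congˡ (+ᴹ-comm _ _)) (≈ᴹ-trans (interchange _ _ _ _) (+ᴹ-congˡ (+ᴹ-comm _ _))) ⟩
        ((x *ᵣ a) *ᵣ c +ᴹ Πᵣ (x *ᵣ b) *ᵣ c) +ᴹ (Πᵣ ((x *ᵣ a) *ᵣ d) +ᴹ Πᵣ (Πᵣ (x *ᵣ b) *ᵣ d))
          AR.≈⟨ +ᴹ-cong (*ᵣ-distribʳ c _ _) (≈ᴹ-trans (Πᵣ-cong (*ᵣ-distribʳ d _ _)) (Πᵣ-+ _ _)) ⟨
        (x ◁ p) ◁ q AR.∎)
        where
        a = coord₀ p ; b = coord₁ p ; c = coord₀ q ; d = coord₁ q
        bσdπ : x *ᵣ ((b R.* σR d) R.* πR) ≈ᴹ Πᵣ (Πᵣ (x *ᵣ b) *ᵣ d)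
        bσdπ = ≈ᴹ-trans (≈ᴹ-sym (*ᵣ-assoc x _ _)) (≈ᴹ-trans (*ᵣ-congʳ (≈ᴹ-sym (*ᵣ-assoc x b (σR d))))
          (≈ᴹ-trans (≈ᴹ-sym (Πᵣ² _)) (Πᵣ-cong (≈ᴹ-sym (Πᵣ-*ᵣ′ _ d)))))
        bσc : Πᵣ (x *ᵣ (b R.* σR c)) ≈ᴹ Πᵣ (x *ᵣ b) *ᵣ c
        bσc = ≈ᴹ-trans (Πᵣ-cong (≈ᴹ-sym (*ᵣ-assoc x b (σR c)))) (≈ᴹ-sym (Πᵣ-*ᵣ′ _ c))

      ▷-*ᵣ : ∀ p x c → (p ▷ x) *ᵣ c ≈ᴹ p ▷ (x *ᵣ c)
      ▷-*ᵣ p x c = ≈ᴹ-trans (*ᵣ-distribʳ c _ _) (+ᴹ-cong (*ₗ-*ᵣ-assoc _ x c)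
        (≈ᴹ-trans (*ₗ-*ᵣ-assoc _ _ c) (*ₗ-congˡ (≈ᴹ-sym (Πₗ-*ᵣ x c)))))

      ▷-Πᵣ : ∀ p x → p ▷ Πᵣ x ≈ᴹ Πᵣ (p ▷ x)
      ▷-Πᵣ p x = ≈ᴹ-sym (≈ᴹ-trans (Πᵣ-+ _ _) (+ᴹ-cong (Πᵣ-*ₗ _ x)
        (≈ᴹ-trans (Πᵣ-*ₗ _ _) (*ₗ-congˡ (≈ᴹ-sym (Πₗ-Πᵣ x))))))

      ▷-◁-assoc : ∀ p x q → (p ▷ x) ◁ q ≈ᴹ p ▷ (x ◁ q)
      ▷-◁-assoc p x q = ≈ᴹ-trans (+ᴹ-cong (▷-*ᵣ p x _)
        (≈ᴹ-trans (Πᵣ-cong (▷-*ᵣ p x _)) (≈ᴹ-sym (▷-Πᵣ p _)))) (≈ᴹ-sym (▷-distribˡ p _ _))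

    toBimodule : Bimodule O-ring O-ring ℓ ℓ
    toBimodule = record
      { Carrierᴹ = Carrierᴹ ; _≈ᴹ_ = _≈ᴹ_ ; _+ᴹ_ = _+ᴹ_ ; _*ₗ_ = _▷_ ; _*ᵣ_ = _◁_
      ; 0ᴹ = 0ᴹ ; -ᴹ_ = -ᴹ_
      ; isBimodule = record
        { isBisemimodule = record
          { +ᴹ-isCommutativeMonoid = +ᴹ-isCommutativeMonoid
          ; isPreleftSemimodule = record
            { *ₗ-cong = λ {p} {q} → ▷-cong {p} {q}
            ; *ₗ-zeroˡ = λ x → ≈ᴹ-trans (▷-cong {O.0#} {κO R.0#} (B.sym κ.0#-homo) ≈ᴹ-refl)
                                 (≈ᴹ-trans (κ-▷ R.0# x) (*ₗ-zeroˡ x))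
            ; *ₗ-distribʳ = ▷-distribʳ
            ; *ₗ-identityˡ = λ x → ≈ᴹ-trans (▷-cong {O.1#} {κO R.1#} (B.sym κ.1#-homo) ≈ᴹ-refl)
                                     (≈ᴹ-trans (κ-▷ R.1# x) (*ₗ-identityˡ x))
            ; *ₗ-assoc = ▷-assoc
            ; *ₗ-zeroʳ = λ p → ≈ᴹ-trans (+ᴹ-cong (*ₗ-zeroʳ _)
                (≈ᴹ-trans (*ₗ-congˡ (Filtration.Πₗ-0 𝒦 A)) (*ₗ-zeroʳ _))) (+ᴹ-identityˡ 0ᴹ)
            ; *ₗ-distribˡ = ▷-distribˡ
            }
          ; isPrerightSemimodule = record
            { *ᵣ-cong = λ {x} {y} {p} {q} → ◁-cong {x} {y} {p} {q}
            ; *ᵣ-zeroʳ = λ x → ≈ᴹ-trans (◁-cong {x} {x} {O.0#} {κO R.0#} ≈ᴹ-refl (B.sym κ.0#-homo))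
                                 (≈ᴹ-trans (◁-κ x R.0#) (*ᵣ-zeroʳ x))
            ; *ᵣ-distribˡ = ◁-distribˡ
            ; *ᵣ-identityʳ = λ x → ≈ᴹ-trans (◁-cong {x} {x} {O.1#} {κO R.1#} ≈ᴹ-refl (B.sym κ.1#-homo))
                                     (≈ᴹ-trans (◁-κ x R.1#) (*ᵣ-identityʳ x))
            ; *ᵣ-assoc = ◁-assoc
            ; *ᵣ-zeroˡ = λ p → ≈ᴹ-trans (+ᴹ-cong (*ᵣ-zeroˡ _)
                (≈ᴹ-trans (Πᵣ-cong (*ᵣ-zeroˡ _)) (Filtration.Πᵣ-0 𝒦 A))) (+ᴹ-identityˡ 0ᴹ)
            ; *ᵣ-distribʳ = ◁-distribʳ
            }
          ; *ₗ-*ᵣ-assoc = ▷-◁-assoc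
          }
        ; -ᴹ‿cong = -ᴹ‿cong
        ; -ᴹ‿inverse = -ᴹ‿inverse
        }
      }

    private
      ιR : Ring.Carrier F.𝒪-ring → R.Carrier
      ιR (c , c∈) = K.ι c , ι-𝒪 D c∈

      ιO≈ : ∀ c → ιO c O.≈ κO (ιR c)
      ιO≈ (c , _) = B.sym (κ-ι c)

    ι-▷ : ∀ c x → ιO c ▷ x ≈ᴹ ιR c *ₗ x
    ι-▷ c x = ≈ᴹ-trans (▷-cong {ιO c} {κO (ιR c)} (ιO≈ c) ≈ᴹ-refl) (κ-▷ (ιR c) x)

    toBimodule-agrees : ActionsAgree toBimodule ιO ιO
    toBimodule-agrees c x = ≈ᴹ-trans (ι-▷ c x) (≈ᴹ-trans (fixed-central (K.σ-ι (proj₁ c)) x)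
      (≈ᴹ-sym (≈ᴹ-trans (◁-cong {x} {x} {ιO c} {κO (ιR c)} ≈ᴹ-refl (ιO≈ c)) (◁-κ x (ιR c)))))

    toBimodule-finitelyGenerated : ∀ {n} {g : Vector Carrierᴹ n} → Generates A g → FinitelyGenerated toBimodule
    toBimodule-finitelyGenerated {n} {g} generates = n , g , generates stable gen
      where
      stable : IsStable A (Span toBimodule g)
      stable = record
        { ≈-resp = resp ; 0∈ = Span.zero ; +∈ = add
        ; *ₗ∈ = λ a s → resp (κ-▷ a _) (actₗ (κO a) s)
        ; *ᵣ∈ = λ a s → resp (◁-κ _ a) (actᵣ (κO a) s)
        ; Πₗ∈ = λ s → resp (Π-▷ _) (actₗ ΠO s)
        ; Πᵣ∈ = λ s → resp (◁-Π _) (actᵣ ΠO s)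
        }

    -- Scalars coming from O_F are fixed by σ. On them the twist by the degree disappears, so that
    -- the standard bimodule and its swap, whose left action is the twisted one, can be treated
    -- alike.
    FixedTorsionFree : Set ℓ
    FixedTorsionFree = ∀ a x → 𝒦.Fixed a → ¬ a R.≈ R.0# → a *ₗ x ≈ᴹ 0ᴹ → x ≈ᴹ 0ᴹ

    toBilattice : ∀ {n} {g : Vector Carrierᴹ n} → Generates A g → FixedTorsionFree → Bilattice
    toBilattice generates torsionFree = record
      { bimodule = toBimodule
      ; finitelyGenerated = toBimodule-finitelyGenerated generates
      ; actionsAgree = toBimodule-agrees
      ; torsionFree = λ c x c≉0 e → torsionFree (ιR c) x (K.σ-ι (proj₁ c)) (ι-≉0 D c≉0)
          (≈ᴹ-trans (≈ᴹ-sym (ι-▷ c x)) e)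
      }

    module _ (Y : Bimodule O-ring O-ring ℓ ℓ) (agree : ActionsAgree Y ιO ιO)
             (h : Π-Hom 𝒦 A (fromBimodule Y agree)) where
      private module Y = Bimodule Y
      open Π-Hom h

      ▷-homo : ∀ p x → fun (p ▷ x) Y.≈ᴹ p Y.*ₗ fun x
      ▷-homo p x = Y.≈ᴹ-trans (+-homo _ _) (Y.≈ᴹ-trans
        (Y.+ᴹ-cong (*ₗ-homo _ x) (Y.≈ᴹ-trans (*ₗ-homo _ _)
          (Y.≈ᴹ-trans (Y.*ₗ-congˡ (Πₗ-homo x)) (Y.≈ᴹ-sym (Y.*ₗ-assoc _ ΠO _)))))
        (Y.≈ᴹ-trans (Y.≈ᴹ-sym (Y.*ₗ-distribʳ _ _ _))
          (Y.*ₗ-cong {y = p} (B.sym (coords-≈ p)) Y.≈ᴹ-refl)))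

      ◁-homo : ∀ x p → fun (x ◁ p) Y.≈ᴹ fun x Y.*ᵣ p
      ◁-homo x p = Y.≈ᴹ-trans (+-homo _ _) (Y.≈ᴹ-trans
        (Y.+ᴹ-cong (*ᵣ-homo x _) (Y.≈ᴹ-trans (Πᵣ-homo _)
          (Y.≈ᴹ-trans (Y.*ᵣ-cong (*ᵣ-homo x _) (O.refl {ΠO})) (Y.*ᵣ-assoc _ _ ΠO))))
        (Y.≈ᴹ-trans (Y.≈ᴹ-sym (Y.*ᵣ-distribˡ _ _ _))
          (Y.*ᵣ-cong {v = p} Y.≈ᴹ-refl (B.sym (coords-≈ p)))))

      toBimodule-≅ : (∀ {x y} → fun x Y.≈ᴹ fun y → x ≈ᴹ y) → (∀ y → ∃[ x ] fun x Y.≈ᴹ y) → toBimodule ≅ Y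
      toBimodule-≅ = mkIso toBimodule Y fun cong +-homo ▷-homo ◁-homo

  -- Writing an element of O_B as a + bΠ reduces closure under either action of O_B to closure under
  -- O_K and under Πₗ or Πᵣ.
  span⊆stable : (Y : Bimodule O-ring O-ring ℓ ℓ) (agree : ActionsAgree Y ιO ιO) →
                ∀ {n} {g : Vector (Bimodule.Carrierᴹ Y) n} {S} → IsStable (fromBimodule Y agree) S →
                (∀ i → S (g i)) → ∀ {x} → Span Y g x → S x
  span⊆stable Y agree {g = g} {S} stable g∈ = go
    where
    open Bimodule Y
    module S = IsStable stable
    go : ∀ {x} → Span Y g x → S x
    go (gen i)    = g∈ i
    go Span.zero  = S.0∈
    go (add s t)  = S.+∈ (go s) (go t)
    go (actₗ p {x} s) = S.≈-resp
      (≈ᴹ-sym (≈ᴹ-trans (*ₗ-cong {x = p} (coords-≈ p) ≈ᴹ-refl)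
        (≈ᴹ-trans (*ₗ-distribʳ x _ _) (+ᴹ-congˡ (*ₗ-assoc _ ΠO x)))))
      (S.+∈ (S.*ₗ∈ (coord₀ p) (go s)) (S.*ₗ∈ (coord₁ p) (S.Πₗ∈ (go s))))
    go (actᵣ p {x} s) = S.≈-resp
      (≈ᴹ-sym (≈ᴹ-trans (*ᵣ-cong {u = p} ≈ᴹ-refl (coords-≈ p))
        (≈ᴹ-trans (*ᵣ-distribˡ x _ _) (+ᴹ-congˡ (≈ᴹ-sym (*ᵣ-assoc x _ ΠO))))))
      (S.+∈ (S.*ᵣ∈ (coord₀ p) (go s)) (S.Πᵣ∈ (S.*ᵣ∈ (coord₁ p) (go s))))
    go (resp e s) = S.≈-resp e (go s)

  standard-torsionFree : ∀ {m n} → FixedTorsionFree (standard 𝒦 m n)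
  standard-torsionFree a u _ a≉0 e b = VK.*-cancel-0 a≉0 (e b)

  swap-standard-torsionFree : ∀ {m n} → FixedTorsionFree (swap (standard 𝒦 m n))
  swap-standard-torsionFree {m} {n} a u fixed a≉0 e b = VK.*-cancel-0 a≉0
    (K.trans (K.*-congʳ (K.sym (UnramifiedInvolution.twist-fixed 𝒦 (degree 𝒦 b) {a} fixed))) (e b))

  -- Bilattices and truncations in standard form

  module _ (L : Bilattice) where
    open Bilattice L

    private
      π≉0 : ¬ π F.≈ F.0#
      π≉0 = Valuation.finite-valuation⇒≉0 F.discretelyValuedField π-uniformizer

      π-torsionFree : ∀ {x} → πO *ₗ x ≈ᴹ 0ᴹ → x ≈ᴹ 0ᴹ
      π-torsionFree {x} = torsionFree (π , F.Uniformizer⊆𝒪 π-uniformizer) x π≉0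

    bilattice-Π : Π-Bimodule 𝒦
    bilattice-Π = fromBimodule bimodule actionsAgree

    bilattice-generates : Generates bilattice-Π (proj₁ (proj₂ finitelyGenerated))
    bilattice-generates stable g∈ x = span⊆stable bimodule actionsAgree stable g∈ (proj₂ (proj₂ finitelyGenerated) x)

    -- If xΠ = 0, then πx = xπ = xΠΠ = 0, and π is a nonzero element of O_F.
    bilattice-injective : RightInjective bilattice-Π
    bilattice-injective {x} e = π-torsionFree (≈ᴹ-trans (actionsAgree _ x)
      (≈ᴹ-trans (*ᵣ-cong {u = πO} {v = ΠO O.* ΠO} ≈ᴹ-refl (B.sym Π²≈π)) (≈ᴹ-trans (≈ᴹ-sym (*ᵣ-assoc x ΠO ΠO))
        (≈ᴹ-trans (*ᵣ-congʳ e) (*ᵣ-zeroˡ ΠO)))))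

    swap-bilattice-injective : RightInjective (swap bilattice-Π)
    swap-bilattice-injective {x} e = π-torsionFree
      (≈ᴹ-trans (*ₗ-cong {x = πO} {y = ΠO O.* ΠO} (B.sym Π²≈π) ≈ᴹ-refl) (≈ᴹ-trans (*ₗ-assoc ΠO ΠO x)
        (≈ᴹ-trans (*ₗ-congˡ e) (*ₗ-zeroʳ ΠO))))

    standard-≅ : ∀ {m n} → HasBasis bilattice-Π m n → toBimodule (standard 𝒦 m n) ≅ bimodule
    standard-≅ {m} {n} basis = toBimodule-≅ (standard 𝒦 m n) bimodule actionsAgree
      (Parametrization.paramHom 𝒦 bilattice-Π basis)
      (λ {u} {v} → basis⇒injective em bilattice-generates basis bilattice-injective u v)
      (basis⇒surjective em bilattice-generates basis)

    swap-standard-≅ : ∀ {m n} → HasBasis (swap bilattice-Π) m n → toBimodule (swap (standard 𝒦 m n)) ≅ bimodule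
    swap-standard-≅ {m} {n} basis = toBimodule-≅ (swap (standard 𝒦 m n)) bimodule actionsAgree
      (unswapHom (Parametrization.paramHom 𝒦 (swap bilattice-Π) basis))
      (λ {u} {v} → basis⇒injective em generates basis swap-bilattice-injective u v)
      (basis⇒surjective em generates basis)
      where
      generates : Generates (swap bilattice-Π) (proj₁ (proj₂ finitelyGenerated))
      generates = swap-generates {A = bilattice-Π} bilattice-generates

  quotient-isHom : ∀ {I : Pred O.Carrier ℓ} (isIdeal : IsIdeal O-ring I) → IsRingHom O-ring (quotientRing O-ring isIdeal) id
  quotient-isHom isIdeal = mkRingHom O-ring quotient id (λ {x} {y} → Q.≈⇒≋ {x} {y})
    (λ x y → Ring.refl quotient {x O.+ y}) (Ring.refl quotient {O.0#})
    (λ x y → Ring.refl quotient {x O.* y}) (Ring.refl quotient {O.1#}) (λ x → Ring.refl quotient {O.- x})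
    where
    quotient = quotientRing O-ring isIdeal
    module Q = AbelianQuotient O.+-abelianGroup (IsIdeal.isSubgroup isIdeal)

  -- Bimodules over the quotient rings are (O_B, O_B)-bimodules on which the ideals act by zero.
  module Inflation {I J : Pred O.Carrier ℓ} (isIdealI : IsIdeal O-ring I) (isIdealJ : IsIdeal O-ring J)
                   (M : Bimodule (quotientRing O-ring isIdealI) (quotientRing O-ring isIdealJ) ℓ ℓ)
                   (agree : ActionsAgree M ιO ιO) where

    inflate : Bimodule O-ring O-ring ℓ ℓ
    inflate = restrict (quotient-isHom isIdealI) (quotient-isHom isIdealJ) M

    inflate-Π : Π-Bimodule 𝒦
    inflate-Π = fromBimodule inflate agree

    inflate-span : ∀ {n} {g : Vector (Bimodule.Carrierᴹ M) n} {x} → Span M g x → Span inflate g x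
    inflate-span (gen i)    = gen i
    inflate-span Span.zero  = Span.zero
    inflate-span (add s t)  = add (inflate-span s) (inflate-span t)
    inflate-span (actₗ a s) = actₗ a (inflate-span s)
    inflate-span (actᵣ b s) = actᵣ b (inflate-span s)
    inflate-span (resp e s) = resp e (inflate-span s)

    inflate-generates : (fg : FinitelyGenerated M) → Generates inflate-Π (proj₁ (proj₂ fg))
    inflate-generates (_ , _ , spans) stable g∈ x = span⊆stable inflate agree stable g∈ (inflate-span (spans x))

  private
    ΠO≈0 : Ring._≈_ 𝔽q² ΠO O.0#
    ΠO≈0 = O.1# , B.trans (B.+-congˡ (RingProperties.-0#≈0# B.ring))
      (B.trans (B.+-identityʳ Π) (B.sym (B.*-identityʳ Π)))

  module _ (M : 𝔽q²[ε]-𝔽q²-Bimodule) where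
    private module M = 𝔽q²[ε]-𝔽q²-Bimodule M
    open Bimodule M.bimodule
    open Inflation πO-isIdeal ΠO-isIdeal M.bimodule M.actionsAgree public
      using () renaming (inflate to inflateʳ; inflate-Π to Π-bimoduleʳ)
    open Inflation πO-isIdeal ΠO-isIdeal M.bimodule M.actionsAgree using (inflate-generates)

    Π-bimoduleʳ-killed : RightKilled Π-bimoduleʳ
    Π-bimoduleʳ-killed x = ≈ᴹ-trans (*ᵣ-cong {u = ΠO} {v = O.0#} ≈ᴹ-refl ΠO≈0) (*ᵣ-zeroʳ x)

    Π-bimoduleʳ-generates : Generates Π-bimoduleʳ (proj₁ (proj₂ M.finitelyGenerated))
    Π-bimoduleʳ-generates = inflate-generates M.finitelyGenerated

  module _ (M : 𝔽q²-𝔽q²[ε]-Bimodule) where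
    private module M = 𝔽q²-𝔽q²[ε]-Bimodule M
    open Bimodule M.bimodule
    open Inflation ΠO-isIdeal πO-isIdeal M.bimodule M.actionsAgree public
      using () renaming (inflate to inflateˡ; inflate-Π to Π-bimoduleˡ)
    open Inflation ΠO-isIdeal πO-isIdeal M.bimodule M.actionsAgree using (inflate-generates)

    swap-Π-bimoduleˡ-killed : RightKilled (swap Π-bimoduleˡ)
    swap-Π-bimoduleˡ-killed x = ≈ᴹ-trans (*ₗ-cong {x = ΠO} {y = O.0#} ΠO≈0 ≈ᴹ-refl) (*ₗ-zeroˡ x)

    Π-bimoduleˡ-generates : Generates Π-bimoduleˡ (proj₁ (proj₂ M.finitelyGenerated))
    Π-bimoduleˡ-generates = inflate-generates M.finitelyGenerated

  module _ (L : Bilattice) where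
    open Bilattice L

    difference⇒sum : ∀ {x y z} → x +ᴹ -ᴹ y ≈ᴹ z → x ≈ᴹ y +ᴹ z
    difference⇒sum {x} {y} e = ≈ᴹ-trans (≈ᴹ-sym (x∙[y-x]≈y +ᴹ-abelianGroup y x)) (+ᴹ-congˡ e)

    module _ (M : 𝔽q²[ε]-𝔽q²-Bimodule) (α : rightTruncation L ≅ʳ M) where
      private
        module T = 𝔽q²[ε]-𝔽q²-Bimodule (rightTruncation L)
        module M = 𝔽q²[ε]-𝔽q²-Bimodule M
        module α = Iso T.bimodule M.bimodule α
        open AbelianQuotient +ᴹ-abelianGroup (IsSubBimodule.isSubgroup (LΠ-isSubBimodule L)) using (≈⇒≋)

      -- The truncation followed by `α`. With the target free to choose, two bilattices with
      -- isomorphic truncations reduce to one and the same bimodule, as `commonBasis` requires.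
      reduceʳ : Π-Hom 𝒦 (bilattice-Π L) (Π-bimoduleʳ M)
      reduceʳ = record
        { fun = α.to
        ; cong = λ {x} {y} e → α.⟦⟧-cong {x} {y} (≈⇒≋ e)
        ; +-homo = α.+ᴹ-homo
        ; *ₗ-homo = λ a x → α.*ₗ-homo (κO a) x
        ; *ᵣ-homo = λ x a → α.*ᵣ-homo (κO a) x
        ; Πₗ-homo = α.*ₗ-homo ΠO
        ; Πᵣ-homo = α.*ᵣ-homo ΠO
        }

      reduceʳ-reduction : Reduction reduceʳ
      reduceʳ-reduction = (λ y → α.from y , α.to-from y) ,
        λ {x} {y} e → let z , f = α.injective {x} {y} e in z , difference⇒sum f

    module _ (M : 𝔽q²-𝔽q²[ε]-Bimodule) (α : leftTruncation L ≅ˡ M) where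
      private
        module T = 𝔽q²-𝔽q²[ε]-Bimodule (leftTruncation L)
        module M = 𝔽q²-𝔽q²[ε]-Bimodule M
        module α = Iso T.bimodule M.bimodule α
        open AbelianQuotient +ᴹ-abelianGroup (IsSubBimodule.isSubgroup (ΠL-isSubBimodule L)) using (≈⇒≋)

      -- Here it is Πₗ that the truncation kills, so both sides are swapped to make it the right
      -- operator.
      reduceˡ : Π-Hom 𝒦 (swap (bilattice-Π L)) (swap (Π-bimoduleˡ M))
      reduceˡ = record
        { fun = α.to
        ; cong = λ {x} {y} e → α.⟦⟧-cong {x} {y} (≈⇒≋ e)
        ; +-homo = α.+ᴹ-homo
        ; *ₗ-homo = λ a x → α.*ᵣ-homo (κO a) x
        ; *ᵣ-homo = λ x a → α.*ₗ-homo (κO a) x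
        ; Πₗ-homo = α.*ᵣ-homo ΠO
        ; Πᵣ-homo = α.*ₗ-homo ΠO
        }

      reduceˡ-reduction : Reduction reduceˡ
      reduceˡ-reduction = (λ y → α.from y , α.to-from y) ,
        λ {x} {y} e → let z , f = α.injective {x} {y} e in z , difference⇒sum f

  module _ (L L′ : Bilattice) (α : L ≅ᴸ L′) where
    private
      module L = Bilattice L
      module L′ = Bilattice L′
      module α = Iso L.bimodule L′.bimodule α

      to-difference : ∀ x y → α.to (x L.+ᴹ L.-ᴹ y) L′.≈ᴹ α.to x L′.+ᴹ L′.-ᴹ α.to y
      to-difference x y = L′.≈ᴹ-trans (α.+ᴹ-homo x (L.-ᴹ y)) (L′.+ᴹ-congˡ (α.-ᴹ-homo y))

    rightTruncation-cong : rightTruncation L ≅ʳ rightTruncation L′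
    rightTruncation-cong = mkIso T.bimodule T′.bimodule α.to
      (λ { {x} {y} (z , e) → α.to z , L′.≈ᴹ-trans (L′.≈ᴹ-sym (to-difference x y))
             (L′.≈ᴹ-trans (α.⟦⟧-cong e) (α.*ᵣ-homo ΠO z)) })
      (λ x y → ≈⇒≋ (α.+ᴹ-homo x y))
      (λ a x → ≈⇒≋ (α.*ₗ-homo a x))
      (λ x b → ≈⇒≋ (α.*ᵣ-homo b x))
      (λ { {x} {y} (z , e) → α.from z , α.injective (L′.≈ᴹ-trans (to-difference x y)
             (L′.≈ᴹ-trans e (L′.≈ᴹ-trans (L′.*ᵣ-congʳ (L′.≈ᴹ-sym (α.to-from z)))
               (L′.≈ᴹ-sym (α.*ᵣ-homo ΠO (α.from z)))))) })
      (λ y → α.from y , ≈⇒≋ (α.to-from y))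
      where
      module T = 𝔽q²[ε]-𝔽q²-Bimodule (rightTruncation L)
      module T′ = 𝔽q²[ε]-𝔽q²-Bimodule (rightTruncation L′)
      open AbelianQuotient L′.+ᴹ-abelianGroup (IsSubBimodule.isSubgroup (LΠ-isSubBimodule L′)) using (≈⇒≋)

    leftTruncation-cong : leftTruncation L ≅ˡ leftTruncation L′
    leftTruncation-cong = mkIso T.bimodule T′.bimodule α.to
      (λ { {x} {y} (z , e) → α.to z , L′.≈ᴹ-trans (L′.≈ᴹ-sym (to-difference x y))
             (L′.≈ᴹ-trans (α.⟦⟧-cong e) (α.*ₗ-homo ΠO z)) })
      (λ x y → ≈⇒≋ (α.+ᴹ-homo x y))
      (λ a x → ≈⇒≋ (α.*ₗ-homo a x))
      (λ x b → ≈⇒≋ (α.*ᵣ-homo b x))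
      (λ { {x} {y} (z , e) → α.from z , α.injective (L′.≈ᴹ-trans (to-difference x y)
             (L′.≈ᴹ-trans e (L′.≈ᴹ-trans (L′.*ₗ-congˡ (L′.≈ᴹ-sym (α.to-from z)))
               (L′.≈ᴹ-sym (α.*ₗ-homo ΠO (α.from z)))))) })
      (λ y → α.from y , ≈⇒≋ (α.to-from y))
      where
      module T = 𝔽q²-𝔽q²[ε]-Bimodule (leftTruncation L)
      module T′ = 𝔽q²-𝔽q²[ε]-Bimodule (leftTruncation L′)
      open AbelianQuotient L′.+ᴹ-abelianGroup (IsSubBimodule.isSubgroup (ΠL-isSubBimodule L′)) using (≈⇒≋)

  bilattice-basis : ∀ L → ∃[ m ] ∃[ n ] HasBasis (bilattice-Π L) m n
  bilattice-basis L = injective⇒basis em (bilattice-generates L) (bilattice-injective L)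

  swap-bilattice-basis : ∀ L → ∃[ m ] ∃[ n ] HasBasis (swap (bilattice-Π L)) m n
  swap-bilattice-basis L = injective⇒basis em
    (swap-generates {A = bilattice-Π L} (bilattice-generates L)) (swap-bilattice-injective L)

  rightTruncation-injective : ∀ {L L′} → rightTruncation L ≅ʳ rightTruncation L′ → L ≅ᴸ L′
  rightTruncation-injective {L} {L′} α =
    -- The truncation of `L′` is the common target, reached from `L` through `α` and from `L′`
    -- through the identity.
    let identity = ≅-refl (𝔽q²[ε]-𝔽q²-Bimodule.bimodule (rightTruncation L′))
        m , n , b , b′ = commonBasis (reduceʳ L (rightTruncation L′) α) (reduceʳ L′ (rightTruncation L′) identity)
          (reduceʳ-reduction L (rightTruncation L′) α) (reduceʳ-reduction L′ (rightTruncation L′) identity)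
          (bilattice-basis L) (bilattice-basis L′)
        std = toBimodule (standard 𝒦 m n)
        X = Bilattice.bimodule L
        X′ = Bilattice.bimodule L′
    in ≅-trans X std X′ (≅-sym std X (standard-≅ L b)) (standard-≅ L′ b′)

  leftTruncation-injective : ∀ {L L′} → leftTruncation L ≅ˡ leftTruncation L′ → L ≅ᴸ L′
  leftTruncation-injective {L} {L′} α =
    let identity = ≅-refl (𝔽q²-𝔽q²[ε]-Bimodule.bimodule (leftTruncation L′))
        m , n , b , b′ = commonBasis (reduceˡ L (leftTruncation L′) α) (reduceˡ L′ (leftTruncation L′) identity)
          (reduceˡ-reduction L (leftTruncation L′) α) (reduceˡ-reduction L′ (leftTruncation L′) identity)
          (swap-bilattice-basis L) (swap-bilattice-basis L′)
        std = toBimodule (swap (standard 𝒦 m n))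
        X = Bilattice.bimodule L
        X′ = Bilattice.bimodule L′
    in ≅-trans X std X′ (≅-sym std X (swap-standard-≅ L b)) (swap-standard-≅ L′ b′)

  module _ {m n : ℕ × ℕ} where
    standardBilattice swapStandardBilattice : Bilattice
    standardBilattice = toBilattice (standard 𝒦 m n) (standard-generates {𝒦 = 𝒦}) standard-torsionFree
    swapStandardBilattice = toBilattice (swap (standard 𝒦 m n))
      (swap-generates {A = standard 𝒦 m n} (standard-generates {𝒦 = 𝒦})) swap-standard-torsionFree

  module _ (M : 𝔽q²[ε]-𝔽q²-Bimodule) {m n} (basis : HasBasis (Π-bimoduleʳ M) m n) where
    private
      module M = 𝔽q²[ε]-𝔽q²-Bimodule M
      module T = 𝔽q²[ε]-𝔽q²-Bimodule (rightTruncation (standardBilattice {m} {n}))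
      module MB = Bimodule M.bimodule
      module Std = Π-Bimodule (standard 𝒦 m n)
      open Parametrization 𝒦 (Π-bimoduleʳ M) basis using (paramHom; param)
      module param = Π-Hom paramHom

      param-cong : ∀ u v → LΠ (standardBilattice {m} {n}) (u Std.+ᴹ Std.-ᴹ v) → param u MB.≈ᴹ param v
      param-cong u v (z , e) = MB.≈ᴹ-trans (param.cong {u} {v Std.+ᴹ Std.Πᵣ z} u≈)
        (MB.≈ᴹ-trans (param.+-homo v (Std.Πᵣ z)) (MB.≈ᴹ-trans (MB.+ᴹ-congˡ
          (MB.≈ᴹ-trans (param.Πᵣ-homo z) (Π-bimoduleʳ-killed M (param z)))) (MB.+ᴹ-identityʳ _)))
        where
        u≈ : u Std.≈ᴹ v Std.+ᴹ Std.Πᵣ z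
        u≈ = difference⇒sum (standardBilattice {m} {n}) {u} {v} {Std.Πᵣ z}
               (Std.≈ᴹ-trans {u Std.+ᴹ Std.-ᴹ v} {_◁_ (standard 𝒦 m n) z ΠO} {Std.Πᵣ z} e (◁-Π (standard 𝒦 m n) z))

    -- The map comes from an adapted basis of M itself, through `param`. It kills the multiples of Π
    -- on the right because M does, and `basis⇒kernel` shows that it kills nothing else.
    rightTruncation-standard : rightTruncation (standardBilattice {m} {n}) ≅ʳ M
    rightTruncation-standard = mkIso T.bimodule M.bimodule param
      (λ {u} {v} → param-cong u v)
      param.+-homo
      (▷-homo (standard 𝒦 m n) (inflateʳ M) M.actionsAgree paramHom)
      (◁-homo (standard 𝒦 m n) (inflateʳ M) M.actionsAgree paramHom)
      (λ {u} {v} e → let w , f = basis⇒kernel em (Π-bimoduleʳ-generates M) basis u v e in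
        w , λ b → R.trans {(u Std.+ᴹ Std.-ᴹ v) b} {Std.Πᵣ w b} {_◁_ (standard 𝒦 m n) w ΠO b}
              (f b) (R.sym {_◁_ (standard 𝒦 m n) w ΠO b} {Std.Πᵣ w b} (◁-Π (standard 𝒦 m n) w b)))
      (basis⇒surjective em (Π-bimoduleʳ-generates M) basis)

  module _ (M : 𝔽q²-𝔽q²[ε]-Bimodule) {m n} (basis : HasBasis (swap (Π-bimoduleˡ M)) m n) where
    private
      module M = 𝔽q²-𝔽q²[ε]-Bimodule M
      module T = 𝔽q²-𝔽q²[ε]-Bimodule (leftTruncation (swapStandardBilattice {m} {n}))
      module MB = Bimodule M.bimodule
      module Std = Π-Bimodule (standard 𝒦 m n)
      swapStd = swap (standard 𝒦 m n)
      open Parametrization 𝒦 (swap (Π-bimoduleˡ M)) basis using (paramHom; param)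
      module param = Π-Hom paramHom

      generates : Generates (swap (Π-bimoduleˡ M)) (proj₁ (proj₂ M.finitelyGenerated))
      generates = swap-generates {A = Π-bimoduleˡ M} (Π-bimoduleˡ-generates M)

      param-cong : ∀ u v → ΠL (swapStandardBilattice {m} {n}) (u Std.+ᴹ Std.-ᴹ v) → param u MB.≈ᴹ param v
      param-cong u v (z , e) = MB.≈ᴹ-trans (param.cong {u} {v Std.+ᴹ Std.Πᵣ z} u≈)
        (MB.≈ᴹ-trans (param.+-homo v (Std.Πᵣ z)) (MB.≈ᴹ-trans (MB.+ᴹ-congˡ
          (MB.≈ᴹ-trans (param.Πᵣ-homo z) (swap-Π-bimoduleˡ-killed M (param z)))) (MB.+ᴹ-identityʳ _)))
        where
        u≈ : u Std.≈ᴹ v Std.+ᴹ Std.Πᵣ z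
        u≈ = difference⇒sum (swapStandardBilattice {m} {n}) {u} {v} {Std.Πᵣ z}
               (Std.≈ᴹ-trans {u Std.+ᴹ Std.-ᴹ v} {_▷_ swapStd ΠO z} {Std.Πᵣ z} e (Π-▷ swapStd z))

    leftTruncation-standard : leftTruncation (swapStandardBilattice {m} {n}) ≅ˡ M
    leftTruncation-standard = mkIso T.bimodule M.bimodule param
      (λ {u} {v} → param-cong u v)
      param.+-homo
      (▷-homo swapStd (inflateˡ M) M.actionsAgree (unswapHom paramHom))
      (◁-homo swapStd (inflateˡ M) M.actionsAgree (unswapHom paramHom))
      (λ {u} {v} e → let w , f = basis⇒kernel em generates basis u v e in
        w , λ b → R.trans {(u Std.+ᴹ Std.-ᴹ v) b} {Std.Πᵣ w b} {_▷_ swapStd ΠO w b}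
              (f b) (R.sym {_▷_ swapStd ΠO w b} {Std.Πᵣ w b} (Π-▷ swapStd w b)))
      (basis⇒surjective em generates basis)

  rightTruncation-surjective : ∀ M → ∃[ L ] rightTruncation L ≅ʳ M
  rightTruncation-surjective M =
    let m , n , basis = killed⇒basis em (Π-bimoduleʳ-generates M) (Π-bimoduleʳ-killed M)
    in standardBilattice {m} {n} , rightTruncation-standard M basis

  leftTruncation-surjective : ∀ M → ∃[ L ] leftTruncation L ≅ˡ M
  leftTruncation-surjective M =
    let m , n , basis = killed⇒basis em (swap-generates {A = Π-bimoduleˡ M} (Π-bimoduleˡ-generates M))
                          (swap-Π-bimoduleˡ-killed M)
    in swapStandardBilattice {m} {n} , leftTruncation-standard M basis

corollary2p2p3 : ∀ {ℓ} → ExcludedMiddle ℓ →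
    (F : NonarchimedeanLocalField ℓ) (D : QuaternionDatum F) →
    let open QuaternionDatum D in
    IsBijection _≅ᴸ_ _≅ʳ_ rightTruncation × IsBijection _≅ᴸ_ _≅ˡ_ leftTruncation
corollary2p2p3 {ℓ} em F D = record
  { isInjection = record
    { isCongruent = record
      { cong = λ {L} {L′} → rightTruncation-cong em D L L′
      ; isEquivalence₁ = ≅ᴸ-isEquivalence
      ; isEquivalence₂ = On.isEquivalence R.bimodule ≅-isEquivalence
      }
    ; injective = λ {L} {L′} → rightTruncation-injective em D {L} {L′}
    }
  ; surjective = λ M → let L , α = rightTruncation-surjective em D M in
      L , λ {L′} β → ≅-trans (R.bimodule (rightTruncation L′)) (R.bimodule (rightTruncation L)) (R.bimodule M)
        (rightTruncation-cong em D L′ L β) α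
  } , record
  { isInjection = record
    { isCongruent = record
      { cong = λ {L} {L′} → leftTruncation-cong em D L L′
      ; isEquivalence₁ = ≅ᴸ-isEquivalence
      ; isEquivalence₂ = On.isEquivalence L.bimodule ≅-isEquivalence
      }
    ; injective = λ {L} {L′} → leftTruncation-injective em D {L} {L′}
    }
  ; surjective = λ M → let L , α = leftTruncation-surjective em D M in
      L , λ {L′} β → ≅-trans (L.bimodule (leftTruncation L′)) (L.bimodule (leftTruncation L)) (L.bimodule M)
        (leftTruncation-cong em D L′ L β) α
  }
  where
  open QuaternionDatum D
  module R = 𝔽q²[ε]-𝔽q²-Bimodule
  module L = 𝔽q²-𝔽q²[ε]-Bimodule
  ≅ᴸ-isEquivalence : IsEquivalence _≅ᴸ_
  ≅ᴸ-isEquivalence = On.isEquivalence Bilattice.bimodule ≅-isEquivalence
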